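{- Let $p\ge5$ be a prime with Legendre symbol $\left(\frac{ -18}{p}\right)=-1$, and let $m\ge0$, $\alpha\ge0$, $n\ge0$ be integers. Then for every integer $i$ with $1\le i\le p-1$, $$\overline{S}_3^{\,8m+1}\big(48p^{2\alpha+2}n+2(24i+11p)p^{2\alpha+1}\big)\equiv0\pmod{16}.$$
   Context: For $|q|<1$ and a positive integer $k$, write $f_k=\prod_{j\ge1}(1-q^{kj})$. For a positive integer $r$, $\overline{S}_3^{\,r}(n)$ (number of $3$-Schur overpartitions of $n$ with $r$-tuples) is defined by $\sum_{n\ge0}\overline{S}_3^{\,r}(n)q^n=\prod_{n\ge1}\frac{(1+q^{2n-1})^r(1-q^{3(2n-1)})^r}{(1+q^{3(2n-1)})^r(1-q^{2n-1})^r}=\frac{f_2^{3r}f_3^{2r}f_{12}^r}{f_1^{2r}f_4^rf_6^{3r}}$. -}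

module Defs where

open import Data.Nat as ℕ using (ℕ; zero; suc)
open import Data.Integer using (ℤ; +_; -[1+_]; _+_; _*_; _-_; -_; 0ℤ; 1ℤ)
open import Data.Integer.Divisibility using (_∣_)
open import Data.Product using (_×_; ∃-syntax)
open import Relation.Nullary using (¬_; yes; no)

Series : Set
Series = ℕ → ℤ

sumTo : ℕ → (ℕ → ℤ) → ℤ
sumTo zero    f = f 0
sumTo (suc n) f = sumTo n f + f (suc n)

δ : ℕ → ℕ → ℤ
δ a b with a ℕ.≟ b
... | yes _ = 1ℤ
... | no  _ = 0ℤ

oneS : Series
oneS n = δ n 0

_⊛_ : Series → Series → Series
(f ⊛ g) n = sumTo n (λ k → f k * g (n ℕ.∸ k))

powS : ℕ → Series → Series
powS zero    s = oneS
powS (suc r) s = s ⊛ powS r s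

binom : ℤ → ℕ → Series
binom c d n = δ n 0 + c * δ n d

-- 1 / (1 - x q^d) = Σ_k x^k q^(k d), for d ≥ 1
zpow : ℤ → ℕ → ℤ
zpow x zero    = 1ℤ
zpow x (suc k) = x * zpow x k

geom : ℤ → ℕ → Series
geom x d n = sumTo n (λ k → zpow x k * δ (k ℕ.* d) n)

factor : ℕ → Series
factor j = binom 1ℤ d ⊛ (binom (- 1ℤ) (3 ℕ.* d) ⊛ (geom (- 1ℤ) (3 ℕ.* d) ⊛ geom 1ℤ d))
  where d = suc (2 ℕ.* j)

prodTo : ℕ → (ℕ → Series) → Series
prodTo zero    s = s 0
prodTo (suc n) s = prodTo n s ⊛ s (suc n)

-- \overline{S}_3^{r}(N): coefficient of q^N in
--   Π_{n≥1} ((1+q^{2n-1})(1-q^{3(2n-1)}) / ((1+q^{3(2n-1)})(1-q^{2n-1})))^r .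
-- Factors with 2n-1 > N are ≡ 1 mod q^{N+1}, so truncating at n ≤ N+1 is exact.
S3bar : ℕ → ℕ → ℤ
S3bar r N = prodTo N (λ j → powS r (factor j)) N

LegendreIsMinusOne : ℤ → ℕ → Set
LegendreIsMinusOne a p = ¬ ((+ p) ∣ a) × ¬ (∃[ x ] ((+ p) ∣ (x * x - a)))

{-# OPTIONS --safe #-}
module Submission where

-- Write φ(q) = Σ q^(k²), ψ(q) = Σ q^(k(k+1)/2), f_k = ∏ (1 - q^(kj)), and let F be
-- the generating function for r = 1.  The Jacobi triple product gives
-- F = φ(q) φ(-q³) / (φ(-q²) φ(-q⁶)).  Every φ is 1 modulo 2, so F⁸ ≡ φ⁸ ≡ 1 (mod 16),
-- which reduces r = 8m + 1 to r = 1 and replaces 1/φ by φ⁷.  The coefficients of F at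
-- 48K + 22 are then reached by successive dissections, each line keeping one residue
-- class of exponents (rescaled to a series in q again):
--   * 0 mod 2: F gives φ(q) φ(q³) (φ(-q²) φ(-q⁶))⁷;
--   * 1 mod 2: φ(q) φ(q³) gives 2 ψ(q) ψ(q³), by a bijection for x² + 3y²;
--   * 2 mod 3: ψ(q) φ(-q)³ gives 6 φ(-q³)² ψ(q³) f(-q, -q⁵);
--   * 1 mod 2: f(-q, -q⁵) ψ(q) = f₂ ψ(q³) and the same bijection give 2 (f₂ ψ(q³))².
-- Modulo 16 the result is 8 times the square of the coefficient of q^K in f₂ ψ(q³).
-- By Euler's pentagonal number theorem this coefficient is 0 unless 24K + 11 is of
-- the form 2X² + 9Y².  As -18 is not a square modulo p, p divides any value of this
-- form to an even power, whereas it divides p^(2α+1) (24(pn + i) + 11p) to an odd one.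

open import Defs
open import Data.Nat using (ℕ; _+_; _*_; _^_; _≤_; _∸_)
open import Data.Nat.Primality using (Prime)
open import Data.Integer using (+_; -[1+_])
open import Data.Integer.Divisibility using (_∣_)
open import Data.Nat using (zero; suc; _<_; z≤n; s≤s; NonZero; >-nonZero⁻¹; ≢-nonZero⁻¹)
open import Data.Nat.Primality using (euclidsLemma; prime⇒irreducible; prime⇒nonZero)
open import Data.Integer as ℤ using (ℤ; 0ℤ; 1ℤ; -1ℤ)
  renaming (_+_ to infixl 6 _+ᶻ_; _*_ to infixl 7 _*ᶻ_; -_ to infix 8 -ᶻ_)
open import Algebra.Bundles using (CommutativeRing)
import Algebra.Solver.CommutativeMonoid
import Algebra.Solver.Ring
open import Algebra.Solver.Ring.AlmostCommutativeRing using (fromCommutativeRing; _-Raw-AlmostCommutative⟶_)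
import Data.Integer.Divisibility.Signed as Signed
import Data.Integer.Properties as ℤₚ
open import Algebra.Properties.AbelianGroup ℤₚ.+-0-abelianGroup using () renaming (∙-cancelʳ to +ᶻ-cancelʳ)
open import Data.Integer.Tactic.RingSolver using () renaming (solve-∀ to ℤ-solve)
import Data.Maybe as Maybe
open import Data.Nat.Coprimality using (Coprime; coprime-Bézout)
import Data.Nat.Divisibility as ℕᵈ
open import Data.Nat.DivMod using (_%_; _/_; m≡m%n+[m/n]*n; m%n<n; m<n⇒m%n≡m; [m+kn]%n≡m%n; m*n%n≡0; %-distribˡ-*)
open import Data.Nat.GCD using (module Bézout)
import Data.Nat.Properties as ℕₚ
open import Data.Nat.Tactic.RingSolver using () renaming (solve-∀ to ℕ-solve)
open import Data.Empty using (⊥; ⊥-elim)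
open import Data.Product using (Σ; _,_; proj₁; proj₂; ∃-syntax)
open import Data.Sum using (_⊎_; inj₁; inj₂)
open import Function using (_∘_; _$_)
open import Level using (0ℓ)
open import Relation.Binary using (Setoid)
import Relation.Binary.Reasoning.Setoid as SetoidReasoning
open import Relation.Binary.PropositionalEquality
  using (_≡_; _≢_; refl; sym; trans; cong; cong₂; subst; module ≡-Reasoning)
open import Relation.Nullary using (¬_; yes; no)
open import Relation.Nullary.Decidable using (dec⇒maybe; from-yes; _⊎-dec_)

-- The ring of formal power series

-- No limits occur: each coefficient of an infinite product or of a sum over ℤ is computed from a
-- finite truncation, and equality up to q^N takes the place of convergence. No quotients occur
-- either: identities are stated with denominators multiplied out and proved by cancelling a series
-- with constant term 1. The dissections stay manageable because each result is rearranged, before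
-- the next step, into a series in q^d times a short product, where d is the next modulus; only the
-- short product then has to be dissected. Such rearrangements hold only modulo a limited power of
-- 2, and the numerical factors split off on the way pay for them: with 2 outside, congruences
-- modulo 8 suffice, and with 2 · 6 outside, congruences modulo 4. The last dissection makes the
-- factor 2 · 6 · 2 = 24, and the final evenness of a coefficient turns it into a multiple of 48 = 3
-- · 16.

sumTo-cong≤ : ∀ n {f g : ℕ → ℤ} → (∀ k → k ≤ n → f k ≡ g k) → sumTo n f ≡ sumTo n g
sumTo-cong≤ zero    h = h 0 z≤n
sumTo-cong≤ (suc n) h =
  cong₂ _+ᶻ_ (sumTo-cong≤ n (λ k k≤n → h k (ℕₚ.m≤n⇒m≤1+n k≤n))) (h (suc n) ℕₚ.≤-refl)

sumTo-cong : ∀ n {f g : ℕ → ℤ} → (∀ k → f k ≡ g k) → sumTo n f ≡ sumTo n g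
sumTo-cong n h = sumTo-cong≤ n (λ k _ → h k)

+ᶻ-interchange : ∀ a b c d → (a +ᶻ b) +ᶻ (c +ᶻ d) ≡ (a +ᶻ c) +ᶻ (b +ᶻ d)
+ᶻ-interchange = ℤ-solve

sumTo-+ : ∀ n (f g : ℕ → ℤ) → sumTo n (λ k → f k +ᶻ g k) ≡ sumTo n f +ᶻ sumTo n g
sumTo-+ zero    f g = refl
sumTo-+ (suc n) f g = trans (cong (_+ᶻ (f (suc n) +ᶻ g (suc n))) (sumTo-+ n f g))
  (+ᶻ-interchange (sumTo n f) (sumTo n g) (f (suc n)) (g (suc n)))

sumTo-*ˡ : ∀ n c (f : ℕ → ℤ) → sumTo n (λ k → c *ᶻ f k) ≡ c *ᶻ sumTo n f
sumTo-*ˡ zero    c f = refl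
sumTo-*ˡ (suc n) c f = trans (cong (_+ᶻ c *ᶻ f (suc n)) (sumTo-*ˡ n c f))
  (sym (ℤₚ.*-distribˡ-+ c (sumTo n f) (f (suc n))))

sumTo-0 : ∀ n {f : ℕ → ℤ} → (∀ k → k ≤ n → f k ≡ 0ℤ) → sumTo n f ≡ 0ℤ
sumTo-0 zero    h = h 0 z≤n
sumTo-0 (suc n) h =
  cong₂ _+ᶻ_ (sumTo-0 n (λ k k≤n → h k (ℕₚ.m≤n⇒m≤1+n k≤n))) (h (suc n) ℕₚ.≤-refl)

sumTo-head : ∀ n (f : ℕ → ℤ) → sumTo (suc n) f ≡ f 0 +ᶻ sumTo n (f ∘ suc)
sumTo-head zero    f = refl
sumTo-head (suc n) f = trans (cong (_+ᶻ f (suc (suc n))) (sumTo-head n f))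
  (ℤₚ.+-assoc (f 0) (sumTo n (f ∘ suc)) (f (suc (suc n))))

sumTo-rev : ∀ n (f : ℕ → ℤ) → sumTo n f ≡ sumTo n (λ k → f (n ∸ k))
sumTo-rev zero    f = refl
sumTo-rev (suc n) f = begin
  sumTo n f +ᶻ f (suc n)                     ≡⟨ ℤₚ.+-comm (sumTo n f) (f (suc n)) ⟩
  f (suc n) +ᶻ sumTo n f                     ≡⟨ cong (f (suc n) +ᶻ_) (sumTo-rev n f) ⟩
  f (suc n) +ᶻ sumTo n (λ k → f (n ∸ k))     ≡⟨ sumTo-head n (λ k → f (suc n ∸ k)) ⟨
  sumTo (suc n) (λ k → f (suc n ∸ k))        ∎
  where open ≡-Reasoning

δ-≡ : ∀ {a b} → a ≡ b → δ a b ≡ 1ℤ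
δ-≡ {a} {b} p with a ℕₚ.≟ b
... | yes _ = refl
... | no ¬p = ⊥-elim (¬p p)

δ-≢ : ∀ {a b} → a ≢ b → δ a b ≡ 0ℤ
δ-≢ {a} {b} ¬p with a ℕₚ.≟ b
... | yes p = ⊥-elim (¬p p)
... | no _  = refl

δ-⇔ : ∀ {a b c d} → (a ≡ b → c ≡ d) → (c ≡ d → a ≡ b) → δ a b ≡ δ c d
δ-⇔ {a} {b} f g with a ℕₚ.≟ b
... | yes p = sym (δ-≡ (f p))
... | no ¬p = sym (δ-≢ (¬p ∘ g))

δ-comm : ∀ a b → δ a b ≡ δ b a
δ-comm a b = δ-⇔ sym sym

infix 4 _≈_
-- A record, rather than a bare family of equations, so that both series can be inferred from an
-- equation between them.
record _≈_ (f g : Series) : Set where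
  constructor pointwise
  field at : ∀ n → f n ≡ g n
open _≈_

zeroS : Series
zeroS _ = 0ℤ

-- Opacity keeps series expressions from unfolding into sums of integers; coefficients are reached
-- through lemmas such as `⊕-at`.
opaque
  infixl 6 _⊕_
  _⊕_ : Series → Series → Series
  (f ⊕ g) n = f n +ᶻ g n

  infix 8 ⊖_
  ⊖_ : Series → Series
  (⊖ f) n = -ᶻ f n

  const : ℤ → Series
  const c n = c *ᶻ δ n 0

  ⊕-at : ∀ f g n → (f ⊕ g) n ≡ f n +ᶻ g n
  ⊕-at f g n = refl

  const-at : ∀ c n → const c n ≡ c *ᶻ δ n 0
  const-at c n = refl

  ⊕-cong : ∀ {f f′ g g′} → f ≈ f′ → g ≈ g′ → f ⊕ g ≈ f′ ⊕ g′
  ⊕-cong p q = pointwise λ n → cong₂ _+ᶻ_ (at p n) (at q n)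

  ⊖-cong : ∀ {f f′} → f ≈ f′ → ⊖ f ≈ ⊖ f′
  ⊖-cong p = pointwise λ n → cong -ᶻ_ (at p n)

  ⊕-assoc : ∀ f g h → (f ⊕ g) ⊕ h ≈ f ⊕ (g ⊕ h)
  ⊕-assoc f g h = pointwise λ n → ℤₚ.+-assoc (f n) (g n) (h n)

  ⊕-comm : ∀ f g → f ⊕ g ≈ g ⊕ f
  ⊕-comm f g = pointwise λ n → ℤₚ.+-comm (f n) (g n)

  ⊕-identityˡ : ∀ f → zeroS ⊕ f ≈ f
  ⊕-identityˡ f = pointwise λ n → ℤₚ.+-identityˡ (f n)

  ⊕-identityʳ : ∀ f → f ⊕ zeroS ≈ f
  ⊕-identityʳ f = pointwise λ n → ℤₚ.+-identityʳ (f n)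

  ⊖-inverseˡ : ∀ f → ⊖ f ⊕ f ≈ zeroS
  ⊖-inverseˡ f = pointwise λ n → ℤₚ.+-inverseˡ (f n)

  ⊖-inverseʳ : ∀ f → f ⊕ ⊖ f ≈ zeroS
  ⊖-inverseʳ f = pointwise λ n → ℤₚ.+-inverseʳ (f n)

  const-+ : ∀ x y → const (x +ᶻ y) ≈ const x ⊕ const y
  const-+ x y = pointwise λ n → ℤₚ.*-distribʳ-+ (δ n 0) x y

  const-neg : ∀ x → const (-ᶻ x) ≈ ⊖ const x
  const-neg x = pointwise λ n → sym (ℤₚ.neg-distribˡ-* x (δ n 0))

  const-0 : const 0ℤ ≈ zeroS
  const-0 = pointwise λ n → refl

infixl 7 _·_
_·_ : ℤ → Series → Series
(c · f) n = c *ᶻ f n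

opaque
  infixl 7 _∙_
  _∙_ : Series → Series → Series
  _∙_ = _⊛_

  ∙-at : ∀ f g n → (f ∙ g) n ≡ sumTo n (λ k → f k *ᶻ g (n ∸ k))
  ∙-at f g n = refl

  ⊛≈∙ : ∀ f g → f ⊛ g ≈ f ∙ g
  ⊛≈∙ f g = pointwise λ n → refl

-- The series (f - f 0) / q. Together with `∙-suc` it turns statements about coefficients of
-- products into inductions.
tail : Series → Series
tail f n = f (suc n)

∙-suc : ∀ f g n → (f ∙ g) (suc n) ≡ f 0 *ᶻ g (suc n) +ᶻ (tail f ∙ g) n
∙-suc f g n = trans (∙-at f g (suc n)) (trans (sumTo-head n (λ k → f k *ᶻ g (suc n ∸ k)))
  (cong (f 0 *ᶻ g (suc n) +ᶻ_) (sym (∙-at (tail f) g n))))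

∙-cong-at : ∀ {f f′ g g′} n → (∀ k → k ≤ n → f k ≡ f′ k) → (∀ k → k ≤ n → g k ≡ g′ k) →
  (f ∙ g) n ≡ (f′ ∙ g′) n
∙-cong-at {f} {f′} {g} {g′} n p q = trans (∙-at f g n) (trans
  (sumTo-cong≤ n (λ k k≤n → cong₂ _*ᶻ_ (p k k≤n) (q (n ∸ k) (ℕₚ.m∸n≤m n k)))) (sym (∙-at f′ g′ n)))

∙-cong : ∀ {f f′ g g′} → f ≈ f′ → g ≈ g′ → f ∙ g ≈ f′ ∙ g′
∙-cong p q = pointwise (λ n → ∙-cong-at n (λ k _ → at p k) (λ k _ → at q k))

∙-comm : ∀ f g → f ∙ g ≈ g ∙ f
∙-comm f g = pointwise λ n → trans (∙-at f g n) (trans (sumTo-rev n _) (trans (sumTo-cong≤ n (λ k k≤n →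
  trans (cong (λ j → f (n ∸ k) *ᶻ g j) (ℕₚ.m∸[m∸n]≡n k≤n)) (ℤₚ.*-comm (f (n ∸ k)) (g k))))
  (sym (∙-at g f n))))

∙-distribʳ-⊕ : ∀ h f g → (f ⊕ g) ∙ h ≈ f ∙ h ⊕ g ∙ h
∙-distribʳ-⊕ h f g = pointwise λ n → trans (∙-at (f ⊕ g) h n)
  (trans (trans (sumTo-cong n (λ k → trans (cong (_*ᶻ h (n ∸ k)) (⊕-at f g k))
      (ℤₚ.*-distribʳ-+ (h (n ∸ k)) (f k) (g k)))) (sumTo-+ n _ _))
    (trans (sym (cong₂ _+ᶻ_ (∙-at f h n) (∙-at g h n))) (sym (⊕-at (f ∙ h) (g ∙ h) n))))

∙-·ˡ : ∀ c f g → (c · f) ∙ g ≈ c · (f ∙ g)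
∙-·ˡ c f g = pointwise λ n → trans (∙-at (c · f) g n)
  (trans (trans (sumTo-cong n (λ k → ℤₚ.*-assoc c (f k) (g (n ∸ k)))) (sumTo-*ˡ n c _))
    (sym (cong (c *ᶻ_) (∙-at f g n))))

-- Induction on the index for all three series at once: by `∙-suc`, the tail of f g is f 0 times the
-- tail of g, plus (tail f) g, so that coefficient n + 1 reduces to coefficient n for `tail f`.
∙-assoc-at : ∀ n f g h → ((f ∙ g) ∙ h) n ≡ (f ∙ (g ∙ h)) n
∙-assoc-at zero    f g h = begin
  ((f ∙ g) ∙ h) 0          ≡⟨ ∙-at (f ∙ g) h 0 ⟩
  (f ∙ g) 0 *ᶻ h 0         ≡⟨ cong (_*ᶻ h 0) (∙-at f g 0) ⟩
  (f 0 *ᶻ g 0) *ᶻ h 0      ≡⟨ ℤₚ.*-assoc (f 0) (g 0) (h 0) ⟩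
  f 0 *ᶻ (g 0 *ᶻ h 0)      ≡⟨ cong (f 0 *ᶻ_) (∙-at g h 0) ⟨
  f 0 *ᶻ (g ∙ h) 0         ≡⟨ ∙-at f (g ∙ h) 0 ⟨
  (f ∙ (g ∙ h)) 0          ∎
  where open ≡-Reasoning
∙-assoc-at (suc n) f g h = begin
  ((f ∙ g) ∙ h) (suc n)
    ≡⟨ ∙-suc (f ∙ g) h n ⟩
  (f ∙ g) 0 *ᶻ h (suc n) +ᶻ (tail (f ∙ g) ∙ h) n
    ≡⟨ cong (λ u → u *ᶻ h (suc n) +ᶻ (tail (f ∙ g) ∙ h) n) (∙-at f g 0) ⟩
  (f 0 *ᶻ g 0) *ᶻ h (suc n) +ᶻ (tail (f ∙ g) ∙ h) n
    ≡⟨ cong (f 0 *ᶻ g 0 *ᶻ h (suc n) +ᶻ_)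
         (at (∙-cong {tail (f ∙ g)} {(f 0 · tail g) ⊕ tail f ∙ g} (pointwise λ m → trans (∙-suc f g m) (sym (⊕-at (f 0 · tail g) (tail f ∙ g) m))) (pointwise {h} λ _ → refl)) n) ⟩
  (f 0 *ᶻ g 0) *ᶻ h (suc n) +ᶻ (((f 0 · tail g) ⊕ tail f ∙ g) ∙ h) n
    ≡⟨ cong (f 0 *ᶻ g 0 *ᶻ h (suc n) +ᶻ_) (trans (at (∙-distribʳ-⊕ h (f 0 · tail g) (tail f ∙ g)) n) (⊕-at _ _ n)) ⟩
  (f 0 *ᶻ g 0) *ᶻ h (suc n) +ᶻ (((f 0 · tail g) ∙ h) n +ᶻ ((tail f ∙ g) ∙ h) n)
    ≡⟨ cong₂ (λ u v → f 0 *ᶻ g 0 *ᶻ h (suc n) +ᶻ (u +ᶻ v))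
         (at (∙-·ˡ (f 0) (tail g) h) n) (∙-assoc-at n (tail f) g h) ⟩
  (f 0 *ᶻ g 0) *ᶻ h (suc n) +ᶻ (f 0 *ᶻ (tail g ∙ h) n +ᶻ (tail f ∙ (g ∙ h)) n)
    ≡⟨ factor-out (f 0) (g 0) (h (suc n)) ((tail g ∙ h) n) _ ⟩
  f 0 *ᶻ (g 0 *ᶻ h (suc n) +ᶻ (tail g ∙ h) n) +ᶻ (tail f ∙ (g ∙ h)) n
    ≡⟨ cong (λ u → f 0 *ᶻ u +ᶻ (tail f ∙ (g ∙ h)) n) (∙-suc g h n) ⟨
  f 0 *ᶻ (g ∙ h) (suc n) +ᶻ (tail f ∙ (g ∙ h)) n
    ≡⟨ ∙-suc f (g ∙ h) n ⟨
  (f ∙ (g ∙ h)) (suc n) ∎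
  where
  open ≡-Reasoning
  factor-out : ∀ a b c d e → (a *ᶻ b) *ᶻ c +ᶻ (a *ᶻ d +ᶻ e) ≡ a *ᶻ (b *ᶻ c +ᶻ d) +ᶻ e
  factor-out = ℤ-solve

const-∙ : ∀ c f → const c ∙ f ≈ c · f
const-∙ c f = pointwise go
  where
  const-head : ∀ c → const c 0 ≡ c
  const-head c = trans (const-at c 0) (ℤₚ.*-identityʳ c)
  go : ∀ n → (const c ∙ f) n ≡ c *ᶻ f n
  go zero    = trans (∙-at (const c) f 0) (cong (_*ᶻ f 0) (const-head c))
  go (suc n) = begin
    (const c ∙ f) (suc n)                            ≡⟨ ∙-suc (const c) f n ⟩
    const c 0 *ᶻ f (suc n) +ᶻ (tail (const c) ∙ f) n
      ≡⟨ cong₂ _+ᶻ_ (cong (_*ᶻ f (suc n)) (const-head c))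
           (trans (∙-at (tail (const c)) f n) (sumTo-0 n (λ k _ → cong (_*ᶻ f (n ∸ k)) (trans (const-at c (suc k)) (ℤₚ.*-zeroʳ c))))) ⟩
    c *ᶻ f (suc n) +ᶻ 0ℤ                             ≡⟨ ℤₚ.+-identityʳ _ ⟩
    c *ᶻ f (suc n)                                   ∎
    where open ≡-Reasoning

oneS≈const1 : oneS ≈ const 1ℤ
oneS≈const1 = pointwise λ n → sym (trans (const-at 1ℤ n) (ℤₚ.*-identityˡ (δ n 0)))

∙-identityˡ : ∀ f → oneS ∙ f ≈ f
∙-identityˡ f = pointwise λ n →
  trans (at (∙-cong oneS≈const1 (pointwise {f} λ _ → refl)) n)
    (trans (at (const-∙ 1ℤ f) n) (ℤₚ.*-identityˡ (f n)))

∙-distribˡ-⊕ : ∀ h f g → h ∙ (f ⊕ g) ≈ h ∙ f ⊕ h ∙ g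
∙-distribˡ-⊕ h f g = pointwise λ n →
  trans (at (∙-comm h (f ⊕ g)) n) (trans (at (∙-distribʳ-⊕ h f g) n)
    (at (⊕-cong (∙-comm f h) (∙-comm g h)) n))

∙-congˡ : ∀ {f g g′} → g ≈ g′ → f ∙ g ≈ f ∙ g′
∙-congˡ {f} p = ∙-cong (pointwise {f} λ _ → refl) p

∙-congʳ : ∀ {f f′ g} → f ≈ f′ → f ∙ g ≈ f′ ∙ g
∙-congʳ {g = g} p = ∙-cong p (pointwise {g} λ _ → refl)

⊕-congˡ : ∀ {f g g′} → g ≈ g′ → f ⊕ g ≈ f ⊕ g′
⊕-congˡ {f} p = ⊕-cong (pointwise {f} λ _ → refl) p

⊕-congʳ : ∀ {f f′ g} → f ≈ f′ → f ⊕ g ≈ f′ ⊕ g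
⊕-congʳ {g = g} p = ⊕-cong p (pointwise {g} λ _ → refl)

seriesRing : CommutativeRing 0ℓ 0ℓ
seriesRing = record
  { Carrier = Series ; _≈_ = _≈_ ; _+_ = _⊕_ ; _*_ = _∙_ ; -_ = ⊖_ ; 0# = zeroS ; 1# = oneS
  ; isCommutativeRing = record
    { isRing = record
      { +-isAbelianGroup = record
        { isGroup = record
          { isMonoid = record
            { isSemigroup = record
              { isMagma = record
                { isEquivalence = record
                  { refl  = pointwise λ _ → refl
                  ; sym   = λ p → pointwise λ n → sym (at p n)
                  ; trans = λ p q → pointwise λ n → trans (at p n) (at q n) }
                ; ∙-cong = ⊕-cong }
              ; assoc = ⊕-assoc }
            ; identity = ⊕-identityˡ , ⊕-identityʳ }
          ; inverse = ⊖-inverseˡ , ⊖-inverseʳ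
          ; ⁻¹-cong = ⊖-cong }
        ; comm = ⊕-comm }
      ; *-cong = ∙-cong
      ; *-assoc = λ f g h → pointwise λ n → ∙-assoc-at n f g h
      ; *-identity = ∙-identityˡ
                   , (λ f → pointwise λ n → trans (at (∙-comm f oneS) n) (at (∙-identityˡ f) n))
      ; distrib = ∙-distribˡ-⊕ , ∙-distribʳ-⊕ }
    ; *-comm = ∙-comm } }

open CommutativeRing seriesRing using ()
  renaming ( refl to ≈-refl; sym to ≈-sym; trans to ≈-trans; setoid to ≈-setoid
          ; *-assoc to ∙-assoc; *-identityʳ to ∙-identityʳ
           ; zeroʳ to ∙-zeroʳ
           ; *-commutativeMonoid to ∙-commutativeMonoid )

≡⇒≈ : ∀ {f g : Series} → f ≡ g → f ≈ g
≡⇒≈ refl = ≈-refl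

module ≈-Reasoning = SetoidReasoning ≈-setoid

module Mon = Algebra.Solver.CommutativeMonoid ∙-commutativeMonoid
  renaming (_⊕_ to infixl 7 _⊙_)
open Mon using (_⊙_; _⊜_)

const-homomorphism : CommutativeRing.rawRing ℤₚ.+-*-commutativeRing
  -Raw-AlmostCommutative⟶ fromCommutativeRing seriesRing
const-homomorphism = record
  { ⟦_⟧    = const
  ; +-homo = const-+
  ; *-homo = λ x y → pointwise λ n →
      trans (const-at (x *ᶻ y) n) (trans (ℤₚ.*-assoc x y (δ n 0))
        (sym (trans (at (const-∙ x (const y)) n) (cong (x *ᶻ_) (const-at y n)))))
  ; -‿homo = const-neg
  ; 0-homo = const-0
  ; 1-homo = ≈-sym oneS≈const1
  }

module SR = Algebra.Solver.Ring (CommutativeRing.rawRing ℤₚ.+-*-commutativeRing)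
  (fromCommutativeRing seriesRing) const-homomorphism
  (λ x y → Maybe.map (λ p → pointwise λ n → cong (λ c → const c n) p) (dec⇒maybe (x ℤ.≟ y)))
open SR using (_:+_; _:*_; _:=_; con)

∙-interchange : ∀ s t u v → (s ∙ t) ∙ (u ∙ v) ≈ (s ∙ u) ∙ (t ∙ v)
∙-interchange = Mon.solve 4 (λ s t u v → (s ⊙ t) ⊙ (u ⊙ v) ⊜ (s ⊙ u) ⊙ (t ⊙ v)) ≈-refl

-- Infinite products

δ-suc : ∀ a b → δ (suc a) (suc b) ≡ δ a b
δ-suc a b = δ-⇔ ℕₚ.suc-injective (cong suc)

mono : ℕ → Series
mono d n = δ n d

mono-shift : ∀ d f n → (mono d ∙ f) (d + n) ≡ f n
mono-shift zero    f n = at (∙-identityˡ f) n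
mono-shift (suc d) f n = begin
  (mono (suc d) ∙ f) (suc (d + n))            ≡⟨ ∙-suc (mono (suc d)) f (d + n) ⟩
  0ℤ *ᶻ f (suc (d + n)) +ᶻ (tail (mono (suc d)) ∙ f) (d + n)
    ≡⟨ cong₂ _+ᶻ_ (ℤₚ.*-zeroˡ (f (suc (d + n))))
         (at (∙-cong {tail (mono (suc d))} {mono d} (pointwise λ k → δ-suc k d) (≈-refl {f})) (d + n)) ⟩
  0ℤ +ᶻ (mono d ∙ f) (d + n)                  ≡⟨ ℤₚ.+-identityˡ _ ⟩
  (mono d ∙ f) (d + n)                        ≡⟨ mono-shift d f n ⟩
  f n                                         ∎
  where open ≡-Reasoning

mono-below : ∀ d f n → n < d → (mono d ∙ f) n ≡ 0ℤ
mono-below d f n n<d = trans (∙-at (mono d) f n) $ sumTo-0 n λ k k≤n →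
  cong (_*ᶻ f (n ∸ k)) (δ-≢ (ℕₚ.<⇒≢ (ℕₚ.≤-<-trans k≤n n<d)))

mono-+ : ∀ a b → mono a ∙ mono b ≈ mono (a + b)
mono-+ a b = pointwise go
  where
  go : ∀ n → (mono a ∙ mono b) n ≡ δ n (a + b)
  go n with n ℕₚ.<? a
  ... | yes n<a = trans (mono-below a (mono b) n n<a)
        (sym (δ-≢ (ℕₚ.<⇒≢ (ℕₚ.<-≤-trans n<a (ℕₚ.m≤m+n a b)))))
  ... | no n≮a with ℕₚ.m≤n⇒∃[o]m+o≡n (ℕₚ.≮⇒≥ n≮a)
  ... | m , refl = trans (mono-shift a (mono b) m) (δ-⇔ (cong (λ k → a + k)) (ℕₚ.+-cancelˡ-≡ a m b))

mono-cancel : ∀ d {f g} → mono d ∙ f ≈ mono d ∙ g → f ≈ g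
mono-cancel d {f} {g} p = pointwise λ n →
  trans (sym (mono-shift d f n)) (trans (at p (d + n)) (mono-shift d g n))

binom-mono : ∀ c d → binom c d ≈ oneS ⊕ const c ∙ mono d
binom-mono c d = pointwise λ n →
  sym (trans (⊕-at oneS (const c ∙ mono d) n) (cong (δ n 0 +ᶻ_) (at (const-∙ c (mono d)) n)))

infix 4 _≈_upto_
-- Congruence modulo q^(N+1), the substitute for convergence.
record _≈_upto_ (f g : Series) (N : ℕ) : Set where
  constructor agree
  field at≤ : ∀ n → n ≤ N → f n ≡ g n
open _≈_upto_

≈⇒upto : ∀ {f g N} → f ≈ g → f ≈ g upto N
≈⇒upto p = agree λ n _ → at p n

upto-refl : ∀ {f N} → f ≈ f upto N
upto-refl = agree λ _ _ → refl

upto-sym : ∀ {f g N} → f ≈ g upto N → g ≈ f upto N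
upto-sym p = agree λ n n≤N → sym (at≤ p n n≤N)

upto-trans : ∀ {f g h N} → f ≈ g upto N → g ≈ h upto N → f ≈ h upto N
upto-trans p q = agree λ n n≤N → trans (at≤ p n n≤N) (at≤ q n n≤N)

upto-mono : ∀ {f g M N} → N ≤ M → f ≈ g upto M → f ≈ g upto N
upto-mono N≤M p = agree λ n n≤N → at≤ p n (ℕₚ.≤-trans n≤N N≤M)

∙-upto : ∀ {f f′ g g′ N} → f ≈ f′ upto N → g ≈ g′ upto N → f ∙ g ≈ f′ ∙ g′ upto N
∙-upto p q = agree λ n n≤N → ∙-cong-at n
  (λ k k≤n → at≤ p k (ℕₚ.≤-trans k≤n n≤N)) (λ k k≤n → at≤ q k (ℕₚ.≤-trans k≤n n≤N))

-- As f 0 = 1, coefficient n of f g is g n plus a combination of earlier coefficients of g, on which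
-- g and h already agree by induction.
∙-cancel-upto : ∀ N {f g h} → f 0 ≡ 1ℤ → f ∙ g ≈ f ∙ h upto N → g ≈ h upto N
∙-cancel-upto N {f} {g} {h} f0 p = agree (go N p)
  where
  head-eq : ∀ u v {x} → x ≡ 1ℤ → x *ᶻ u ≡ x *ᶻ v → u ≡ v
  head-eq u v refl q = trans (sym (ℤₚ.*-identityˡ u)) (trans q (ℤₚ.*-identityˡ v))
  go : ∀ N → f ∙ g ≈ f ∙ h upto N → ∀ n → n ≤ N → g n ≡ h n
  go zero    p .0 z≤n = head-eq _ _ f0 (trans (sym (∙-at f g 0)) (trans (at≤ p 0 z≤n) (∙-at f h 0)))
  go (suc N) p n n≤ with ℕₚ.m≤n⇒m<n∨m≡n n≤
  ... | inj₁ (s≤s n≤N) = go N (upto-mono (ℕₚ.n≤1+n N) p) n n≤N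
  ... | inj₂ refl = head-eq _ _ f0 (+ᶻ-cancelʳ ((tail f ∙ h) N) _ _ (begin
    f 0 *ᶻ g (suc N) +ᶻ (tail f ∙ h) N
      ≡⟨ cong (f 0 *ᶻ g (suc N) +ᶻ_) (∙-cong-at {tail f} {tail f} {g} {h} N (λ _ _ → refl) (go N (upto-mono (ℕₚ.n≤1+n N) p))) ⟨
    f 0 *ᶻ g (suc N) +ᶻ (tail f ∙ g) N   ≡⟨ ∙-suc f g N ⟨
    (f ∙ g) (suc N)                      ≡⟨ at≤ p (suc N) ℕₚ.≤-refl ⟩
    (f ∙ h) (suc N)                      ≡⟨ ∙-suc f h N ⟩
    f 0 *ᶻ h (suc N) +ᶻ (tail f ∙ h) N   ∎))
    where open ≡-Reasoning

∙-cancel : ∀ {f g h} → f 0 ≡ 1ℤ → f ∙ g ≈ f ∙ h → g ≈ h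
∙-cancel f0 p = pointwise λ n → at≤ (∙-cancel-upto n f0 (≈⇒upto p)) n ℕₚ.≤-refl

prodTo-suc : ∀ n s → prodTo (suc n) s ≈ prodTo n s ∙ s (suc n)
prodTo-suc n s = ⊛≈∙ (prodTo n s) (s (suc n))

prodTo-cong : ∀ n {s t : ℕ → Series} → (∀ j → s j ≈ t j) → prodTo n s ≈ prodTo n t
prodTo-cong zero    p = p 0
prodTo-cong (suc n) {s} {t} p = ≈-trans (prodTo-suc n s)
  (≈-trans (∙-cong (prodTo-cong n p) (p (suc n))) (≈-sym (prodTo-suc n t)))

prodTo-∙ : ∀ n (s t : ℕ → Series) → prodTo n (λ j → s j ∙ t j) ≈ prodTo n s ∙ prodTo n t
prodTo-∙ zero    s t = ≈-refl
prodTo-∙ (suc n) s t = ≈-trans (prodTo-suc n _) $ ≈-trans (∙-congʳ (prodTo-∙ n s t)) $ ≈-trans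
  (∙-interchange (prodTo n s) (prodTo n t) (s (suc n)) (t (suc n)))
  (∙-cong (≈-sym (prodTo-suc n s)) (≈-sym (prodTo-suc n t)))

-- A diagonal: coefficient n is taken from the partial product over the indices 0 to n. Under
-- `TendsTo1` the later factors do not change it.
infprod : (ℕ → Series) → Series
infprod s n = prodTo n s n

TendsTo1 : (ℕ → Series) → Set
TendsTo1 s = ∀ j → s j ≈ oneS upto j

prodTo-infprod : ∀ {s} → TendsTo1 s → ∀ {N M} → N ≤ M → prodTo M s ≈ infprod s upto N
prodTo-infprod {s} s→1 {N} {M} N≤M = agree λ n n≤N → stable (ℕₚ.≤-trans n≤N N≤M) n ℕₚ.≤-refl
  where
  stable : ∀ {n M} → n ≤ M → ∀ m → m ≤ n → prodTo M s m ≡ prodTo n s m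
  stable {n} {M} n≤M m m≤n with ℕₚ.m≤n⇒m<n∨m≡n n≤M
  ... | inj₂ refl = refl
  stable {n} {suc M} n≤M m m≤n | inj₁ (s≤s n≤M′) = begin
    prodTo (suc M) s m             ≡⟨ at (prodTo-suc M s) m ⟩
    (prodTo M s ∙ s (suc M)) m
      ≡⟨ ∙-cong-at {prodTo M s} m (λ _ _ → refl) (λ k k≤m →
           at≤ (s→1 (suc M)) k (ℕₚ.≤-trans k≤m (ℕₚ.≤-trans m≤n n≤M))) ⟩
    (prodTo M s ∙ oneS) m          ≡⟨ at (∙-identityʳ (prodTo M s)) m ⟩
    prodTo M s m                   ≡⟨ stable n≤M′ m m≤n ⟩
    prodTo n s m                   ∎
    where open ≡-Reasoning

infprod-cong : ∀ {s t : ℕ → Series} → (∀ j → s j ≈ t j) → infprod s ≈ infprod t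
infprod-cong p = pointwise λ n → at (prodTo-cong n p) n

infprod-∙ : ∀ {s t} → TendsTo1 s → TendsTo1 t →
  infprod (λ j → s j ∙ t j) ≈ infprod s ∙ infprod t
infprod-∙ {s} {t} s→1 t→1 = pointwise λ n → trans (at (prodTo-∙ n s t) n)
  (at≤ (∙-upto (prodTo-infprod s→1 ℕₚ.≤-refl) (prodTo-infprod t→1 ℕₚ.≤-refl)) n ℕₚ.≤-refl)

-- The partial product up to index 2n + 1 contains exactly n + 1 factors of each parity, so the
-- rearrangement is a finite one.
infprod-bisect : ∀ {s} → TendsTo1 s →
  infprod s ≈ infprod (λ j → s (j * 2)) ∙ infprod (λ j → s (1 + j * 2))
infprod-bisect {s} s→1 = pointwise λ n →
  let open ≡-Reasoning in begin
  infprod s n                             ≡⟨ at≤ (prodTo-infprod s→1 (le 1 n)) n ℕₚ.≤-refl ⟨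
  prodTo (1 + n * 2) s n                  ≡⟨ at (finite n) n ⟩
  (prodTo n s₀ ∙ prodTo n s₁) n
    ≡⟨ at≤ (∙-upto (prodTo-infprod (λ j → upto-mono (le 0 j) (s→1 (j * 2))) ℕₚ.≤-refl)
                   (prodTo-infprod (λ j → upto-mono (le 1 j) (s→1 (1 + j * 2))) ℕₚ.≤-refl)) n ℕₚ.≤-refl ⟩
  (infprod s₀ ∙ infprod s₁) n             ∎
  where
  s₀ s₁ : ℕ → Series
  s₀ j = s (j * 2)
  s₁ j = s (1 + j * 2)
  le : ∀ r n → n ≤ r + n * 2
  le r n = ℕₚ.≤-trans (ℕₚ.m≤m*n n 2) (ℕₚ.m≤n+m (n * 2) r)
  finite : ∀ n → prodTo (1 + n * 2) s ≈ prodTo n s₀ ∙ prodTo n s₁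
  finite zero    = prodTo-suc 0 s
  finite (suc n) = begin
    prodTo (3 + n * 2) s                                ≈⟨ prodTo-suc (2 + n * 2) s ⟩
    prodTo (2 + n * 2) s ∙ s₁ (suc n)                   ≈⟨ ∙-congʳ (prodTo-suc (1 + n * 2) s) ⟩
    prodTo (1 + n * 2) s ∙ s₀ (suc n) ∙ s₁ (suc n)      ≈⟨ ∙-congʳ (∙-congʳ (finite n)) ⟩
    prodTo n s₀ ∙ prodTo n s₁ ∙ s₀ (suc n) ∙ s₁ (suc n)
      ≈⟨ Mon.solve 4 (λ a b c d → ((a ⊙ b) ⊙ c) ⊙ d ⊜ (a ⊙ c) ⊙ (b ⊙ d)) ≈-refl
           (prodTo n s₀) (prodTo n s₁) (s₀ (suc n)) (s₁ (suc n)) ⟩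
    (prodTo n s₀ ∙ s₀ (suc n)) ∙ (prodTo n s₁ ∙ s₁ (suc n))
      ≈⟨ ∙-cong (prodTo-suc n s₀) (prodTo-suc n s₁) ⟨
    prodTo (suc n) s₀ ∙ prodTo (suc n) s₁               ∎
    where open ≈-Reasoning

infprod-trisect : ∀ {s} → TendsTo1 s → infprod s ≈
  infprod (λ j → s (j * 3)) ∙ infprod (λ j → s (1 + j * 3)) ∙ infprod (λ j → s (2 + j * 3))
infprod-trisect {s} s→1 = pointwise λ n →
  let open ≡-Reasoning in begin
  infprod s n                             ≡⟨ at≤ (prodTo-infprod s→1 (le 2 n)) n ℕₚ.≤-refl ⟨
  prodTo (2 + n * 3) s n                  ≡⟨ at (finite n) n ⟩
  (prodTo n s₀ ∙ prodTo n s₁ ∙ prodTo n s₂) n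
    ≡⟨ at≤ (∙-upto (∙-upto (prodTo-infprod (λ j → upto-mono (le 0 j) (s→1 (j * 3))) ℕₚ.≤-refl)
                           (prodTo-infprod (λ j → upto-mono (le 1 j) (s→1 (1 + j * 3))) ℕₚ.≤-refl))
                   (prodTo-infprod (λ j → upto-mono (le 2 j) (s→1 (2 + j * 3))) ℕₚ.≤-refl)) n ℕₚ.≤-refl ⟩
  (infprod s₀ ∙ infprod s₁ ∙ infprod s₂) n ∎
  where
  s₀ s₁ s₂ : ℕ → Series
  s₀ j = s (j * 3)
  s₁ j = s (1 + j * 3)
  s₂ j = s (2 + j * 3)
  le : ∀ r n → n ≤ r + n * 3
  le r n = ℕₚ.≤-trans (ℕₚ.m≤m*n n 3) (ℕₚ.m≤n+m (n * 3) r)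
  finite : ∀ n → prodTo (2 + n * 3) s ≈ prodTo n s₀ ∙ prodTo n s₁ ∙ prodTo n s₂
  finite zero    = ≈-trans (prodTo-suc 1 s) (∙-congʳ (prodTo-suc 0 s))
  finite (suc n) = begin
    prodTo (5 + n * 3) s                                          ≈⟨ prodTo-suc (4 + n * 3) s ⟩
    prodTo (4 + n * 3) s ∙ s₂ (suc n)                             ≈⟨ ∙-congʳ (prodTo-suc (3 + n * 3) s) ⟩
    prodTo (3 + n * 3) s ∙ s₁ (suc n) ∙ s₂ (suc n)
      ≈⟨ ∙-congʳ (∙-congʳ (prodTo-suc (2 + n * 3) s)) ⟩
    prodTo (2 + n * 3) s ∙ s₀ (suc n) ∙ s₁ (suc n) ∙ s₂ (suc n)
      ≈⟨ ∙-congʳ (∙-congʳ (∙-congʳ (finite n))) ⟩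
    prodTo n s₀ ∙ prodTo n s₁ ∙ prodTo n s₂ ∙ s₀ (suc n) ∙ s₁ (suc n) ∙ s₂ (suc n)
      ≈⟨ Mon.solve 6 (λ a b c d e f → ((((a ⊙ b) ⊙ c) ⊙ d) ⊙ e) ⊙ f
           ⊜ ((a ⊙ d) ⊙ (b ⊙ e)) ⊙ (c ⊙ f)) ≈-refl
           (prodTo n s₀) (prodTo n s₁) (prodTo n s₂) (s₀ (suc n)) (s₁ (suc n)) (s₂ (suc n)) ⟩
    (prodTo n s₀ ∙ s₀ (suc n)) ∙ (prodTo n s₁ ∙ s₁ (suc n)) ∙ (prodTo n s₂ ∙ s₂ (suc n))
      ≈⟨ ∙-cong (∙-cong (prodTo-suc n s₀) (prodTo-suc n s₁)) (prodTo-suc n s₂) ⟨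
    prodTo (suc n) s₀ ∙ prodTo (suc n) s₁ ∙ prodTo (suc n) s₂     ∎
    where open ≈-Reasoning

-- The q-Pochhammer symbol (-ε q^a; q^c)_∞, that is, the product of 1 + ε q^(a+jc) over j ≥ 0.
qprod : ℤ → ℕ → ℕ → Series
qprod ε a c = infprod (λ j → binom ε (a + j * c))

binom-near-1 : ∀ ε d j → j < d → binom ε d ≈ oneS upto j
binom-near-1 ε d j j<d = agree λ n n≤j → begin
  δ n 0 +ᶻ ε *ᶻ δ n d  ≡⟨ cong (λ u → δ n 0 +ᶻ ε *ᶻ u) (δ-≢ (ℕₚ.<⇒≢ (ℕₚ.≤-<-trans n≤j j<d))) ⟩
  δ n 0 +ᶻ ε *ᶻ 0ℤ     ≡⟨ cong (δ n 0 +ᶻ_) (ℤₚ.*-zeroʳ ε) ⟩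
  δ n 0 +ᶻ 0ℤ          ≡⟨ ℤₚ.+-identityʳ _ ⟩
  δ n 0                ∎
  where open ≡-Reasoning

qprod-tendsTo1 : ∀ ε a c .{{_ : NonZero a}} .{{_ : NonZero c}} → TendsTo1 (λ j → binom ε (a + j * c))
qprod-tendsTo1 ε a c j = binom-near-1 ε (a + j * c) j
  (ℕₚ.+-mono-≤ (>-nonZero⁻¹ a) (ℕₚ.m≤m*n j c))

qprod-bisect : ∀ ε a c .{{_ : NonZero a}} .{{_ : NonZero c}} →
  qprod ε a c ≈ qprod ε a (2 * c) ∙ qprod ε (a + c) (2 * c)
qprod-bisect ε a c = ≈-trans (infprod-bisect (qprod-tendsTo1 ε a c)) (∙-cong
  (infprod-cong λ j → ≡⇒≈ (cong (binom ε) (e₀ a j c)))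
  (infprod-cong λ j → ≡⇒≈ (cong (binom ε) (e₁ a j c))))
  where
  e₀ : ∀ a j c → a + j * 2 * c ≡ a + j * (2 * c)
  e₀ = ℕ-solve
  e₁ : ∀ a j c → a + (1 + j * 2) * c ≡ a + c + j * (2 * c)
  e₁ = ℕ-solve

qprod-trisect : ∀ ε a c .{{_ : NonZero a}} .{{_ : NonZero c}} →
  qprod ε a c ≈ qprod ε a (3 * c) ∙ qprod ε (a + c) (3 * c) ∙ qprod ε (a + 2 * c) (3 * c)
qprod-trisect ε a c = ≈-trans (infprod-trisect (qprod-tendsTo1 ε a c)) (∙-cong (∙-cong
  (infprod-cong λ j → ≡⇒≈ (cong (binom ε) (e₀ a j c)))
  (infprod-cong λ j → ≡⇒≈ (cong (binom ε) (e₁ a j c))))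
  (infprod-cong λ j → ≡⇒≈ (cong (binom ε) (e₂ a j c))))
  where
  e₀ : ∀ a j c → a + j * 3 * c ≡ a + j * (3 * c)
  e₀ = ℕ-solve
  e₁ : ∀ a j c → a + (1 + j * 3) * c ≡ a + c + j * (3 * c)
  e₁ = ℕ-solve
  e₂ : ∀ a j c → a + (2 + j * 3) * c ≡ a + 2 * c + j * (3 * c)
  e₂ = ℕ-solve

binom-squares : ∀ d → binom 1ℤ d ∙ binom -1ℤ d ≈ binom -1ℤ (2 * d)
binom-squares d = begin
  binom 1ℤ d ∙ binom -1ℤ d     ≈⟨ ∙-cong (binom-mono 1ℤ d) (binom-mono -1ℤ d) ⟩
  (oneS ⊕ const 1ℤ ∙ mono d) ∙ (oneS ⊕ const -1ℤ ∙ mono d)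
    ≈⟨ ∙-cong (⊕-congʳ oneS≈const1) (⊕-congʳ oneS≈const1) ⟩
  (const 1ℤ ⊕ const 1ℤ ∙ mono d) ∙ (const 1ℤ ⊕ const -1ℤ ∙ mono d)
    ≈⟨ SR.solve 1 (λ x → (con 1ℤ :+ con 1ℤ :* x) :* (con 1ℤ :+ con -1ℤ :* x)
                     := con 1ℤ :+ con -1ℤ :* (x :* x)) ≈-refl (mono d) ⟩
  const 1ℤ ⊕ const -1ℤ ∙ (mono d ∙ mono d)
    ≈⟨ ⊕-cong oneS≈const1 (∙-congˡ (≈-sym (mono-+ d d))) ⟨
  oneS ⊕ const -1ℤ ∙ mono (d + d)
    ≈⟨ binom-mono -1ℤ (d + d) ⟨
  binom -1ℤ (d + d)            ≈⟨ ≡⇒≈ (cong (λ x → binom -1ℤ (d + x)) (sym (ℕₚ.+-identityʳ d))) ⟩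
  binom -1ℤ (2 * d)            ∎
  where open ≈-Reasoning

qprod-squares : ∀ a c .{{_ : NonZero a}} .{{_ : NonZero c}} →
  qprod 1ℤ a c ∙ qprod -1ℤ a c ≈ qprod -1ℤ (2 * a) (2 * c)
qprod-squares a c = ≈-trans (≈-sym (infprod-∙ (qprod-tendsTo1 1ℤ a c) (qprod-tendsTo1 -1ℤ a c)))
  (infprod-cong λ j → ≈-trans (binom-squares (a + j * c)) (≡⇒≈ (cong (binom -1ℤ) (e a j c))))
  where
  e : ∀ a j c → 2 * (a + j * c) ≡ 2 * a + j * (2 * c)
  e = ℕ-solve

qprod-head : ∀ ε a c .{{_ : NonZero a}} → qprod ε a c 0 ≡ 1ℤ
qprod-head ε a@(suc _) c = trans (cong (1ℤ +ᶻ_) (ℤₚ.*-zeroʳ ε)) refl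

-- Sums over ℤ and theta series

zsum : ℕ → (ℤ → ℤ) → ℤ
zsum zero    u = u 0ℤ
zsum (suc B) u = zsum B u +ᶻ (u (+ suc B) +ᶻ u -[1+ B ])

zsum-cong≤ : ∀ B {u v : ℤ → ℤ} → (∀ k → ℤ.∣ k ∣ ≤ B → u k ≡ v k) → zsum B u ≡ zsum B v
zsum-cong≤ zero    h = h 0ℤ z≤n
zsum-cong≤ (suc B) h = cong₂ _+ᶻ_ (zsum-cong≤ B (λ k k≤B → h k (ℕₚ.m≤n⇒m≤1+n k≤B)))
  (cong₂ _+ᶻ_ (h (+ suc B) ℕₚ.≤-refl) (h -[1+ B ] ℕₚ.≤-refl))

zsum-cong : ∀ B {u v : ℤ → ℤ} → (∀ k → u k ≡ v k) → zsum B u ≡ zsum B v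
zsum-cong B h = zsum-cong≤ B (λ k _ → h k)

zsum-+ : ∀ B (u v : ℤ → ℤ) → zsum B (λ k → u k +ᶻ v k) ≡ zsum B u +ᶻ zsum B v
zsum-+ zero    u v = refl
zsum-+ (suc B) u v = trans (cong₂ _+ᶻ_ (zsum-+ B u v)
    (+ᶻ-interchange (u (+ suc B)) (v (+ suc B)) (u -[1+ B ]) (v -[1+ B ])))
  (+ᶻ-interchange (zsum B u) (zsum B v) _ _)

zsum-*ˡ : ∀ B c (u : ℤ → ℤ) → zsum B (λ k → c *ᶻ u k) ≡ c *ᶻ zsum B u
zsum-*ˡ zero    c u = refl
zsum-*ˡ (suc B) c u = trans (cong (_+ᶻ (c *ᶻ u (+ suc B) +ᶻ c *ᶻ u -[1+ B ])) (zsum-*ˡ B c u))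
  (distrib₃ c (zsum B u) (u (+ suc B)) (u -[1+ B ]))
  where
  distrib₃ : ∀ c x y z → c *ᶻ x +ᶻ (c *ᶻ y +ᶻ c *ᶻ z) ≡ c *ᶻ (x +ᶻ (y +ᶻ z))
  distrib₃ = ℤ-solve

zsum-0 : ∀ B {u : ℤ → ℤ} → (∀ k → u k ≡ 0ℤ) → zsum B u ≡ 0ℤ
zsum-0 zero    h = h 0ℤ
zsum-0 (suc B) h = cong₂ _+ᶻ_ (zsum-0 B h) (cong₂ _+ᶻ_ (h (+ suc B)) (h -[1+ B ]))

SupportedIn : ℕ → (ℤ → ℤ) → Set
SupportedIn S u = ∀ k → S < ℤ.∣ k ∣ → u k ≡ 0ℤ

zsum-extend : ∀ {S u} → SupportedIn S u → ∀ {B} → S ≤ B → zsum B u ≡ zsum S u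
zsum-extend {S} {u} supp {B} S≤B with ℕₚ.m≤n⇒m<n∨m≡n S≤B
... | inj₂ refl = refl
zsum-extend {S} {u} supp {suc B} S≤B | inj₁ (s≤s S≤B′) = begin
  zsum B u +ᶻ (u (+ suc B) +ᶻ u -[1+ B ])
    ≡⟨ cong₂ _+ᶻ_ (zsum-extend supp S≤B′) (cong₂ _+ᶻ_ (supp (+ suc B) (s≤s S≤B′)) (supp -[1+ B ] (s≤s S≤B′))) ⟩
  zsum S u +ᶻ 0ℤ   ≡⟨ ℤₚ.+-identityʳ _ ⟩
  zsum S u         ∎
  where open ≡-Reasoning

zsum-window : ∀ {S u B B′} → SupportedIn S u → S ≤ B → S ≤ B′ → zsum B u ≡ zsum B′ u
zsum-window supp S≤B S≤B′ = trans (zsum-extend supp S≤B) (sym (zsum-extend supp S≤B′))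

Coercive : (ℤ → ℕ) → Set
Coercive e = ∀ k → ℤ.∣ k ∣ ≤ e k

-- Σ_{k ∈ ℤ} w(k) q^e(k): for coercive e, only |k| ≤ n matters for the coefficient of qⁿ.
theta : (ℤ → ℤ) → (ℤ → ℕ) → Series
theta w e n = zsum n (λ k → w k *ᶻ δ (e k) n)

*ᶻ-δ-≢ : ∀ (x : ℤ) {a b : ℕ} → a ≢ b → x *ᶻ δ a b ≡ 0ℤ
*ᶻ-δ-≢ x a≢b = trans (cong (x *ᶻ_) (δ-≢ a≢b)) (ℤₚ.*-zeroʳ x)

theta-supported : ∀ (w : ℤ → ℤ) {e : ℤ → ℕ} → Coercive e → ∀ n → SupportedIn n (λ k → w k *ᶻ δ (e k) n)
theta-supported w coercive n k n<k = *ᶻ-δ-≢ (w k) (ℕₚ.>⇒≢ (ℕₚ.<-≤-trans n<k (coercive k)))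

theta-window : ∀ (w : ℤ → ℤ) {e : ℤ → ℕ} → Coercive e → ∀ {n B} → n ≤ B →
  theta w e n ≡ zsum B (λ k → w k *ᶻ δ (e k) n)
theta-window w {e} coercive {n} n≤B =
  sym (zsum-extend {n} {λ k → w k *ᶻ δ (e k) n} (theta-supported w coercive n) n≤B)

theta-cong : ∀ (w w′ : ℤ → ℤ) (e e′ : ℤ → ℕ) → (∀ k → w k ≡ w′ k) → (∀ k → e k ≡ e′ k) →
  theta w e ≈ theta w′ e′
theta-cong w w′ e e′ p q = pointwise λ n →
  zsum-cong n (λ k → cong₂ (λ (x : ℤ) (y : ℕ) → x *ᶻ δ y n) (p k) (q k))

-- n (n - 1) / 2
tri : ℕ → ℕ
tri zero    = 0
tri (suc n) = n + tri n

tri-+ : ∀ m n → tri (m + n) ≡ tri m + tri n + m * n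
tri-+ zero    n = sym (ℕₚ.+-identityʳ (tri n))
tri-+ (suc m) n = trans (cong (λ x → m + n + x) (tri-+ m n)) (rearrange m n (tri m) (tri n))
  where
  rearrange : ∀ m n x y → m + n + (x + y + m * n) ≡ m + x + y + (n + m * n)
  rearrange = ℕ-solve

tri-square : ∀ m → m * m ≡ m + 2 * tri m
tri-square zero    = refl
tri-square (suc m) = trans (expand m) (trans (cong (λ x → x + m + m + 1) (tri-square m)) (rearrange m (tri m)))
  where
  expand : ∀ m → suc m * suc m ≡ m * m + m + m + 1
  expand = ℕ-solve
  rearrange : ∀ m x → m + 2 * x + m + m + 1 ≡ suc m + 2 * (m + x)
  rearrange = ℕ-solve

-- k (k + 1) / 2
triᶻ : ℤ → ℕ
triᶻ (+ m)    = tri (suc m)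
triᶻ -[1+ m ] = tri (suc m)

triᶻ-neg : ∀ m → triᶻ (-ᶻ (+ m)) ≡ tri m
triᶻ-neg zero    = refl
triᶻ-neg (suc m) = refl

-- The exponents of Ramanujan's theta function f (ε qᵃ, ε qᵇ).
rexp : ℕ → ℕ → ℤ → ℕ
rexp a b k = a * triᶻ (-ᶻ k) + b * triᶻ k

-- For ε = ±1 the k-th term of f(ε q^a, ε q^b) carries the sign ε^(k²), which is ε^|k| because k²
-- and |k| have the same parity.
rtheta : ℤ → ℕ → ℕ → Series
rtheta ε a b = theta (λ k → zpow ε ℤ.∣ k ∣) (rexp a b)

rexp-coercive : ∀ a b .{{_ : NonZero a}} .{{_ : NonZero b}} → Coercive (rexp a b)
rexp-coercive a b (+ m) = ℕₚ.≤-trans (ℕₚ.m≤m+n m (tri m))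
  (ℕₚ.≤-trans (ℕₚ.m≤n*m (m + tri m) b) (ℕₚ.m≤n+m (b * (m + tri m)) _))
rexp-coercive a b -[1+ m ] = ℕₚ.≤-trans (ℕₚ.m≤m+n (suc m) (tri (suc m)))
  (ℕₚ.≤-trans (ℕₚ.m≤n*m (suc m + tri (suc m)) a) (ℕₚ.m≤m+n (a * (suc m + tri (suc m))) _))

sumS : ℕ → (ℕ → Series) → Series
sumS n s N = sumTo n (λ i → s i N)

zsumS : ℕ → (ℤ → Series) → Series
zsumS B s N = zsum B (λ k → s k N)

sumS-suc : ∀ n s → sumS (suc n) s ≈ sumS n s ⊕ s (suc n)
sumS-suc n s = pointwise λ N → sym (⊕-at (sumS n s) (s (suc n)) N)

zsumS-suc : ∀ B s → zsumS (suc B) s ≈ zsumS B s ⊕ (s (+ suc B) ⊕ s -[1+ B ])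
zsumS-suc B s = pointwise λ N → sym (trans (⊕-at (zsumS B s) _ N)
  (cong (zsum B (λ k → s k N) +ᶻ_) (⊕-at (s (+ suc B)) (s -[1+ B ]) N)))

∙-sumS : ∀ f n s → f ∙ sumS n s ≈ sumS n (λ i → f ∙ s i)
∙-sumS f zero    s = ∙-congˡ (pointwise λ _ → refl)
∙-sumS f (suc n) s = begin
  f ∙ sumS (suc n) s                     ≈⟨ ∙-congˡ (sumS-suc n s) ⟩
  f ∙ (sumS n s ⊕ s (suc n))             ≈⟨ ∙-distribˡ-⊕ f (sumS n s) (s (suc n)) ⟩
  f ∙ sumS n s ⊕ f ∙ s (suc n)           ≈⟨ ⊕-congʳ (∙-sumS f n s) ⟩
  sumS n (λ i → f ∙ s i) ⊕ f ∙ s (suc n) ≈⟨ sumS-suc n (λ i → f ∙ s i) ⟨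
  sumS (suc n) (λ i → f ∙ s i)           ∎
  where open ≈-Reasoning

∙-zsumS : ∀ f B s → f ∙ zsumS B s ≈ zsumS B (λ k → f ∙ s k)
∙-zsumS f zero    s = ∙-congˡ (pointwise λ _ → refl)
∙-zsumS f (suc B) s = begin
  f ∙ zsumS (suc B) s
    ≈⟨ ∙-congˡ (zsumS-suc B s) ⟩
  f ∙ (zsumS B s ⊕ (s (+ suc B) ⊕ s -[1+ B ]))
    ≈⟨ ∙-distribˡ-⊕ f (zsumS B s) (s (+ suc B) ⊕ s -[1+ B ]) ⟩
  f ∙ zsumS B s ⊕ f ∙ (s (+ suc B) ⊕ s -[1+ B ])
    ≈⟨ ⊕-cong (∙-zsumS f B s) (∙-distribˡ-⊕ f (s (+ suc B)) (s -[1+ B ])) ⟩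
  zsumS B (λ k → f ∙ s k) ⊕ (f ∙ s (+ suc B) ⊕ f ∙ s -[1+ B ])
    ≈⟨ zsumS-suc B (λ k → f ∙ s k) ⟨
  zsumS (suc B) (λ k → f ∙ s k) ∎
  where open ≈-Reasoning

sumS-cong≤ : ∀ n {s t : ℕ → Series} → (∀ i → i ≤ n → s i ≈ t i) → sumS n s ≈ sumS n t
sumS-cong≤ n p = pointwise λ N → sumTo-cong≤ n (λ i i≤n → at (p i i≤n) N)

zsumS-cong≤ : ∀ n {s t : ℤ → Series} → (∀ i → ℤ.∣ i ∣ ≤ n → s i ≈ t i) → zsumS n s ≈ zsumS n t
zsumS-cong≤ n p = pointwise λ N → zsum-cong≤ n (λ i i≤n → at (p i i≤n) N)

-- This is M + k as long as |k| ≤ M, the only range in which it matters: it centres the indices 0 to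
-- 2M at 0.
offset : ℕ → ℤ → ℕ
offset M (+ m)    = M + m
offset M -[1+ m ] = M ∸ suc m

sumTo-centred : ∀ M (u : ℕ → ℤ) → sumTo (M + M) u ≡ zsum M (u ∘ offset M)
sumTo-centred zero    u = refl
sumTo-centred (suc M) u = begin
  sumTo (suc M + suc M) u
    ≡⟨ sumTo-head (M + suc M) u ⟩
  u 0 +ᶻ sumTo (M + suc M) (u ∘ suc)
    ≡⟨ cong (λ n → u 0 +ᶻ sumTo n (u ∘ suc)) (ℕₚ.+-suc M M) ⟩
  u 0 +ᶻ (sumTo (M + M) (u ∘ suc) +ᶻ u (2 + (M + M)))
    ≡⟨ cong₂ (λ x n → u 0 +ᶻ (x +ᶻ u n)) (sumTo-centred M (u ∘ suc)) (cong suc (sym (ℕₚ.+-suc M M))) ⟩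
  u 0 +ᶻ (zsum M (u ∘ suc ∘ offset M) +ᶻ u (suc M + suc M))
    ≡⟨ rotate (u 0) (zsum M (u ∘ suc ∘ offset M)) (u (suc M + suc M)) ⟩
  zsum M (u ∘ suc ∘ offset M) +ᶻ (u (suc M + suc M) +ᶻ u 0)
    ≡⟨ cong₂ (λ x n → x +ᶻ (u (suc M + suc M) +ᶻ u n))
         (zsum-cong≤ M (λ k k≤M → cong u (shift k k≤M))) (sym (ℕₚ.n∸n≡0 M)) ⟩
  zsum M (u ∘ offset (suc M)) +ᶻ (u (suc M + suc M) +ᶻ u (M ∸ M)) ∎
  where
  open ≡-Reasoning
  rotate : ∀ x y z → x +ᶻ (y +ᶻ z) ≡ y +ᶻ (z +ᶻ x)
  rotate = ℤ-solve
  shift : ∀ k → ℤ.∣ k ∣ ≤ M → suc (offset M k) ≡ offset (suc M) k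
  shift (+ m)    k≤M = refl
  shift -[1+ m ] k≤M = sym (ℕₚ.+-∸-assoc 1 k≤M)

-- Gaussian binomial coefficients

module _ (c : ℕ) where

  -- The q-binomial coefficient "i + j over i" in base q^c, defined by Pascal's rule. Indexing by
  -- the two complementary parts avoids subtraction.
  gaussian : ℕ → ℕ → Series
  gaussian zero    j       = oneS
  gaussian (suc i) zero    = oneS
  gaussian (suc i) (suc j) = gaussian (suc i) j ⊕ mono (c * suc j) ∙ gaussian i (suc j)

  gaussian-0 : ∀ i → gaussian i 0 ≡ oneS
  gaussian-0 zero    = refl
  gaussian-0 (suc i) = refl

  pochhammer : ℕ → Series
  pochhammer zero    = oneS
  pochhammer (suc n) = pochhammer n ∙ binom -1ℤ (c * suc n)

  -- The quotient formula for q-binomial coefficients with the denominators cleared. For x =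
  -- q^(c(i+1)) and z = q^(c(j+1)) the induction rests on (1 - z) + z (1 - x) = 1 - x z.
  gaussian-pochhammer : ∀ i j → gaussian i j ∙ (pochhammer i ∙ pochhammer j) ≈ pochhammer (i + j)
  gaussian-pochhammer zero    j = ≈-trans (∙-identityˡ _) (∙-identityˡ _)
  gaussian-pochhammer (suc i) zero = ≈-trans (∙-identityˡ _) (≈-trans (∙-identityʳ _)
    (≡⇒≈ (cong pochhammer (sym (ℕₚ.+-identityʳ (suc i))))))
  gaussian-pochhammer (suc i) (suc j) = begin
    (G₁ ⊕ z ∙ G₂) ∙ ((Dᵢ ∙ binom -1ℤ (c * suc i)) ∙ (Dⱼ ∙ binom -1ℤ (c * suc j)))
      ≈⟨ ∙-congˡ (∙-cong (∙-congˡ (minus (c * suc i))) (∙-congˡ (minus (c * suc j)))) ⟩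
    (G₁ ⊕ z ∙ G₂) ∙ ((Dᵢ ∙ (const 1ℤ ⊕ const -1ℤ ∙ x)) ∙ (Dⱼ ∙ (const 1ℤ ⊕ const -1ℤ ∙ z)))
      ≈⟨ SR.solve 6 (λ G₁ G₂ Dᵢ Dⱼ x z → 
           (G₁ :+ z :* G₂) :* ((Dᵢ :* (con 1ℤ :+ con -1ℤ :* x)) :* (Dⱼ :* (con 1ℤ :+ con -1ℤ :* z)))
           := (G₁ :* ((Dᵢ :* (con 1ℤ :+ con -1ℤ :* x)) :* Dⱼ)) :* (con 1ℤ :+ con -1ℤ :* z)
              :+ (G₂ :* (Dᵢ :* (Dⱼ :* (con 1ℤ :+ con -1ℤ :* z)))) :* (z :* (con 1ℤ :+ con -1ℤ :* x)))
           ≈-refl G₁ G₂ Dᵢ Dⱼ x z ⟩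
    (G₁ ∙ ((Dᵢ ∙ (const 1ℤ ⊕ const -1ℤ ∙ x)) ∙ Dⱼ)) ∙ (const 1ℤ ⊕ const -1ℤ ∙ z)
      ⊕ (G₂ ∙ (Dᵢ ∙ (Dⱼ ∙ (const 1ℤ ⊕ const -1ℤ ∙ z)))) ∙ (z ∙ (const 1ℤ ⊕ const -1ℤ ∙ x))
      ≈⟨ ⊕-cong (∙-congʳ (∙-congˡ (∙-congʳ (∙-congˡ (minus (c * suc i))))))
                (∙-congʳ (∙-congˡ (∙-congˡ (∙-congˡ (minus (c * suc j)))))) ⟨
    (G₁ ∙ (pochhammer (suc i) ∙ Dⱼ)) ∙ (const 1ℤ ⊕ const -1ℤ ∙ z)
      ⊕ (G₂ ∙ (Dᵢ ∙ pochhammer (suc j))) ∙ (z ∙ (const 1ℤ ⊕ const -1ℤ ∙ x))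
      ≈⟨ ⊕-cong (∙-congʳ (≈-trans (gaussian-pochhammer (suc i) j) (≡⇒≈ (cong pochhammer (sym (ℕₚ.+-suc i j))))))
                (∙-congʳ (gaussian-pochhammer i (suc j))) ⟩
    D ∙ (const 1ℤ ⊕ const -1ℤ ∙ z) ⊕ D ∙ (z ∙ (const 1ℤ ⊕ const -1ℤ ∙ x))
      ≈⟨ SR.solve 3 (λ D x z → 
           D :* (con 1ℤ :+ con -1ℤ :* z) :+ D :* (z :* (con 1ℤ :+ con -1ℤ :* x))
           := D :* (con 1ℤ :+ con -1ℤ :* (x :* z))) ≈-refl D x z ⟩
    D ∙ (const 1ℤ ⊕ const -1ℤ ∙ (x ∙ z))
      ≈⟨ ∙-congˡ (⊕-congˡ (∙-congˡ (≈-trans (mono-+ (c * suc i) (c * suc j))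
           (≡⇒≈ (cong mono (sym (ℕₚ.*-distribˡ-+ c (suc i) (suc j)))))))) ⟩
    D ∙ (const 1ℤ ⊕ const -1ℤ ∙ mono (c * suc (i + suc j)))
      ≈⟨ ∙-congˡ (minus (c * suc (i + suc j))) ⟨
    D ∙ binom -1ℤ (c * suc (i + suc j)) ∎
    where
    open ≈-Reasoning
    G₁ = gaussian (suc i) j
    G₂ = gaussian i (suc j)
    Dᵢ = pochhammer i
    Dⱼ = pochhammer j
    D = pochhammer (i + suc j)
    x = mono (c * suc i)
    z = mono (c * suc j)
    minus : ∀ d → binom -1ℤ d ≈ const 1ℤ ⊕ const -1ℤ ∙ mono d
    minus d = ≈-trans (binom-mono -1ℤ d) (⊕-congʳ oneS≈const1)

-- The Jacobi triple product

-- Bookkeeping for Pascal's rule: an entry of antidiagonal m + 1 receives `Y` from its neighbour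
-- with smaller j and `X` from its neighbour with smaller i; each end of the antidiagonal has only
-- one of them.
antidiagonal-pascal : ∀ (h X Y : ℕ → ℕ → Series) →
  (∀ j → h 0 (suc j) ≈ Y 0 j) → (∀ i → h (suc i) 0 ≈ X i 0) →
  (∀ i j → h (suc i) (suc j) ≈ Y (suc i) j ⊕ X i (suc j)) →
  ∀ m → sumS (suc m) (λ i → h i (suc m ∸ i)) ≈ sumS m (λ i → Y i (m ∸ i)) ⊕ sumS m (λ i → X i (m ∸ i))
antidiagonal-pascal h X Y h₀ h₁ h₂ m = pointwise λ N → trans (go m N) (sym (⊕-at (sumS m (λ i → Y i (m ∸ i))) (sumS m (λ i → X i (m ∸ i))) N))
  where
  open ≡-Reasoning
  regroup : ∀ a b c d → a +ᶻ ((b +ᶻ c) +ᶻ d) ≡ (a +ᶻ b) +ᶻ (c +ᶻ d)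
  regroup = ℤ-solve
  go : ∀ m N → sumTo (suc m) (λ i → h i (suc m ∸ i) N) ≡
    sumTo m (λ i → Y i (m ∸ i) N) +ᶻ sumTo m (λ i → X i (m ∸ i) N)
  go zero    N = cong₂ _+ᶻ_ (at (h₀ 0) N) (at (h₁ 0) N)
  go (suc m) N = begin
    sumTo (2 + m) (λ i → h i (2 + m ∸ i) N)
      ≡⟨ sumTo-head (suc m) (λ i → h i (2 + m ∸ i) N) ⟩
    h 0 (2 + m) N +ᶻ (sumTo m (λ i → h (suc i) (suc m ∸ i) N) +ᶻ h (2 + m) (m ∸ m) N)
      ≡⟨ cong₂ (λ x y → x +ᶻ (sumTo m (λ i → h (suc i) (suc m ∸ i) N) +ᶻ y)) (at (h₀ (suc m)) N)
           (trans (cong (λ z → h (2 + m) z N) (ℕₚ.n∸n≡0 m)) (trans (at (h₁ (suc m)) N)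
             (cong (λ z → X (suc m) z N) (sym (ℕₚ.n∸n≡0 m))))) ⟩
    Y 0 (suc m) N +ᶻ (sumTo m (λ i → h (suc i) (suc m ∸ i) N) +ᶻ X (suc m) (m ∸ m) N)
      ≡⟨ cong (λ x → Y 0 (suc m) N +ᶻ (x +ᶻ X (suc m) (m ∸ m) N)) (trans (sumTo-cong≤ m inner)
           (sumTo-+ m (λ i → Y (suc i) (m ∸ i) N) (λ i → X i (suc m ∸ i) N))) ⟩
    Y 0 (suc m) N +ᶻ ((sumTo m (λ i → Y (suc i) (m ∸ i) N) +ᶻ sumTo m (λ i → X i (suc m ∸ i) N)) +ᶻ X (suc m) (m ∸ m) N)
      ≡⟨ regroup (Y 0 (suc m) N) (sumTo m (λ i → Y (suc i) (m ∸ i) N)) (sumTo m (λ i → X i (suc m ∸ i) N)) (X (suc m) (m ∸ m) N) ⟩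
    (Y 0 (suc m) N +ᶻ sumTo m (λ i → Y (suc i) (m ∸ i) N)) +ᶻ (sumTo m (λ i → X i (suc m ∸ i) N) +ᶻ X (suc m) (m ∸ m) N)
      ≡⟨ cong (_+ᶻ sumTo (suc m) (λ i → X i (suc m ∸ i) N)) (sumTo-head m (λ i → Y i (suc m ∸ i) N)) ⟨
    sumTo (suc m) (λ i → Y i (suc m ∸ i) N) +ᶻ sumTo (suc m) (λ i → X i (suc m ∸ i) N) ∎
    where
    inner : ∀ i → i ≤ m → h (suc i) (suc m ∸ i) N ≡ Y (suc i) (m ∸ i) N +ᶻ X i (suc m ∸ i) N
    inner i i≤m = begin
      h (suc i) (suc m ∸ i) N                              ≡⟨ cong (λ z → h (suc i) z N) (ℕₚ.+-∸-assoc 1 i≤m) ⟩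
      h (suc i) (suc (m ∸ i)) N                            ≡⟨ at (h₂ i (m ∸ i)) N ⟩
      (Y (suc i) (m ∸ i) ⊕ X i (suc (m ∸ i))) N            ≡⟨ ⊕-at _ _ N ⟩
      Y (suc i) (m ∸ i) N +ᶻ X i (suc (m ∸ i)) N
        ≡⟨ cong (λ z → Y (suc i) (m ∸ i) N +ᶻ X i z N) (ℕₚ.+-∸-assoc 1 i≤m) ⟨
      Y (suc i) (m ∸ i) N +ᶻ X i (suc m ∸ i) N             ∎

module _ (ε : ℤ) (a b : ℕ) where

  private c = a + b

  module _ (y : ℕ) where

    -- With y = c M and m = 2M factors, the product of mono y ⊕ ε q^(b+cj) is, up to a
    -- monomial, a finite version of both infinite products at once.
    binomial-term : ℕ → ℕ → Series
    binomial-term i j = const (zpow ε i) ∙ mono (c * tri i + b * i + y * j) ∙ gaussian c i j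

    shifted-factor : ℕ → Series
    shifted-factor j = mono y ⊕ const ε ∙ mono (b + c * j)

    -- Cauchy's q-binomial theorem. In the product with the next factor, the summand q^y raises j
    -- and the summand ε q^(b+c(i+j)) raises i, which is Pascal's rule for `gaussian`.
    q-binomial : ∀ m → prodTo m shifted-factor ≈ sumS (suc m) (λ i → binomial-term i (suc m ∸ i))
    q-binomial = go
      where
      Y X : ℕ → ℕ → Series
      Y i j = mono y ∙ binomial-term i j
      X i j = const ε ∙ mono (b + c * (i + j)) ∙ binomial-term i j
      const-suc : ∀ i → const (zpow ε (suc i)) ≈ const ε ∙ const (zpow ε i)
      const-suc i = SR.solve 0 (con (ε *ᶻ zpow ε i) := con ε :* con (zpow ε i)) ≈-refl
      h₀ : ∀ j → binomial-term 0 (suc j) ≈ Y 0 j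
      h₀ j = begin
        const 1ℤ ∙ mono (c * 0 + b * 0 + y * suc j) ∙ oneS
          ≈⟨ ∙-congʳ (∙-congˡ (≈-trans (≡⇒≈ (cong mono (e c b y j))) (≈-sym (mono-+ y _)))) ⟩
        const 1ℤ ∙ (mono y ∙ mono (c * 0 + b * 0 + y * j)) ∙ oneS
          ≈⟨ Mon.solve 4 (λ k m n o → (k ⊙ (m ⊙ n)) ⊙ o ⊜ m ⊙ ((k ⊙ n) ⊙ o)) ≈-refl
               (const 1ℤ) (mono y) (mono (c * 0 + b * 0 + y * j)) oneS ⟩
        mono y ∙ binomial-term 0 j ∎
        where
        open ≈-Reasoning
        e : ∀ c b y j → c * 0 + b * 0 + y * suc j ≡ y + (c * 0 + b * 0 + y * j)
        e = ℕ-solve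
      h₁ : ∀ i → binomial-term (suc i) 0 ≈ X i 0
      h₁ i = begin
        const (zpow ε (suc i)) ∙ mono (c * (i + tri i) + b * suc i + y * 0) ∙ oneS
          ≈⟨ ∙-congʳ (∙-cong (const-suc i) (≈-trans (≡⇒≈ (cong mono (e c b y i (tri i)))) (≈-sym (mono-+ _ _)))) ⟩
        const ε ∙ const (zpow ε i) ∙ (mono (b + c * (i + 0)) ∙ mono (c * tri i + b * i + y * 0)) ∙ oneS
          ≈⟨ Mon.solve 5 (λ k l m n o → ((k ⊙ l) ⊙ (m ⊙ n)) ⊙ o ⊜ (k ⊙ m) ⊙ ((l ⊙ n) ⊙ o)) ≈-refl
               (const ε) (const (zpow ε i)) (mono (b + c * (i + 0))) (mono (c * tri i + b * i + y * 0)) oneS ⟩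
        const ε ∙ mono (b + c * (i + 0)) ∙ (const (zpow ε i) ∙ mono (c * tri i + b * i + y * 0) ∙ oneS)
          ≈⟨ ∙-congˡ (∙-congˡ (≡⇒≈ (gaussian-0 c i))) ⟨
        X i 0 ∎
        where
        open ≈-Reasoning
        e : ∀ c b y i t → c * (i + t) + b * suc i + y * 0 ≡ b + c * (i + 0) + (c * t + b * i + y * 0)
        e = ℕ-solve
      h₂ : ∀ i j → binomial-term (suc i) (suc j) ≈ Y (suc i) j ⊕ X i (suc j)
      h₂ i j = begin
        const (zpow ε (suc i)) ∙ mono (c * (i + tri i) + b * suc i + y * suc j) ∙ (G₁ ⊕ mono (c * suc j) ∙ G₂)
          ≈⟨ SR.solve 5 (λ k m z G₁ G₂ → k :* m :* (G₁ :+ z :* G₂) := k :* m :* G₁ :+ k :* (m :* z) :* G₂)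
               ≈-refl _ _ (mono (c * suc j)) G₁ G₂ ⟩
        const (zpow ε (suc i)) ∙ mono (c * (i + tri i) + b * suc i + y * suc j) ∙ G₁
          ⊕ const (zpow ε (suc i)) ∙ (mono (c * (i + tri i) + b * suc i + y * suc j) ∙ mono (c * suc j)) ∙ G₂
          ≈⟨ ⊕-cong (∙-congʳ (∙-congˡ (≈-trans (≡⇒≈ (cong mono (e₁ c b y i j (tri i)))) (≈-sym (mono-+ _ _)))))
               (∙-congʳ (∙-cong (const-suc i) (≈-trans (mono-+ _ _) (≈-trans (≡⇒≈ (cong mono (e₂ c b y i j (tri i)))) (≈-sym (mono-+ _ _)))))) ⟩
        const (zpow ε (suc i)) ∙ (mono y ∙ mono (c * (i + tri i) + b * suc i + y * j)) ∙ G₁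
          ⊕ const ε ∙ const (zpow ε i) ∙ (mono (b + c * (i + suc j)) ∙ mono (c * tri i + b * i + y * suc j)) ∙ G₂
          ≈⟨ ⊕-cong
              (Mon.solve 4 (λ k m n o → (k ⊙ (m ⊙ n)) ⊙ o ⊜ m ⊙ ((k ⊙ n) ⊙ o)) ≈-refl
                 (const (zpow ε (suc i))) (mono y) (mono (c * (i + tri i) + b * suc i + y * j)) G₁)
              (Mon.solve 5 (λ k l m n o → ((k ⊙ l) ⊙ (m ⊙ n)) ⊙ o ⊜ (k ⊙ m) ⊙ ((l ⊙ n) ⊙ o)) ≈-refl
                 (const ε) (const (zpow ε i)) (mono (b + c * (i + suc j))) (mono (c * tri i + b * i + y * suc j)) G₂) ⟩
        Y (suc i) j ⊕ X i (suc j) ∎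
        where
        open ≈-Reasoning
        G₁ = gaussian c (suc i) j
        G₂ = gaussian c i (suc j)
        e₁ : ∀ c b y i j t → c * (i + t) + b * suc i + y * suc j ≡ y + (c * (i + t) + b * suc i + y * j)
        e₁ = ℕ-solve
        e₂ : ∀ c b y i j t → c * (i + t) + b * suc i + y * suc j + c * suc j
                           ≡ b + c * (i + suc j) + (c * t + b * i + y * suc j)
        e₂ = ℕ-solve
      row : ℕ → Series
      row m = sumS m (λ i → binomial-term i (m ∸ i))
      row-suc : ∀ m → row (suc m) ≈ row m ∙ shifted-factor m
      row-suc m = begin
        row (suc m)
          ≈⟨ antidiagonal-pascal binomial-term X Y h₀ h₁ h₂ m ⟩
        sumS m (λ i → Y i (m ∸ i)) ⊕ sumS m (λ i → X i (m ∸ i))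
          ≈⟨ ⊕-cong (∙-sumS (mono y) m _) (≈-trans (∙-sumS (const ε ∙ mono (b + c * m)) m _)
               (sumS-cong≤ m (λ i i≤m → ∙-congʳ (∙-congˡ (≡⇒≈ (cong (λ z → mono (b + c * z)) (sym (ℕₚ.m+[n∸m]≡n i≤m)))))))) ⟨
        mono y ∙ row m ⊕ const ε ∙ mono (b + c * m) ∙ row m
          ≈⟨ SR.solve 3 (λ s t r → s :* r :+ t :* r := r :* (s :+ t)) ≈-refl (mono y) (const ε ∙ mono (b + c * m)) (row m) ⟩
        row m ∙ shifted-factor m ∎
        where open ≈-Reasoning
      row-0 : row 0 ≈ oneS
      row-0 = ≈-trans (pointwise {row 0} {const 1ℤ ∙ mono (c * 0 + b * 0 + y * 0) ∙ oneS} λ N → refl)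
        (≈-trans (∙-identityʳ _) (≈-trans (∙-cong (≈-sym oneS≈const1)
          (≡⇒≈ (cong mono (e c b y)))) (∙-identityʳ oneS)))
        where
        e : ∀ c b y → c * 0 + b * 0 + y * 0 ≡ 0
        e = ℕ-solve
      go : ∀ m → prodTo m shifted-factor ≈ row (suc m)
      go zero    = ≈-sym (≈-trans (row-suc 0) (≈-trans (∙-congʳ row-0) (∙-identityˡ _)))
      -- `prodTo m` has m + 1 factors and therefore matches row m + 1; row 0 is the empty product.
      go (suc m) = ≈-trans (prodTo-suc m shifted-factor)
        (≈-trans (∙-congʳ (go m)) (≈-sym (row-suc (suc m))))

prodTo-cong≤ : ∀ n {s t : ℕ → Series} → (∀ j → j ≤ n → s j ≈ t j) → prodTo n s ≈ prodTo n t
prodTo-cong≤ zero    p = p 0 z≤n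
prodTo-cong≤ (suc n) {s} {t} p = ≈-trans (prodTo-suc n s)
  (≈-trans (∙-cong (prodTo-cong≤ n (λ j j≤n → p j (ℕₚ.m≤n⇒m≤1+n j≤n))) (p (suc n) ℕₚ.≤-refl))
    (≈-sym (prodTo-suc n t)))

prodTo-++ : ∀ m n s → prodTo (m + suc n) s ≈ prodTo m s ∙ prodTo n (λ j → s (suc m + j))
prodTo-++ m zero s = begin
  prodTo (m + 1) s             ≈⟨ ≡⇒≈ (cong (λ k → prodTo k s) (ℕₚ.+-comm m 1)) ⟩
  prodTo (suc m) s             ≈⟨ prodTo-suc m s ⟩
  prodTo m s ∙ s (suc m)       ≈⟨ ∙-congˡ (≡⇒≈ (cong s (sym (ℕₚ.+-identityʳ (suc m))))) ⟩
  prodTo m s ∙ s (suc m + 0)   ∎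
  where open ≈-Reasoning
prodTo-++ m (suc n) s = begin
  prodTo (m + suc (suc n)) s                       ≈⟨ ≡⇒≈ (cong (λ k → prodTo k s) (ℕₚ.+-suc m (suc n))) ⟩
  prodTo (suc (m + suc n)) s                       ≈⟨ prodTo-suc (m + suc n) s ⟩
  prodTo (m + suc n) s ∙ s (suc m + suc n)         ≈⟨ ∙-congʳ (prodTo-++ m n s) ⟩
  prodTo m s ∙ prodTo n t ∙ t (suc n)              ≈⟨ ∙-assoc _ _ _ ⟩
  prodTo m s ∙ (prodTo n t ∙ t (suc n))            ≈⟨ ∙-congˡ (prodTo-suc n t) ⟨
  prodTo m s ∙ prodTo (suc n) t                    ∎
  where
  open ≈-Reasoning
  t : ℕ → Series
  t j = s (suc m + j)

prodTo-head : ∀ n s → prodTo (suc n) s ≈ s 0 ∙ prodTo n (s ∘ suc)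
prodTo-head n s = prodTo-++ 0 n s

prodTo-rev : ∀ n s → prodTo n s ≈ prodTo n (λ j → s (n ∸ j))
prodTo-rev zero    s = ≈-refl
prodTo-rev (suc n) s = begin
  prodTo (suc n) s                          ≈⟨ prodTo-suc n s ⟩
  prodTo n s ∙ s (suc n)                    ≈⟨ ∙-comm _ _ ⟩
  s (suc n) ∙ prodTo n s                    ≈⟨ ∙-congˡ (prodTo-rev n s) ⟩
  s (suc n) ∙ prodTo n (λ j → s (n ∸ j))    ≈⟨ prodTo-head n (λ j → s (suc n ∸ j)) ⟨
  prodTo (suc n) (λ j → s (suc n ∸ j))      ∎
  where open ≈-Reasoning

const-* : ∀ x y → const x ∙ const y ≈ const (x *ᶻ y)
const-* x y = SR.solve 0 (con x :* con y := con (x *ᶻ y)) ≈-refl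

zpow-+ : ∀ x m n → zpow x (m + n) ≡ zpow x m *ᶻ zpow x n
zpow-+ x zero    n = sym (ℤₚ.*-identityˡ (zpow x n))
zpow-+ x (suc m) n = trans (cong (x *ᶻ_) (zpow-+ x m n)) (sym (ℤₚ.*-assoc x (zpow x m) (zpow x n)))

zpow-square : ∀ ε → ε *ᶻ ε ≡ 1ℤ → ∀ n → zpow ε n *ᶻ zpow ε n ≡ 1ℤ
zpow-square ε εε zero    = refl
zpow-square ε εε (suc n) = trans (rearrange ε (zpow ε n))
  (cong₂ _*ᶻ_ εε (zpow-square ε εε n))
  where
  rearrange : ∀ x y → (x *ᶻ y) *ᶻ (x *ᶻ y) ≡ (x *ᶻ x) *ᶻ (y *ᶻ y)
  rearrange = ℤ-solve

module _ (ε : ℤ) (εε : ε *ᶻ ε ≡ 1ℤ) (a b : ℕ) where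

  private c = a + b

  linear-factors : ℕ → ℕ → Series
  linear-factors d n = prodTo n (λ j → binom ε (d + j * c))

  theta-term : ℕ → ℤ → Series
  theta-term M k = const (zpow ε ℤ.∣ k ∣) ∙ mono (rexp a b k) ∙ gaussian c (offset M k) (offset M (-ᶻ k))

  private
    -- Exponent of the monomial common to both sides. With M = n + 1, the M low factors contribute b
    -- M + c tri(M) and the M high ones c M².
    scale : ℕ → ℕ
    scale n = b * suc n + c * tri (suc n) + c * suc n * suc n

  -- Since c = a + b, the exponents c M and b + c j differ by a + l c; taking out the second summand
  -- leaves 1 + ε q^(a+lc) because ε is its own inverse.
  shifted-low : ∀ M j l → suc (j + l) ≡ M →
    shifted-factor ε a b (c * M) j ≈ const ε ∙ mono (b + c * j) ∙ binom ε (a + l * c)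
  shifted-low M j l refl = begin
    mono (c * suc (j + l)) ⊕ const ε ∙ mono (b + c * j)
      ≈⟨ ⊕-congʳ (≈-trans (≡⇒≈ (cong mono (e a b j l))) (≈-sym (mono-+ (b + c * j) (a + l * c)))) ⟩
    x ∙ z ⊕ const ε ∙ x
      ≈⟨ SR.solve 3 (λ E x z → x :* z :+ E :* x := x :* z :* con 1ℤ :+ E :* x) ≈-refl (const ε) x z ⟩
    x ∙ z ∙ const 1ℤ ⊕ const ε ∙ x
      ≈⟨ ⊕-congʳ (∙-congˡ (≈-trans (const-* ε ε) (≡⇒≈ (cong const εε)))) ⟨
    x ∙ z ∙ (const ε ∙ const ε) ⊕ const ε ∙ x
      ≈⟨ SR.solve 3 (λ E x z → x :* z :* (E :* E) :+ E :* x := E :* x :* (con 1ℤ :+ E :* z)) ≈-refl (const ε) x z ⟩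
    const ε ∙ x ∙ (const 1ℤ ⊕ const ε ∙ z)
      ≈⟨ ∙-congˡ (≈-trans (binom-mono ε (a + l * c)) (⊕-congʳ oneS≈const1)) ⟨
    const ε ∙ x ∙ binom ε (a + l * c) ∎
    where
    open ≈-Reasoning
    x = mono (b + c * j)
    z = mono (a + l * c)
    e : ∀ a b j l → (a + b) * suc (j + l) ≡ b + (a + b) * j + (a + l * (a + b))
    e = ℕ-solve

  shifted-high : ∀ M l → shifted-factor ε a b (c * M) (M + l) ≈ mono (c * M) ∙ binom ε (b + l * c)
  shifted-high M l = begin
    x ⊕ const ε ∙ mono (b + c * (M + l))
      ≈⟨ ⊕-congˡ (∙-congˡ (≈-trans (≡⇒≈ (cong mono (e c b M l))) (≈-sym (mono-+ (c * M) (b + l * c))))) ⟩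
    x ⊕ const ε ∙ (x ∙ z)
      ≈⟨ SR.solve 3 (λ E x z → x :+ E :* (x :* z) := x :* (con 1ℤ :+ E :* z)) ≈-refl (const ε) x z ⟩
    x ∙ (const 1ℤ ⊕ const ε ∙ z)
      ≈⟨ ∙-congˡ (≈-trans (binom-mono ε (b + l * c)) (⊕-congʳ oneS≈const1)) ⟨
    x ∙ binom ε (b + l * c) ∎
    where
    open ≈-Reasoning
    x = mono (c * M)
    z = mono (b + l * c)
    e : ∀ c b M l → b + c * (M + l) ≡ c * M + (b + l * c)
    e = ℕ-solve

  extract-low : ∀ n (t : ℕ → Series) → prodTo n (λ j → const ε ∙ mono (b + c * j) ∙ t j) ≈
    const (zpow ε (suc n)) ∙ mono (b * suc n + c * tri (suc n)) ∙ prodTo n t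
  extract-low zero t = ∙-congʳ (∙-cong (≡⇒≈ (cong const (sym (ℤₚ.*-identityʳ ε)))) (≡⇒≈ (cong mono (e c b))))
    where
    e : ∀ c b → b + c * 0 ≡ b * 1 + c * 0
    e = ℕ-solve
  extract-low (suc n) t = begin
    prodTo (suc n) (λ j → const ε ∙ mono (b + c * j) ∙ t j)
      ≈⟨ prodTo-suc n _ ⟩
    prodTo n (λ j → const ε ∙ mono (b + c * j) ∙ t j) ∙ (const ε ∙ mono (b + c * suc n) ∙ t (suc n))
      ≈⟨ ∙-congʳ (extract-low n t) ⟩
    const (zpow ε (suc n)) ∙ mono (b * suc n + c * tri (suc n)) ∙ prodTo n t ∙ (const ε ∙ mono (b + c * suc n) ∙ t (suc n))
      ≈⟨ Mon.solve 6 (λ u v w x y z → ((u ⊙ v) ⊙ w) ⊙ ((x ⊙ y) ⊙ z)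
            ⊜ ((x ⊙ u) ⊙ (y ⊙ v)) ⊙ (w ⊙ z)) ≈-refl
           (const (zpow ε (suc n))) (mono (b * suc n + c * tri (suc n))) (prodTo n t) (const ε) (mono (b + c * suc n)) (t (suc n)) ⟩
    (const ε ∙ const (zpow ε (suc n))) ∙ (mono (b + c * suc n) ∙ mono (b * suc n + c * tri (suc n))) ∙ (prodTo n t ∙ t (suc n))
      ≈⟨ ∙-cong (∙-cong (const-* ε (zpow ε (suc n))) (≈-trans (mono-+ _ _) (≡⇒≈ (cong mono (e c b n (tri (suc n)))))))
           (≈-sym (prodTo-suc n t)) ⟩
    const (zpow ε (suc (suc n))) ∙ mono (b * suc (suc n) + c * tri (suc (suc n))) ∙ prodTo (suc n) t ∎
    where
    open ≈-Reasoning
    e : ∀ c b n t → b + c * suc n + (b * suc n + c * t) ≡ b * suc (suc n) + c * (suc n + t)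
    e = ℕ-solve

  extract-high : ∀ x n (t : ℕ → Series) → prodTo n (λ j → mono x ∙ t j) ≈ mono (x * suc n) ∙ prodTo n t
  extract-high x zero    t = ∙-congʳ (≡⇒≈ (cong mono (sym (ℕₚ.*-identityʳ x))))
  extract-high x (suc n) t = begin
    prodTo (suc n) (λ j → mono x ∙ t j)                 ≈⟨ prodTo-suc n _ ⟩
    prodTo n (λ j → mono x ∙ t j) ∙ (mono x ∙ t (suc n)) ≈⟨ ∙-congʳ (extract-high x n t) ⟩
    mono (x * suc n) ∙ prodTo n t ∙ (mono x ∙ t (suc n))
      ≈⟨ Mon.solve 4 (λ u v w z → (u ⊙ v) ⊙ (w ⊙ z) ⊜ (w ⊙ u) ⊙ (v ⊙ z)) ≈-refl
           (mono (x * suc n)) (prodTo n t) (mono x) (t (suc n)) ⟩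
    mono x ∙ mono (x * suc n) ∙ (prodTo n t ∙ t (suc n))
      ≈⟨ ∙-cong (≈-trans (mono-+ x (x * suc n)) (≡⇒≈ (cong mono (sym (ℕₚ.*-suc x (suc n)))))) (≈-sym (prodTo-suc n t)) ⟩
    mono (x * suc (suc n)) ∙ prodTo (suc n) t           ∎
    where open ≈-Reasoning

  -- Of the 2M factors, M = n + 1, the first half yields the product for a, in reverse order, and
  -- the second half the product for b.
  product-side : ∀ n → prodTo (n + suc n) (shifted-factor ε a b (c * suc n)) ≈
    const (zpow ε (suc n)) ∙ mono (scale n) ∙ (linear-factors a n ∙ linear-factors b n)
  product-side n = begin
    prodTo (n + suc n) (shifted-factor ε a b (c * M))
      ≈⟨ prodTo-++ n n _ ⟩
    prodTo n (shifted-factor ε a b (c * M)) ∙ prodTo n (λ l → shifted-factor ε a b (c * M) (M + l))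
      ≈⟨ ∙-cong (prodTo-cong≤ n (λ j j≤n → shifted-low M j (n ∸ j) (cong suc (ℕₚ.m+[n∸m]≡n j≤n))))
                (prodTo-cong n (shifted-high M)) ⟩
    prodTo n (λ j → const ε ∙ mono (b + c * j) ∙ binom ε (a + (n ∸ j) * c)) ∙ prodTo n (λ l → mono (c * M) ∙ binom ε (b + l * c))
      ≈⟨ ∙-cong (extract-low n _) (extract-high (c * M) n _) ⟩
    const (zpow ε M) ∙ mono (b * M + c * tri M) ∙ prodTo n (λ j → binom ε (a + (n ∸ j) * c)) ∙ (mono (c * M * M) ∙ linear-factors b n)
      ≈⟨ ∙-congʳ (∙-congˡ (prodTo-rev n (λ j → binom ε (a + j * c)))) ⟨
    const (zpow ε M) ∙ mono (b * M + c * tri M) ∙ linear-factors a n ∙ (mono (c * M * M) ∙ linear-factors b n)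
      ≈⟨ Mon.solve 5 (λ u v w x y → ((u ⊙ v) ⊙ w) ⊙ (x ⊙ y) ⊜ (u ⊙ (v ⊙ x)) ⊙ (w ⊙ y)) ≈-refl
           (const (zpow ε M)) (mono (b * M + c * tri M)) (linear-factors a n) (mono (c * M * M)) (linear-factors b n) ⟩
    const (zpow ε M) ∙ (mono (b * M + c * tri M) ∙ mono (c * M * M)) ∙ (linear-factors a n ∙ linear-factors b n)
      ≈⟨ ∙-congʳ (∙-congˡ (mono-+ (b * M + c * tri M) (c * M * M))) ⟩
    const (zpow ε M) ∙ mono (scale n) ∙ (linear-factors a n ∙ linear-factors b n) ∎
    where
    open ≈-Reasoning
    M = suc n

  co-offset : ∀ M k → ℤ.∣ k ∣ ≤ M → (M + M) ∸ offset M k ≡ offset M (-ᶻ k)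
  co-offset M (+ zero)  k≤M = trans (cong (λ z → M + M ∸ z) (ℕₚ.+-identityʳ M))
    (trans (ℕₚ.m+n∸n≡m M M) (sym (ℕₚ.+-identityʳ M)))
  co-offset M (+ suc m) k≤M = ℕₚ.[m+n]∸[m+o]≡n∸o M M (suc m)
  co-offset M -[1+ m ]  k≤M = trans (ℕₚ.+-∸-assoc M (ℕₚ.m∸n≤m M (suc m)))
    (cong (λ z → M + z) (ℕₚ.m∸[m∸n]≡n k≤M))

  private
    exponent-pos : ∀ m d → c * tri (m + d + m) + b * (m + d + m) + c * (m + d) * d ≡
      b * (m + d) + c * tri (m + d) + c * (m + d) * (m + d) + (a * tri m + b * (m + tri m))
    exponent-pos m d = trans
      (cong (λ z → c * z + b * (m + d + m) + c * (m + d) * d) (tri-+ (m + d) m))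
      (e a b m d (tri (m + d)) (tri m))
      where
      e : ∀ a b m d x y → (a + b) * (x + y + (m + d) * m) + b * (m + d + m) + (a + b) * (m + d) * d ≡
        b * (m + d) + (a + b) * x + (a + b) * (m + d) * (m + d) + (a * y + b * (m + y))
      e = ℕ-solve
    exponent-neg : ∀ m d → c * tri d + b * d + c * (m + d) * (m + d + m) ≡
      b * (m + d) + c * tri (m + d) + c * (m + d) * (m + d) + (a * (m + tri m) + b * tri m)
    exponent-neg m d = trans (e₁ c b m d (tri d)) (trans
      (cong (λ z → c * tri d + b * d + c * (m + d) * (m + d) + c * (z + m * d)) (tri-square m))
      (trans (e₂ a b m d (tri d) (tri m))
        (cong (λ z → b * (m + d) + c * z + c * (m + d) * (m + d) + (a * (m + tri m) + b * tri m)) (sym (tri-+ m d)))))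
      where
      e₁ : ∀ c b m d x → c * x + b * d + c * (m + d) * (m + d + m) ≡
        c * x + b * d + c * (m + d) * (m + d) + c * (m * m + m * d)
      e₁ = ℕ-solve
      e₂ : ∀ a b m d x y → (a + b) * x + b * d + (a + b) * (m + d) * (m + d) + (a + b) * (m + 2 * y + m * d) ≡
        b * (m + d) + (a + b) * (y + x + m * d) + (a + b) * (m + d) * (m + d) + (a * (m + y) + b * y)
      e₂ = ℕ-solve

  -- Substituting i = M + k into c tri(i) + b i + c M (2M - i), the mixed terms c M k cancel, and
  -- what depends on k is c k(k-1)/2 + b k = a k(k-1)/2 + b k(k+1)/2.
  exponent : ∀ M k → ℤ.∣ k ∣ ≤ M →
    c * tri (offset M k) + b * offset M k + c * M * offset M (-ᶻ k) ≡
    b * M + c * tri M + c * M * M + rexp a b k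
  exponent M (+ m) k≤M with ℕₚ.m≤n⇒∃[o]m+o≡n k≤M
  ... | d , refl = trans
    (cong (λ z → c * tri (m + d + m) + b * (m + d + m) + c * (m + d) * z) (low m d))
    (trans (exponent-pos m d)
      (cong (λ z → b * (m + d) + c * tri (m + d) + c * (m + d) * (m + d) + (a * z + b * (m + tri m))) (sym (triᶻ-neg m))))
    where
    low : ∀ m d → offset (m + d) (-ᶻ (+ m)) ≡ d
    low zero    d = ℕₚ.+-identityʳ d
    low (suc m) d = ℕₚ.m+n∸m≡n m d
  exponent M -[1+ l ] k≤M with ℕₚ.m≤n⇒∃[o]m+o≡n k≤M
  ... | d , refl = trans
    (cong (λ z → c * tri z + b * z + c * (suc l + d) * (suc l + d + suc l)) (ℕₚ.m+n∸m≡n l d))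
    (exponent-neg (suc l) d)

  private
    zpow-offset : ∀ M k → ℤ.∣ k ∣ ≤ M → zpow ε (offset M k) ≡ zpow ε M *ᶻ zpow ε ℤ.∣ k ∣
    zpow-offset M (+ m)    k≤M = zpow-+ ε M m
    zpow-offset M -[1+ m ] k≤M = begin
      zpow ε (M ∸ suc m)                                       ≡⟨ ℤₚ.*-identityʳ _ ⟨
      zpow ε (M ∸ suc m) *ᶻ 1ℤ                                  ≡⟨ cong (zpow ε (M ∸ suc m) *ᶻ_) (zpow-square ε εε (suc m)) ⟨
      zpow ε (M ∸ suc m) *ᶻ (zpow ε (suc m) *ᶻ zpow ε (suc m))   ≡⟨ ℤₚ.*-assoc (zpow ε (M ∸ suc m)) (zpow ε (suc m)) (zpow ε (suc m)) ⟨
      zpow ε (M ∸ suc m) *ᶻ zpow ε (suc m) *ᶻ zpow ε (suc m)     ≡⟨ cong (_*ᶻ zpow ε (suc m)) (zpow-+ ε (M ∸ suc m) (suc m)) ⟨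
      zpow ε (M ∸ suc m + suc m) *ᶻ zpow ε (suc m)              ≡⟨ cong (λ z → zpow ε z *ᶻ zpow ε (suc m)) (ℕₚ.m∸n+n≡m k≤M) ⟩
      zpow ε M *ᶻ zpow ε (suc m)                                ∎
      where open ≡-Reasoning

  sum-side : ∀ n → sumS (suc n + suc n) (λ i → binomial-term ε a b (c * suc n) i (suc n + suc n ∸ i)) ≈
    const (zpow ε (suc n)) ∙ mono (scale n) ∙ zsumS (suc n) (theta-term (suc n))
  sum-side n = begin
    sumS (M + M) (λ i → binomial-term ε a b (c * M) i (M + M ∸ i))
      ≈⟨ pointwise (λ N → sumTo-centred M (λ i → binomial-term ε a b (c * M) i (M + M ∸ i) N)) ⟩
    zsumS M (λ k → binomial-term ε a b (c * M) (offset M k) (M + M ∸ offset M k))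
      ≈⟨ zsumS-cong≤ M (λ k k≤M → ≈-trans
           (≡⇒≈ (cong (binomial-term ε a b (c * M) (offset M k)) (co-offset M k k≤M))) (term k k≤M)) ⟩
    zsumS M (λ k → const (zpow ε M) ∙ mono (scale n) ∙ theta-term M k)
      ≈⟨ ∙-zsumS (const (zpow ε M) ∙ mono (scale n)) M (theta-term M) ⟨
    const (zpow ε M) ∙ mono (scale n) ∙ zsumS M (theta-term M) ∎
    where
    open ≈-Reasoning
    M = suc n
    term : ∀ k → ℤ.∣ k ∣ ≤ M → binomial-term ε a b (c * M) (offset M k) (offset M (-ᶻ k)) ≈
      const (zpow ε M) ∙ mono (scale n) ∙ theta-term M k
    term k k≤M = begin
      const (zpow ε (offset M k)) ∙ mono (c * tri (offset M k) + b * offset M k + c * M * offset M (-ᶻ k)) ∙ G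
        ≈⟨ ∙-congʳ (∙-cong (≈-trans (≡⇒≈ (cong const (zpow-offset M k k≤M))) (≈-sym (const-* (zpow ε M) (zpow ε ℤ.∣ k ∣))))
             (≈-trans (≡⇒≈ (cong mono (exponent M k k≤M))) (≈-sym (mono-+ (scale n) (rexp a b k))))) ⟩
      const (zpow ε M) ∙ const (zpow ε ℤ.∣ k ∣) ∙ (mono (scale n) ∙ mono (rexp a b k)) ∙ G
        ≈⟨ Mon.solve 5 (λ u v w x y → ((u ⊙ v) ⊙ (w ⊙ x)) ⊙ y ⊜ (u ⊙ w) ⊙ ((v ⊙ x) ⊙ y)) ≈-refl
             (const (zpow ε M)) (const (zpow ε ℤ.∣ k ∣)) (mono (scale n)) (mono (rexp a b k)) G ⟩
      const (zpow ε M) ∙ mono (scale n) ∙ theta-term M k ∎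
      where G = gaussian c (offset M k) (offset M (-ᶻ k))

  -- The finite form of the triple product: both sides of the q-binomial theorem carry ε^M
  -- q^`scale`. The sign is removed by multiplying with itself, the monomial by shifting
  -- coefficients.
  finite-triple-product : ∀ n →
    linear-factors a n ∙ linear-factors b n ≈ zsumS (suc n) (theta-term (suc n))
  finite-triple-product n = mono-cancel (scale n) (begin
    s ∙ L                     ≈⟨ ∙-identityˡ (s ∙ L) ⟨
    oneS ∙ (s ∙ L)            ≈⟨ ∙-congʳ ε²≈1 ⟨
    (E ∙ E) ∙ (s ∙ L)         ≈⟨ regroup E s L ⟩
    E ∙ (E ∙ s ∙ L)
      ≈⟨ ∙-congˡ (≈-trans (≈-sym (product-side n)) (≈-trans (q-binomial ε a b (c * suc n) (n + suc n)) (sum-side n))) ⟩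
    E ∙ (E ∙ s ∙ Z)           ≈⟨ regroup E s Z ⟨
    (E ∙ E) ∙ (s ∙ Z)         ≈⟨ ∙-congʳ ε²≈1 ⟩
    oneS ∙ (s ∙ Z)            ≈⟨ ∙-identityˡ (s ∙ Z) ⟩
    s ∙ Z                     ∎)
    where
    open ≈-Reasoning
    E = const (zpow ε (suc n))
    s = mono (scale n)
    L = linear-factors a n ∙ linear-factors b n
    Z = zsumS (suc n) (theta-term (suc n))
    ε²≈1 : E ∙ E ≈ oneS
    ε²≈1 = ≈-trans (const-* _ _) (≈-trans (≡⇒≈ (cong const (zpow-square ε εε (suc n)))) (≈-sym oneS≈const1))
    regroup : ∀ u v w → (u ∙ u) ∙ (v ∙ w) ≈ u ∙ (u ∙ v ∙ w)
    regroup = Mon.solve 3 (λ u v w → (u ⊙ u) ⊙ (v ⊙ w) ⊜ u ⊙ ((u ⊙ v) ⊙ w)) ≈-refl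

pochhammer-limit : ∀ c .{{_ : NonZero c}} {N m} → N < m → pochhammer c m ≈ qprod -1ℤ c c upto N
pochhammer-limit c {N} {suc m} (s≤s N≤m) =
  upto-trans (≈⇒upto (finite m)) (prodTo-infprod (qprod-tendsTo1 -1ℤ c c) N≤m)
  where
  step : ∀ n → binom -1ℤ (c * suc n) ≈ binom -1ℤ (c + n * c)
  step n = ≡⇒≈ (cong (binom -1ℤ) (ℕₚ.*-comm c (suc n)))
  finite : ∀ n → pochhammer c (suc n) ≈ prodTo n (λ j → binom -1ℤ (c + j * c))
  finite zero    = ≈-trans (∙-identityˡ _) (step 0)
  finite (suc n) = ≈-trans (∙-cong (finite n) (step (suc n))) (≈-sym (prodTo-suc n _))

-- Up to q^N every Pochhammer product of more than N factors equals D = `qprod -1ℤ c c`. Hence D · D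
-- · `gaussian c i j` is D, and one D cancels.
gaussian-limit : ∀ c .{{_ : NonZero c}} {N i j} → N < i → N < j →
  qprod -1ℤ c c ∙ gaussian c i j ≈ oneS upto N
gaussian-limit c {N} {i} {j} N<i N<j = ∙-cancel-upto N (qprod-head -1ℤ c c) (upto-trans
  (≈⇒upto (Mon.solve 2 (λ d g → d ⊙ (d ⊙ g) ⊜ g ⊙ (d ⊙ d)) ≈-refl D (gaussian c i j)))
  (upto-trans (∙-upto upto-refl (∙-upto (upto-sym (pochhammer-limit c N<i)) (upto-sym (pochhammer-limit c N<j))))
    (upto-trans (≈⇒upto (gaussian-pochhammer c i j))
      (upto-trans (pochhammer-limit c (ℕₚ.≤-trans N<i (ℕₚ.m≤m+n i j))) (≈⇒upto (≈-sym (∙-identityʳ D)))))))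
  where D = qprod -1ℤ c c

offset-large : ∀ N k → ℤ.∣ k ∣ ≤ N → N < offset (suc (N + N)) k
offset-large N (+ m)    k≤N = s≤s (ℕₚ.≤-trans (ℕₚ.m≤m+n N N) (ℕₚ.m≤m+n (N + N) m))
offset-large N -[1+ m ] k≤N = ℕₚ.≤-trans (ℕₚ.≤-reflexive (sym (ℕₚ.m+n∸n≡m (suc N) N)))
  (ℕₚ.≤-trans (ℕₚ.∸-monoʳ-≤ (suc (N + N)) k≤N) ℕₚ.≤-refl)

-- Coefficient N is read off the finite form with M = 2N + 1. Terms with exponent above N vanish;
-- for the others coercivity gives |k| ≤ N, so M + k and M - k both exceed N and D cancels the
-- Gaussian coefficient up to q^N.
jacobi-triple-product : ∀ ε → ε *ᶻ ε ≡ 1ℤ → ∀ a b .{{_ : NonZero a}} .{{_ : NonZero b}} →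
  rtheta ε a b ≈ qprod ε a (a + b) ∙ qprod ε b (a + b) ∙ qprod -1ℤ (a + b) (a + b)
jacobi-triple-product ε εε a@(suc _) b = pointwise coefficient
  where
  c = a + b
  D = qprod -1ℤ c c
  w : ℤ → ℤ
  w k = zpow ε ℤ.∣ k ∣
  coefficient : ∀ N → rtheta ε a b N ≡ (qprod ε a c ∙ qprod ε b c ∙ D) N
  coefficient N = begin
    rtheta ε a b N
      ≡⟨ theta-window w (rexp-coercive a b) (ℕₚ.m≤n⇒m≤1+n (ℕₚ.m≤m+n N N)) ⟩
    zsum M (λ k → w k *ᶻ δ (rexp a b k) N)
      ≡⟨ zsum-cong M term ⟨
    zsumS M (λ k → D ∙ theta-term ε εε a b M k) N
      ≡⟨ at (∙-zsumS D M (theta-term ε εε a b M)) N ⟨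
    (D ∙ zsumS M (theta-term ε εε a b M)) N
      ≡⟨ at (∙-congˡ (finite-triple-product ε εε a b (N + N))) N ⟨
    (D ∙ (linear-factors ε εε a b a (N + N) ∙ linear-factors ε εε a b b (N + N))) N
      ≡⟨ at≤ (∙-upto upto-refl (∙-upto (prodTo-infprod (qprod-tendsTo1 ε a c) (ℕₚ.m≤m+n N N))
                                       (prodTo-infprod (qprod-tendsTo1 ε b c) (ℕₚ.m≤m+n N N)))) N ℕₚ.≤-refl ⟩
    (D ∙ (qprod ε a c ∙ qprod ε b c)) N
      ≡⟨ at (∙-comm D _) N ⟩
    (qprod ε a c ∙ qprod ε b c ∙ D) N ∎
    where
    open ≡-Reasoning
    M = suc (N + N)
    term : ∀ k → (D ∙ theta-term ε εε a b M k) N ≡ w k *ᶻ δ (rexp a b k) N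
    term k with ℕₚ.<-≤-connex N (rexp a b k)
    ... | inj₁ N<r = begin
      (D ∙ (const (w k) ∙ mono r ∙ G)) N
        ≡⟨ at (Mon.solve 4 (λ d x y g → d ⊙ ((x ⊙ y) ⊙ g) ⊜ y ⊙ (d ⊙ (x ⊙ g))) ≈-refl
             D (const (w k)) (mono r) G) N ⟩
      (mono r ∙ (D ∙ (const (w k) ∙ G))) N   ≡⟨ mono-below r _ N N<r ⟩
      0ℤ                                     ≡⟨ *ᶻ-δ-≢ (w k) (ℕₚ.>⇒≢ N<r) ⟨
      w k *ᶻ δ r N                           ∎
      where
      r = rexp a b k
      G = gaussian c (offset M k) (offset M (-ᶻ k))
    ... | inj₂ r≤N = begin
      (D ∙ (const (w k) ∙ mono r ∙ G)) N
        ≡⟨ at (Mon.solve 4 (λ d x y g → d ⊙ ((x ⊙ y) ⊙ g) ⊜ x ⊙ (y ⊙ (d ⊙ g))) ≈-refl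
             D (const (w k)) (mono r) G) N ⟩
      (const (w k) ∙ (mono r ∙ (D ∙ G))) N
        ≡⟨ at≤ (∙-upto upto-refl (∙-upto upto-refl (gaussian-limit c (offset-large N k k≤N)
             (offset-large N (-ᶻ k) (ℕₚ.≤-trans (ℕₚ.≤-reflexive (ℤₚ.∣-i∣≡∣i∣ k)) k≤N))))) N ℕₚ.≤-refl ⟩
      (const (w k) ∙ (mono r ∙ oneS)) N      ≡⟨ at (∙-cong (≈-refl {const (w k)}) (∙-identityʳ (mono r))) N ⟩
      (const (w k) ∙ mono r) N               ≡⟨ at (const-∙ (w k) (mono r)) N ⟩
      w k *ᶻ δ N r                           ≡⟨ cong (w k *ᶻ_) (δ-comm N r) ⟩
      w k *ᶻ δ r N                           ∎
      where
      r = rexp a b k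
      G = gaussian c (offset M k) (offset M (-ᶻ k))
      k≤N = ℕₚ.≤-trans (rexp-coercive a b k) r≤N

-- The generating function as a quotient of theta functions

-- The substitution s(q^d).
dilate : ℕ → Series → Series
dilate d s n = sumTo n (λ j → s j *ᶻ δ (j * d) n)

dilate-below : ∀ d s n → n < d → dilate d s n ≡ s 0 *ᶻ δ n 0
dilate-below d s zero    n<d = refl
dilate-below d s (suc n) n<d = trans (sumTo-head n _) (trans (cong₂ _+ᶻ_ (cong (s 0 *ᶻ_) (δ-comm 0 (suc n)))
  (sumTo-0 n λ k _ → *ᶻ-δ-≢ (s (suc k)) (ℕₚ.>⇒≢ (ℕₚ.<-≤-trans n<d (ℕₚ.m≤m+n d (k * d)))))) (ℤₚ.+-identityʳ _))

dilate-step : ∀ d .{{_ : NonZero d}} s n → dilate d s (d + n) ≡ dilate d (tail s) n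
dilate-step d@(suc d′) s n = begin
  sumTo (suc (d′ + n)) (λ k → s k *ᶻ δ (k * d) (d + n))
    ≡⟨ sumTo-head (d′ + n) _ ⟩
  s 0 *ᶻ δ 0 (d + n) +ᶻ sumTo (d′ + n) (λ k → s (suc k) *ᶻ δ (d + k * d) (d + n))
    ≡⟨ cong₂ _+ᶻ_ (*ᶻ-δ-≢ (s 0) {0} {d + n} λ ()) (sumTo-cong (d′ + n) shift) ⟩
  0ℤ +ᶻ sumTo (d′ + n) (λ k → s (suc k) *ᶻ δ (k * d) n)
    ≡⟨ ℤₚ.+-identityˡ _ ⟩
  sumTo (d′ + n) (λ k → s (suc k) *ᶻ δ (k * d) n)
    ≡⟨ extra d′ ⟩
  dilate d (tail s) n ∎
  where
  open ≡-Reasoning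
  shift : ∀ k → s (suc k) *ᶻ δ (d + k * d) (d + n) ≡ s (suc k) *ᶻ δ (k * d) n
  shift k = cong (s (suc k) *ᶻ_) (δ-⇔ (ℕₚ.+-cancelˡ-≡ d (k * d) n) (cong (λ z → d + z)))
  extra : ∀ e → sumTo (e + n) (λ k → s (suc k) *ᶻ δ (k * d) n) ≡ dilate d (tail s) n
  extra zero    = refl
  extra (suc e) = trans (cong₂ _+ᶻ_ (extra e) (*ᶻ-δ-≢ (s (suc (suc (e + n))))
    (ℕₚ.>⇒≢ (ℕₚ.≤-trans (s≤s (ℕₚ.m≤n+m n e)) (ℕₚ.m≤m*n (suc (e + n)) d))))) (ℤₚ.+-identityʳ _)

geom-below : ∀ x d n → n < d → geom x d n ≡ δ n 0
geom-below x d n n<d = trans (dilate-below d (zpow x) n n<d) (ℤₚ.*-identityˡ (δ n 0))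

geom-step : ∀ x d .{{_ : NonZero d}} n → geom x d (d + n) ≡ x *ᶻ geom x d n
geom-step x d n = trans (dilate-step d (zpow x) n) (trans
  (sumTo-cong n (λ k → ℤₚ.*-assoc x (zpow x k) (δ (k * d) n))) (sumTo-*ˡ n x _))

geom-inverse : ∀ x d .{{_ : NonZero d}} → binom (-ᶻ x) d ∙ geom x d ≈ oneS
geom-inverse x d = pointwise λ n → trans (at expand n) (go n)
  where
  expand : binom (-ᶻ x) d ∙ geom x d ≈ geom x d ⊕ const (-ᶻ x) ∙ (mono d ∙ geom x d)
  expand = ≈-trans (∙-congʳ (≈-trans (binom-mono (-ᶻ x) d) (⊕-congʳ oneS≈const1)))
    (SR.solve 3 (λ c m g → (con 1ℤ :+ c :* m) :* g := g :+ c :* (m :* g)) ≈-refl (const (-ᶻ x)) (mono d) (geom x d))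
  value : ∀ n → (geom x d ⊕ const (-ᶻ x) ∙ (mono d ∙ geom x d)) n ≡ geom x d n +ᶻ (-ᶻ x) *ᶻ (mono d ∙ geom x d) n
  value n = trans (⊕-at _ _ n) (cong (geom x d n +ᶻ_) (at (const-∙ (-ᶻ x) (mono d ∙ geom x d)) n))
  cancel : ∀ x y → x *ᶻ y +ᶻ (-ᶻ x) *ᶻ y ≡ 0ℤ
  cancel = ℤ-solve
  d≢0 : d ≢ 0
  d≢0 = ≢-nonZero⁻¹ d
  go : ∀ n → (geom x d ⊕ const (-ᶻ x) ∙ (mono d ∙ geom x d)) n ≡ δ n 0
  go n with n ℕₚ.<? d
  ... | yes n<d = trans (value n) (trans (cong₂ _+ᶻ_ (geom-below x d n n<d)
        (trans (cong ((-ᶻ x) *ᶻ_) (mono-below d _ n n<d)) (ℤₚ.*-zeroʳ (-ᶻ x)))) (ℤₚ.+-identityʳ _))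
  ... | no n≮d with ℕₚ.m≤n⇒∃[o]m+o≡n (ℕₚ.≮⇒≥ n≮d)
  ... | m , refl = trans (value (d + m)) (trans (cong₂ _+ᶻ_ (geom-step x d m)
        (cong ((-ᶻ x) *ᶻ_) (mono-shift d (geom x d) m)))
        (trans (cancel x (geom x d m)) (sym (δ-≢ (λ eq → d≢0 (ℕₚ.m+n≡0⇒m≡0 d eq))))))

-- The exponents are written as a + j c, the shape required by `qprod`.
schurFactor-numerator schurFactor-denominator : ℕ → Series
schurFactor-numerator   j = binom 1ℤ (1 + j * 2) ∙ binom -1ℤ (3 + j * 6)
schurFactor-denominator j = binom -1ℤ (1 + j * 2) ∙ binom 1ℤ (3 + j * 6)

factor-fraction : ∀ j → schurFactor-denominator j ∙ factor j ≈ schurFactor-numerator j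
factor-fraction j = begin
  binom -1ℤ (1 + j * 2) ∙ binom 1ℤ (3 + j * 6) ∙ factor j
    ≈⟨ ∙-cong (∙-cong (≡⇒≈ (cong (binom -1ℤ) (e₁ j))) (≡⇒≈ (cong (binom 1ℤ) (e₃ j)))) factor≈ ⟩
  binom -1ℤ d ∙ binom 1ℤ (3 * d) ∙ (binom 1ℤ d ∙ (binom -1ℤ (3 * d) ∙ (geom -1ℤ (3 * d) ∙ geom 1ℤ d)))
    ≈⟨ Mon.solve 6 (λ u v w x y z → (u ⊙ v) ⊙ (w ⊙ (x ⊙ (y ⊙ z))) ⊜ ((u ⊙ z) ⊙ (v ⊙ y)) ⊙ (w ⊙ x)) ≈-refl
         (binom -1ℤ d) (binom 1ℤ (3 * d)) (binom 1ℤ d) (binom -1ℤ (3 * d)) (geom -1ℤ (3 * d)) (geom 1ℤ d) ⟩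
  (binom -1ℤ d ∙ geom 1ℤ d) ∙ (binom 1ℤ (3 * d) ∙ geom -1ℤ (3 * d)) ∙ (binom 1ℤ d ∙ binom -1ℤ (3 * d))
    ≈⟨ ∙-congʳ (∙-cong (geom-inverse 1ℤ d) (geom-inverse -1ℤ (3 * d))) ⟩
  oneS ∙ oneS ∙ (binom 1ℤ d ∙ binom -1ℤ (3 * d))
    ≈⟨ ≈-trans (∙-congʳ (∙-identityˡ oneS)) (∙-identityˡ _) ⟩
  binom 1ℤ d ∙ binom -1ℤ (3 * d)
    ≈⟨ ∙-cong (≡⇒≈ (cong (binom 1ℤ) (e₁ j))) (≡⇒≈ (cong (binom -1ℤ) (e₃ j))) ⟨
  schurFactor-numerator j ∎
  where
  open ≈-Reasoning
  d = suc (2 * j)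
  e₁ : ∀ j → 1 + j * 2 ≡ suc (2 * j)
  e₁ = ℕ-solve
  e₃ : ∀ j → 3 + j * 6 ≡ 3 * suc (2 * j)
  e₃ = ℕ-solve
  factor≈ : factor j ≈ binom 1ℤ d ∙ (binom -1ℤ (3 * d) ∙ (geom -1ℤ (3 * d) ∙ geom 1ℤ d))
  factor≈ = ≈-trans (⊛≈∙ _ _) (∙-congˡ (≈-trans (⊛≈∙ _ _) (∙-congˡ (⊛≈∙ _ _))))

binom-head : ∀ ε d .{{_ : NonZero d}} → binom ε d 0 ≡ 1ℤ
binom-head ε (suc d) = cong (1ℤ +ᶻ_) (ℤₚ.*-zeroʳ ε)

∙-head : ∀ f g → f 0 ≡ 1ℤ → g 0 ≡ 1ℤ → (f ∙ g) 0 ≡ 1ℤ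
∙-head f g p q = trans (∙-at f g 0) (cong₂ _*ᶻ_ p q)

∙-near-1 : ∀ {f g N} → f ≈ oneS upto N → g ≈ oneS upto N → f ∙ g ≈ oneS upto N
∙-near-1 p q = upto-trans (∙-upto p q) (≈⇒upto (∙-identityˡ oneS))

-- Numerator and denominator are both 1 up to q^j, and the denominator can be cancelled because its
-- constant term is 1.
factor-tendsTo1 : TendsTo1 factor
factor-tendsTo1 j = ∙-cancel-upto j {schurFactor-denominator j}
  (∙-head (binom -1ℤ (1 + j * 2)) (binom 1ℤ (3 + j * 6)) (binom-head -1ℤ (1 + j * 2)) (binom-head 1ℤ (3 + j * 6)))
  (upto-trans (≈⇒upto (factor-fraction j)) (upto-trans
    (∙-near-1 (qprod-tendsTo1 1ℤ 1 2 j) (qprod-tendsTo1 -1ℤ 3 6 j))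
    (upto-sym (upto-trans (≈⇒upto (∙-identityʳ _))
      (∙-near-1 (qprod-tendsTo1 -1ℤ 1 2 j) (qprod-tendsTo1 1ℤ 3 6 j))))))

opaque
  schur : Series
  schur = infprod factor

  schur-upto : ∀ N → prodTo N factor ≈ schur upto N
  schur-upto N = prodTo-infprod factor-tendsTo1 ℕₚ.≤-refl

  schur-fraction : qprod -1ℤ 1 2 ∙ qprod 1ℤ 3 6 ∙ schur ≈ qprod 1ℤ 1 2 ∙ qprod -1ℤ 3 6
  schur-fraction = begin
    qprod -1ℤ 1 2 ∙ qprod 1ℤ 3 6 ∙ schur
      ≈⟨ ∙-congʳ (infprod-∙ (qprod-tendsTo1 -1ℤ 1 2) (qprod-tendsTo1 1ℤ 3 6)) ⟨
    infprod schurFactor-denominator ∙ schur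
      ≈⟨ infprod-∙ (λ j → ∙-near-1 (qprod-tendsTo1 -1ℤ 1 2 j) (qprod-tendsTo1 1ℤ 3 6 j)) factor-tendsTo1 ⟨
    infprod (λ j → schurFactor-denominator j ∙ factor j)
      ≈⟨ infprod-cong factor-fraction ⟩
    infprod schurFactor-numerator
      ≈⟨ infprod-∙ (qprod-tendsTo1 1ℤ 1 2) (qprod-tendsTo1 -1ℤ 3 6) ⟩
    qprod 1ℤ 1 2 ∙ qprod -1ℤ 3 6 ∎
    where open ≈-Reasoning

infixr 8 _^ˢ_
_^ˢ_ : Series → ℕ → Series
s ^ˢ zero  = oneS
s ^ˢ suc r = s ∙ s ^ˢ r

powS-^ˢ : ∀ r s → powS r s ≈ s ^ˢ r
powS-^ˢ zero    s = ≈-refl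
powS-^ˢ (suc r) s = ≈-trans (⊛≈∙ s (powS r s)) (∙-congˡ (powS-^ˢ r s))

^ˢ-upto : ∀ {s t N} → s ≈ t upto N → ∀ r → s ^ˢ r ≈ t ^ˢ r upto N
^ˢ-upto p zero    = upto-refl
^ˢ-upto p (suc r) = ∙-upto p (^ˢ-upto p r)

prodTo-oneS : ∀ n → prodTo n (λ _ → oneS) ≈ oneS
prodTo-oneS zero    = ≈-refl
prodTo-oneS (suc n) = ≈-trans (prodTo-suc n _) (≈-trans (∙-identityʳ _) (prodTo-oneS n))

prodTo-^ˢ : ∀ r n s → prodTo n (λ j → s j ^ˢ r) ≈ prodTo n s ^ˢ r
prodTo-^ˢ zero    n s = prodTo-oneS n
prodTo-^ˢ (suc r) n s = ≈-trans (prodTo-∙ n s (λ j → s j ^ˢ r)) (∙-congˡ (prodTo-^ˢ r n s))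

-- The truncated product in the definition is the r-th power of a partial product that agrees with
-- `schur` up to q^N, and powers preserve this agreement.
S3bar-schur : ∀ r N → S3bar r N ≡ (schur ^ˢ r) N
S3bar-schur r N = trans (at (≈-trans (prodTo-cong N (λ j → powS-^ˢ r (factor j))) (prodTo-^ˢ r N factor)) N)
  (at≤ (^ˢ-upto (schur-upto N) r) N ℕₚ.≤-refl)

-- Product formulas for theta functions

-- φ(qᵏ), φ(-qᵏ), ψ(qᵏ) and f_k.
φ⁺ φ⁻ ψ η : (k : ℕ) → Series
φ⁺ k = rtheta 1ℤ k k
φ⁻ k = rtheta -1ℤ k k
ψ k = rtheta 1ℤ k (3 * k)
η k = qprod -1ℤ k k

-- f(q, q²) and f(-q, -q⁵), which occur in the 3-dissections of ψ(q) and φ(-q).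
θ₁₂ θ₁₅ : Series
θ₁₂ = rtheta 1ℤ 1 2
θ₁₅ = rtheta -1ℤ 1 5

private
  -- The products of 1 - q^(kn) and of 1 + q^(kn) over odd n. Together with `η` they express every
  -- theta product below.
  x⁻ x⁺ : ℕ → Series
  x⁻ k = qprod -1ℤ k (2 * k)
  x⁺ k = qprod 1ℤ k (2 * k)

  η-split : ∀ k .{{_ : NonZero k}} → η k ≈ x⁻ k ∙ η (2 * k)
  η-split k = ≈-trans (qprod-bisect -1ℤ k k)
    (∙-congˡ (≡⇒≈ (cong (λ m → qprod -1ℤ m (2 * k)) (e k))))
    where
    e : ∀ k → k + k ≡ 2 * k
    e = ℕ-solve

  x-square : ∀ k .{{_ : NonZero k}} → x⁺ k ∙ x⁻ k ≈ x⁻ (2 * k)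
  x-square k@(suc _) = qprod-squares k (2 * k)

  φ-product : ∀ ε → ε *ᶻ ε ≡ 1ℤ → ∀ k .{{_ : NonZero k}} →
    rtheta ε k k ≈ qprod ε k (2 * k) ∙ qprod ε k (2 * k) ∙ η (2 * k)
  φ-product ε εε k = ≈-trans (jacobi-triple-product ε εε k k)
    (≡⇒≈ (cong (λ m → qprod ε k m ∙ qprod ε k m ∙ η m) (e k)))
    where
    e : ∀ k → k + k ≡ 2 * k
    e = ℕ-solve

  ψ-product : ∀ k .{{_ : NonZero k}} → ψ k ≈ x⁺ k ∙ η (4 * k)
  ψ-product k@(suc _) = ≈-trans (jacobi-triple-product 1ℤ refl k (3 * k)) (∙-congʳ (≈-sym (begin
    qprod 1ℤ k (2 * k)                                    ≈⟨ qprod-bisect 1ℤ k (2 * k) ⟩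
    qprod 1ℤ k (2 * (2 * k)) ∙ qprod 1ℤ (3 * k) (2 * (2 * k))
      ≈⟨ ≡⇒≈ (cong (λ m → qprod 1ℤ k m ∙ qprod 1ℤ (3 * k) m) (e k)) ⟩
    qprod 1ℤ k (k + 3 * k) ∙ qprod 1ℤ (3 * k) (k + 3 * k) ∎)))
    where
    open ≈-Reasoning
    e : ∀ k → 2 * (2 * k) ≡ k + 3 * k
    e = ℕ-solve

  γ : ℕ → Series
  γ k = qprod 1ℤ k k

  -- Euler's theorem on odd and distinct parts: f_2k is both `γ k` times f_k and, up to the factor
  -- `x⁻ k`, equal to f_k; then f_2k is cancelled.
  euler-odd-distinct : ∀ k .{{_ : NonZero k}} → γ k ∙ x⁻ k ≈ oneS
  euler-odd-distinct k@(suc _) = ∙-cancel (qprod-head -1ℤ (2 * k) (2 * k)) (begin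
    η (2 * k) ∙ (γ k ∙ x⁻ k)
      ≈⟨ Mon.solve 3 (λ e g x → e ⊙ (g ⊙ x) ⊜ g ⊙ (x ⊙ e)) ≈-refl (η (2 * k)) (γ k) (x⁻ k) ⟩
    γ k ∙ (x⁻ k ∙ η (2 * k))      ≈⟨ ∙-congˡ (η-split k) ⟨
    γ k ∙ η k                     ≈⟨ qprod-squares k k ⟩
    η (2 * k)                     ≈⟨ ∙-identityʳ _ ⟨
    η (2 * k) ∙ oneS              ∎)
    where open ≈-Reasoning

φ⁺φ⁻ : ∀ k .{{_ : NonZero k}} → φ⁺ k ∙ φ⁻ k ≈ φ⁻ (2 * k) ∙ φ⁻ (2 * k)
φ⁺φ⁻ k@(suc _) = begin
  φ⁺ k ∙ φ⁻ k
    ≈⟨ ∙-cong (φ-product 1ℤ refl k) (φ-product -1ℤ refl k) ⟩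
  (x⁺ k ∙ x⁺ k ∙ η (2 * k)) ∙ (x⁻ k ∙ x⁻ k ∙ η (2 * k))
    ≈⟨ Mon.solve 3 (λ x y e → (x ⊙ x ⊙ e) ⊙ (y ⊙ y ⊙ e) ⊜ ((x ⊙ y) ⊙ e) ⊙ ((x ⊙ y) ⊙ e))
         ≈-refl (x⁺ k) (x⁻ k) (η (2 * k)) ⟩
  (x⁺ k ∙ x⁻ k ∙ η (2 * k)) ∙ (x⁺ k ∙ x⁻ k ∙ η (2 * k))
    ≈⟨ ∙-cong half half ⟩
  φ⁻ (2 * k) ∙ φ⁻ (2 * k) ∎
  where
  open ≈-Reasoning
  half : x⁺ k ∙ x⁻ k ∙ η (2 * k) ≈ φ⁻ (2 * k)
  half = ≈-trans (∙-cong (x-square k) (η-split (2 * k)))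
    (≈-trans (≈-sym (∙-assoc _ _ _)) (≈-sym (φ-product -1ℤ refl (2 * k))))

ψ-squared : ∀ k .{{_ : NonZero k}} → ψ k ∙ ψ k ≈ ψ (2 * k) ∙ φ⁺ k
ψ-squared k@(suc _) = begin
  ψ k ∙ ψ k
    ≈⟨ ∙-cong (ψ-product k) (≈-trans (ψ-product k) (∙-congˡ η4)) ⟩
  (x⁺ k ∙ η (4 * k)) ∙ (x⁺ k ∙ ((x⁺ (2 * k) ∙ x⁻ (2 * k)) ∙ η (4 * (2 * k))))
    ≈⟨ Mon.solve 5 (λ x y u v w → (x ⊙ u) ⊙ (x ⊙ ((y ⊙ v) ⊙ w)) ⊜ (y ⊙ w) ⊙ (x ⊙ x ⊙ (v ⊙ u)))
         ≈-refl (x⁺ k) (x⁺ (2 * k)) (η (4 * k)) (x⁻ (2 * k)) (η (4 * (2 * k))) ⟩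
  (x⁺ (2 * k) ∙ η (4 * (2 * k))) ∙ (x⁺ k ∙ x⁺ k ∙ (x⁻ (2 * k) ∙ η (4 * k)))
    ≈⟨ ∙-cong (ψ-product (2 * k)) (≈-trans (φ-product 1ℤ refl k) (∙-congˡ
         (≈-trans (η-split (2 * k)) (∙-congˡ (≡⇒≈ (cong η (e₄ k))))))) ⟨
  ψ (2 * k) ∙ φ⁺ k ∎
  where
  open ≈-Reasoning
  e₄ : ∀ k → 2 * (2 * k) ≡ 4 * k
  e₄ = ℕ-solve
  e₈ : ∀ k → 2 * (2 * (2 * k)) ≡ 4 * (2 * k)
  e₈ = ℕ-solve
  η4 : η (4 * k) ≈ (x⁺ (2 * k) ∙ x⁻ (2 * k)) ∙ η (4 * (2 * k))
  η4 = ≈-trans (≡⇒≈ (cong η (sym (e₄ k)))) (≈-trans (η-split (2 * (2 * k)))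
    (∙-cong (≈-sym (x-square (2 * k))) (≡⇒≈ (cong η (e₈ k)))))

η1ψ1 : η 1 ∙ ψ 1 ≈ η 2 ∙ η 2
η1ψ1 = begin
  η 1 ∙ ψ 1
    ≈⟨ ∙-cong (η-split 1) (ψ-product 1) ⟩
  (x⁻ 1 ∙ η 2) ∙ (x⁺ 1 ∙ η 4)
    ≈⟨ Mon.solve 4 (λ x y u v → (x ⊙ u) ⊙ (y ⊙ v) ⊜ u ⊙ ((y ⊙ x) ⊙ v)) ≈-refl (x⁻ 1) (x⁺ 1) (η 2) (η 4) ⟩
  η 2 ∙ (x⁺ 1 ∙ x⁻ 1 ∙ η 4)
    ≈⟨ ∙-congˡ (≈-trans (∙-congʳ (x-square 1)) (≈-sym (η-split 2))) ⟩
  η 2 ∙ η 2 ∎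
  where open ≈-Reasoning

private
  -- By the triple product `θ₁₅` contains the residues 1, 5 and 0 modulo 6. The factor `x⁻ 3` adds
  -- the residue 3, which completes the odd exponents.
  x⁻3θ₁₅ : x⁻ 3 ∙ θ₁₅ ≈ x⁻ 1 ∙ η 6
  x⁻3θ₁₅ = begin
    x⁻ 3 ∙ θ₁₅
      ≈⟨ ∙-congˡ (jacobi-triple-product -1ℤ refl 1 5) ⟩
    x⁻ 3 ∙ (qprod -1ℤ 1 6 ∙ qprod -1ℤ 5 6 ∙ η 6)
      ≈⟨ Mon.solve 4 (λ x u v e → x ⊙ (u ⊙ v ⊙ e) ⊜ (u ⊙ x ⊙ v) ⊙ e) ≈-refl (x⁻ 3) (qprod -1ℤ 1 6) (qprod -1ℤ 5 6) (η 6) ⟩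
    (qprod -1ℤ 1 6 ∙ x⁻ 3 ∙ qprod -1ℤ 5 6) ∙ η 6
      ≈⟨ ∙-congʳ (qprod-trisect -1ℤ 1 2) ⟨
    x⁻ 1 ∙ η 6 ∎
    where open ≈-Reasoning

  γ3θ₁₂ : γ 3 ∙ θ₁₂ ≈ γ 1 ∙ η 3
  γ3θ₁₂ = begin
    γ 3 ∙ θ₁₂
      ≈⟨ ∙-congˡ (jacobi-triple-product 1ℤ refl 1 2) ⟩
    γ 3 ∙ (qprod 1ℤ 1 3 ∙ qprod 1ℤ 2 3 ∙ η 3)
      ≈⟨ Mon.solve 4 (λ x u v e → x ⊙ (u ⊙ v ⊙ e) ⊜ (u ⊙ v ⊙ x) ⊙ e) ≈-refl (γ 3) (qprod 1ℤ 1 3) (qprod 1ℤ 2 3) (η 3) ⟩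
    (qprod 1ℤ 1 3 ∙ qprod 1ℤ 2 3 ∙ γ 3) ∙ η 3
      ≈⟨ ∙-congʳ (qprod-trisect 1ℤ 1 1) ⟨
    γ 1 ∙ η 3 ∎
    where open ≈-Reasoning

  η2-split : ∀ k .{{_ : NonZero k}} → x⁺ k ∙ x⁻ k ∙ η (2 * (2 * k)) ≈ η (2 * k)
  η2-split k@(suc _) = ≈-trans (∙-congʳ (x-square k)) (≈-sym (η-split (2 * k)))

-- Both sides equal f_3 f_6. Dilated by 3, this becomes the relation that merges two terms in the
-- trisection of ψ(q) φ(-q)³.
θ₁₂θ₁₅ : θ₁₂ ∙ θ₁₅ ≈ φ⁻ 3 ∙ ψ 3
θ₁₂θ₁₅ = begin
  θ₁₂ ∙ θ₁₅
    ≈⟨ ∙-identityˡ _ ⟨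
  oneS ∙ (θ₁₂ ∙ θ₁₅)
    ≈⟨ ∙-congʳ (euler-odd-distinct 3) ⟨
  (γ 3 ∙ x⁻ 3) ∙ (θ₁₂ ∙ θ₁₅)
    ≈⟨ ∙-interchange (γ 3) (x⁻ 3) θ₁₂ θ₁₅ ⟩
  (γ 3 ∙ θ₁₂) ∙ (x⁻ 3 ∙ θ₁₅)
    ≈⟨ ∙-cong γ3θ₁₂ x⁻3θ₁₅ ⟩
  (γ 1 ∙ η 3) ∙ (x⁻ 1 ∙ η 6)
    ≈⟨ ∙-interchange (γ 1) (η 3) (x⁻ 1) (η 6) ⟩
  (γ 1 ∙ x⁻ 1) ∙ (η 3 ∙ η 6)
    ≈⟨ ≈-trans (∙-congʳ (euler-odd-distinct 1)) (∙-identityˡ _) ⟩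
  η 3 ∙ η 6
    ≈⟨ ∙-cong (η-split 3) (≈-sym (η2-split 3)) ⟩
  (x⁻ 3 ∙ η 6) ∙ (x⁺ 3 ∙ x⁻ 3 ∙ η 12)
    ≈⟨ Mon.solve 4 (λ x y u v → (x ⊙ u) ⊙ (y ⊙ x ⊙ v) ⊜ (x ⊙ x ⊙ u) ⊙ (y ⊙ v)) ≈-refl (x⁻ 3) (x⁺ 3) (η 6) (η 12) ⟩
  (x⁻ 3 ∙ x⁻ 3 ∙ η 6) ∙ (x⁺ 3 ∙ η 12)
    ≈⟨ ∙-cong (φ-product -1ℤ refl 3) (ψ-product 3) ⟨
  φ⁻ 3 ∙ ψ 3 ∎
  where
  open ≈-Reasoning

θ₁₅ψ1 : θ₁₅ ∙ ψ 1 ≈ η 2 ∙ ψ 3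
θ₁₅ψ1 = ∙-cancel (qprod-head -1ℤ 3 6) (begin
  x⁻ 3 ∙ (θ₁₅ ∙ ψ 1)
    ≈⟨ ∙-assoc _ _ _ ⟨
  (x⁻ 3 ∙ θ₁₅) ∙ ψ 1
    ≈⟨ ∙-cong x⁻3θ₁₅ (ψ-product 1) ⟩
  (x⁻ 1 ∙ η 6) ∙ (x⁺ 1 ∙ η 4)
    ≈⟨ Mon.solve 4 (λ x y u v → (x ⊙ u) ⊙ (y ⊙ v) ⊜ (y ⊙ x ⊙ v) ⊙ u) ≈-refl (x⁻ 1) (x⁺ 1) (η 6) (η 4) ⟩
  (x⁺ 1 ∙ x⁻ 1 ∙ η 4) ∙ η 6
    ≈⟨ ∙-cong (η2-split 1) (≈-sym (η2-split 3)) ⟩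
  η 2 ∙ (x⁺ 3 ∙ x⁻ 3 ∙ η 12)
    ≈⟨ Mon.solve 4 (λ x y u v → u ⊙ (y ⊙ x ⊙ v) ⊜ x ⊙ (u ⊙ (y ⊙ v))) ≈-refl (x⁻ 3) (x⁺ 3) (η 2) (η 12) ⟩
  x⁻ 3 ∙ (η 2 ∙ (x⁺ 3 ∙ η 12))
    ≈⟨ ∙-congˡ (∙-congˡ (ψ-product 3)) ⟨
  x⁻ 3 ∙ (η 2 ∙ ψ 3) ∎)
  where open ≈-Reasoning

-- Since φ(-q^(2k)) is `x⁺ k ∙ x⁻ k ∙ η (2 * k)`, multiplying the numerator by φ(-q²) φ(-q⁶)
-- completes the squares in φ(q) and φ(-q³). The surplus `x⁻ 1 ∙ x⁺ 3` is the denominator and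
-- cancels.
schur-theta : schur ∙ (φ⁻ 2 ∙ φ⁻ 6) ≈ φ⁺ 1 ∙ φ⁻ 3
schur-theta = ∙-cancel {x⁻ 1 ∙ x⁺ 3} (∙-head (x⁻ 1) (x⁺ 3) (qprod-head -1ℤ 1 2) (qprod-head 1ℤ 3 6)) (begin
  (x⁻ 1 ∙ x⁺ 3) ∙ (schur ∙ (φ⁻ 2 ∙ φ⁻ 6))
    ≈⟨ ∙-assoc _ _ _ ⟨
  (x⁻ 1 ∙ x⁺ 3 ∙ schur) ∙ (φ⁻ 2 ∙ φ⁻ 6)
    ≈⟨ ∙-cong schur-fraction (∙-cong (φ⁻2k 1) (φ⁻2k 3)) ⟩
  (x⁺ 1 ∙ x⁻ 3) ∙ ((x⁺ 1 ∙ x⁻ 1 ∙ η 2) ∙ (x⁺ 3 ∙ x⁻ 3 ∙ η 6))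
    ≈⟨ Mon.solve 6 (λ p m P M e f → (p ⊙ M) ⊙ ((p ⊙ m ⊙ e) ⊙ (P ⊙ M ⊙ f))
          ⊜ (m ⊙ P) ⊙ ((p ⊙ p ⊙ e) ⊙ (M ⊙ M ⊙ f))) ≈-refl
         (x⁺ 1) (x⁻ 1) (x⁺ 3) (x⁻ 3) (η 2) (η 6) ⟩
  (x⁻ 1 ∙ x⁺ 3) ∙ ((x⁺ 1 ∙ x⁺ 1 ∙ η 2) ∙ (x⁻ 3 ∙ x⁻ 3 ∙ η 6))
    ≈⟨ ∙-congˡ (∙-cong (φ-product 1ℤ refl 1) (φ-product -1ℤ refl 3)) ⟨
  (x⁻ 1 ∙ x⁺ 3) ∙ (φ⁺ 1 ∙ φ⁻ 3) ∎)
  where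
  open ≈-Reasoning
  φ⁻2k : ∀ k .{{_ : NonZero k}} → φ⁻ (2 * k) ≈ x⁺ k ∙ x⁻ k ∙ η (2 * k)
  φ⁻2k k@(suc _) = ≈-trans (φ-product -1ℤ refl (2 * k)) (≈-trans (∙-assoc _ _ _)
    (≈-sym (∙-cong (x-square k) (η-split (2 * k)))))

-- Euler's pentagonal number theorem in q²: the residues 2, 4 and 0 modulo 6 exhaust the even
-- exponents, so the triple product applies.
η2-theta : η 2 ≈ rtheta -1ℤ 2 4
η2-theta = ≈-trans (qprod-trisect -1ℤ 2 2) (≈-sym (jacobi-triple-product -1ℤ refl 2 4))

-- Dilation and extraction of arithmetic progressions

dilate-peel : ∀ d .{{_ : NonZero d}} s → dilate d s ≈ const (s 0) ⊕ mono d ∙ dilate d (tail s)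
dilate-peel d s = pointwise λ n → trans (go n) (sym (value n))
  where
  value : ∀ n → (const (s 0) ⊕ mono d ∙ dilate d (tail s)) n ≡ s 0 *ᶻ δ n 0 +ᶻ (mono d ∙ dilate d (tail s)) n
  value n = trans (⊕-at _ _ n) (cong (_+ᶻ (mono d ∙ dilate d (tail s)) n) (const-at (s 0) n))
  go : ∀ n → dilate d s n ≡ s 0 *ᶻ δ n 0 +ᶻ (mono d ∙ dilate d (tail s)) n
  go n with n ℕₚ.<? d
  ... | yes n<d = trans (dilate-below d s n n<d) (sym (trans
        (cong (s 0 *ᶻ δ n 0 +ᶻ_) (mono-below d _ n n<d)) (ℤₚ.+-identityʳ _)))
  ... | no n≮d with ℕₚ.m≤n⇒∃[o]m+o≡n (ℕₚ.≮⇒≥ n≮d)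
  ... | m , refl = trans (dilate-step d s m) (sym (trans
        (cong₂ _+ᶻ_ (*ᶻ-δ-≢ (s 0) (λ eq → ≢-nonZero⁻¹ d (ℕₚ.m+n≡0⇒m≡0 d eq)))
          (mono-shift d (dilate d (tail s)) m)) (ℤₚ.+-identityˡ _)))

dilate-cong : ∀ d {s t} → s ≈ t → dilate d s ≈ dilate d t
dilate-cong d p = pointwise λ n → sumTo-cong n (λ j → cong (_*ᶻ δ (j * d) n) (at p j))

extract : ℕ → ℕ → Series → Series
extract d r s n = s (n * d + r)

extract-cong : ∀ d r {s t} → s ≈ t → extract d r s ≈ extract d r t
extract-cong d r p = pointwise λ n → at p (n * d + r)

extract-⊕ : ∀ d r s t → extract d r (s ⊕ t) ≈ extract d r s ⊕ extract d r t
extract-⊕ d r s t = pointwise λ n → trans (⊕-at s t (n * d + r)) (sym (⊕-at (extract d r s) (extract d r t) n))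

extract-const : ∀ d r c s → extract d r (const c ∙ s) ≈ const c ∙ extract d r s
extract-const d r c s = pointwise λ n → trans (at (const-∙ c s) (n * d + r)) (sym (at (const-∙ c (extract d r s)) n))

-- The main tool of the dissections: a factor in q^d preserves residue classes of exponents, so it
-- passes through the extraction with q^d replaced by q. The induction peels off the constant term
-- of s.
extract-dilate : ∀ d .{{_ : NonZero d}} {r} → r < d → ∀ s t → extract d r (dilate d s ∙ t) ≈ s ∙ extract d r t
extract-dilate d {r} r<d s t = pointwise (go s)
  where
  open ≡-Reasoning
  peel : ∀ s N → (dilate d s ∙ t) N ≡ s 0 *ᶻ t N +ᶻ (mono d ∙ (dilate d (tail s) ∙ t)) N
  peel s N = begin
    (dilate d s ∙ t) N
      ≡⟨ at (≈-trans (∙-congʳ (dilate-peel d s)) (SR.solve 4 (λ c m u t → 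
             (c :+ m :* u) :* t := c :* t :+ m :* (u :* t)) ≈-refl (const (s 0)) (mono d) (dilate d (tail s)) t)) N ⟩
    (const (s 0) ∙ t ⊕ mono d ∙ (dilate d (tail s) ∙ t)) N
      ≡⟨ trans (⊕-at _ _ N) (cong (_+ᶻ (mono d ∙ (dilate d (tail s) ∙ t)) N) (at (const-∙ (s 0) t) N)) ⟩
    s 0 *ᶻ t N +ᶻ (mono d ∙ (dilate d (tail s) ∙ t)) N ∎
  go : ∀ s n → (dilate d s ∙ t) (n * d + r) ≡ (s ∙ extract d r t) n
  go s zero    = trans (peel s r) (trans (cong (s 0 *ᶻ t r +ᶻ_) (mono-below d _ r r<d))
    (trans (ℤₚ.+-identityʳ _) (sym (∙-at s (extract d r t) 0))))
  go s (suc n) = begin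
    (dilate d s ∙ t) (d + n * d + r)
      ≡⟨ peel s (d + n * d + r) ⟩
    s 0 *ᶻ t (d + n * d + r) +ᶻ (mono d ∙ (dilate d (tail s) ∙ t)) (d + n * d + r)
      ≡⟨ cong (λ N → s 0 *ᶻ t (d + n * d + r) +ᶻ (mono d ∙ (dilate d (tail s) ∙ t)) N) (ℕₚ.+-assoc d (n * d) r) ⟩
    s 0 *ᶻ t (d + n * d + r) +ᶻ (mono d ∙ (dilate d (tail s) ∙ t)) (d + (n * d + r))
      ≡⟨ cong (s 0 *ᶻ t (d + n * d + r) +ᶻ_) (trans (mono-shift d _ (n * d + r)) (go (tail s) n)) ⟩
    s 0 *ᶻ t (d + n * d + r) +ᶻ (tail s ∙ extract d r t) n
      ≡⟨ ∙-suc s (extract d r t) n ⟨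
    (s ∙ extract d r t) (suc n) ∎

extract-dilate-^ˢ : ∀ d .{{_ : NonZero d}} {r} → r < d → ∀ s t m →
  extract d r (dilate d s ^ˢ m ∙ t) ≈ s ^ˢ m ∙ extract d r t
extract-dilate-^ˢ d {r} r<d s t zero    = ≈-trans (extract-cong d r (∙-identityˡ t)) (≈-sym (∙-identityˡ _))
extract-dilate-^ˢ d {r} r<d s t (suc m) = ≈-trans (extract-cong d r (∙-assoc _ _ _))
  (≈-trans (extract-dilate d r<d s _) (≈-trans (∙-congˡ (extract-dilate-^ˢ d r<d s t m)) (≈-sym (∙-assoc _ _ _))))

extract-one-0 : ∀ d .{{_ : NonZero d}} → extract d 0 oneS ≈ oneS
extract-one-0 d@(suc _) = pointwise λ { zero → refl ; (suc n) → refl }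

extract-one : ∀ d r .{{_ : NonZero r}} → extract d r oneS ≈ zeroS
extract-one d r = pointwise λ n → δ-≢ λ eq → ≢-nonZero⁻¹ r (ℕₚ.m+n≡0⇒n≡0 (n * d) eq)

extract-dilated : ∀ d .{{_ : NonZero d}} s → extract d 0 (dilate d s) ≈ s
extract-dilated d s = ≈-trans (extract-cong d 0 (≈-sym (∙-identityʳ _)))
  (≈-trans (extract-dilate d (>-nonZero⁻¹ d) s oneS) (≈-trans (∙-congˡ (extract-one-0 d)) (∙-identityʳ s)))

extract-dilated-0 : ∀ d .{{_ : NonZero d}} r .{{_ : NonZero r}} → r < d → ∀ s → extract d r (dilate d s) ≈ zeroS
extract-dilated-0 d r r<d s = ≈-trans (extract-cong d r (≈-sym (∙-identityʳ _)))
  (≈-trans (extract-dilate d r<d s oneS) (≈-trans (∙-congˡ (extract-one d r)) (∙-zeroʳ s)))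

extract-ext : ∀ d .{{_ : NonZero d}} {s t} → (∀ r → r < d → extract d r s ≈ extract d r t) → s ≈ t
extract-ext d {s} {t} p = pointwise λ n →
  subst (λ m → s m ≡ t m) (sym (trans (m≡m%n+[m/n]*n n d) (ℕₚ.+-comm (n % d) (n / d * d))))
    (at (p (n % d) (m%n<n n d)) (n / d))

dilate-∙ : ∀ d .{{_ : NonZero d}} s t → dilate d (s ∙ t) ≈ dilate d s ∙ dilate d t
dilate-∙ d s t = extract-ext d λ
  { zero    r<d → ≈-trans (extract-dilated d (s ∙ t)) (≈-sym (≈-trans (extract-dilate d r<d s _) (∙-congˡ (extract-dilated d t))))
  ; (suc r) r<d → ≈-trans (extract-dilated-0 d (suc r) r<d (s ∙ t)) (≈-sym (≈-trans (extract-dilate d r<d s _)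
      (≈-trans (∙-congˡ (extract-dilated-0 d (suc r) r<d t)) (∙-zeroʳ s)))) }

theta-dilate : ∀ d .{{_ : NonZero d}} w {e} → Coercive e → theta w (λ k → d * e k) ≈ dilate d (theta w e)
theta-dilate d w {e} coercive = extract-ext d λ
  { zero    r<d → ≈-trans (pointwise multiple) (≈-sym (extract-dilated d _))
  ; (suc r) r<d → ≈-trans (pointwise (nonmultiple r r<d)) (≈-sym (extract-dilated-0 d (suc r) r<d (theta w e))) }
  where
  multiple : ∀ n → theta w (λ k → d * e k) (n * d + 0) ≡ theta w e n
  multiple n = trans (zsum-cong (n * d + 0) (λ k → cong (w k *ᶻ_) (δ-⇔
      (λ eq → ℕₚ.*-cancelˡ-≡ (e k) n d (trans eq (trans (ℕₚ.+-identityʳ (n * d)) (ℕₚ.*-comm n d))))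
      (λ eq → trans (cong (λ m → d * m) eq) (trans (ℕₚ.*-comm d n) (sym (ℕₚ.+-identityʳ (n * d))))))))
    (sym (theta-window w coercive (ℕₚ.≤-trans (ℕₚ.m≤m*n n d) (ℕₚ.m≤m+n (n * d) 0))))
  nonmultiple : ∀ r → suc r < d → ∀ n → theta w (λ k → d * e k) (n * d + suc r) ≡ 0ℤ
  nonmultiple r r<d n = zsum-0 (n * d + suc r) λ k → *ᶻ-δ-≢ (w k) λ eq →
    ℕₚ.1+n≢0 (trans (sym (m<n⇒m%n≡m r<d)) (trans (sym ([m+kn]%n≡m%n (suc r) n d))
      (trans (cong (_% d) (trans (ℕₚ.+-comm (suc r) (n * d)) (sym eq))) (m*n%m≡0 k))))
    where
    m*n%m≡0 : ∀ k → (d * e k) % d ≡ 0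
    m*n%m≡0 k = trans (cong (_% d) (ℕₚ.*-comm d (e k))) (m*n%n≡0 (e k) d)

rtheta-dilate : ∀ d .{{_ : NonZero d}} ε a b .{{_ : NonZero a}} .{{_ : NonZero b}} →
  rtheta ε (d * a) (d * b) ≈ dilate d (rtheta ε a b)
rtheta-dilate d ε a b = ≈-trans (theta-cong w w _ (λ k → d * rexp a b k) (λ _ → refl) (λ k → e d a b (triᶻ (-ᶻ k)) (triᶻ k)))
  (theta-dilate d w (rexp-coercive a b))
  where
  w : ℤ → ℤ
  w k = zpow ε ℤ.∣ k ∣
  e : ∀ d a b x y → d * a * x + d * b * y ≡ d * (a * x + b * y)
  e = ℕ-solve

-- Dissections of theta functions

zsum-reflect : ∀ B u → zsum B u ≡ zsum B (λ k → u (-ᶻ k))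
zsum-reflect zero    u = refl
zsum-reflect (suc B) u = cong₂ _+ᶻ_ (zsum-reflect B u) (ℤₚ.+-comm (u (+ suc B)) (u -[1+ B ]))

private
  above : ∀ B d c r → + c ≡ + d +ᶻ r → + (c + B * d) ≡ + d *ᶻ + suc B +ᶻ r
  above B d c r eq = trans (cong₂ _+ᶻ_ eq (ℤₚ.pos-* B d)) (e (+ d) r (+ B))
    where
    e : ∀ d r b → (d +ᶻ r) +ᶻ b *ᶻ d ≡ d *ᶻ (1ℤ +ᶻ b) +ᶻ r
    e = ℤ-solve

  above₀ : ∀ B d → + (d + B * d) ≡ + d *ᶻ + suc B
  above₀ B d = trans (above B d d 0ℤ (sym (ℤₚ.+-identityʳ (+ d)))) (ℤₚ.+-identityʳ _)

  below : ∀ B d c r → + c +ᶻ r ≡ + d → -ᶻ (+ (c + B * d)) ≡ + d *ᶻ -[1+ B ] +ᶻ r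
  below B d c r eq = trans (cong (λ x → -ᶻ (+ c +ᶻ x)) (ℤₚ.pos-* B d))
    (trans (e₁ (+ c) r (+ B *ᶻ + d)) (trans (cong (λ x → -ᶻ (x +ᶻ + B *ᶻ + d) +ᶻ r) eq) (e₂ (+ d) r (+ B))))
    where
    e₁ : ∀ c r x → -ᶻ (c +ᶻ x) ≡ -ᶻ (c +ᶻ r +ᶻ x) +ᶻ r
    e₁ = ℤ-solve
    e₂ : ∀ d r b → -ᶻ (d +ᶻ b *ᶻ d) +ᶻ r ≡ d *ᶻ (-ᶻ (1ℤ +ᶻ b)) +ᶻ r
    e₂ = ℤ-solve

  below₀ : ∀ B d → -ᶻ (+ (d + B * d)) ≡ + d *ᶻ -[1+ B ]
  below₀ B d = trans (below B d d 0ℤ (ℤₚ.+-identityʳ (+ d))) (ℤₚ.+-identityʳ _)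

-- For |k| ≤ B the numbers 2k - 1 run from -2B - 1 to 2B - 1, so the endpoint 2B + 1 is left over.
-- Likewise -(4B + 2) is left over modulo 4, while modulo 3 the classes 0, 1 and -1 fill a symmetric
-- window exactly.
zsum-split₂ : ∀ B u → zsum (1 + B * 2) u ≡
  zsum B (λ k → u (+ 2 *ᶻ k)) +ᶻ (zsum B (λ k → u (+ 2 *ᶻ k +ᶻ -1ℤ)) +ᶻ u (+ (1 + B * 2)))
zsum-split₂ zero    u = rearrange (u 0ℤ) (u (+ 1)) (u -[1+ 0 ])
  where
  rearrange : ∀ x y z → x +ᶻ (y +ᶻ z) ≡ x +ᶻ (z +ᶻ y)
  rearrange = ℤ-solve
zsum-split₂ (suc B) u = trans
  (cong (λ x → x +ᶻ (u (+ (2 + B * 2)) +ᶻ u -[1+ 1 + B * 2 ]) +ᶻ (u (+ (3 + B * 2)) +ᶻ u -[1+ 2 + B * 2 ])) (zsum-split₂ B u))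
  (trans (rearrange (zsum B (λ k → u (+ 2 *ᶻ k))) (zsum B (λ k → u (+ 2 *ᶻ k +ᶻ -1ℤ)))
           (u (+ (1 + B * 2))) (u (+ (2 + B * 2))) (u -[1+ 1 + B * 2 ]) (u (+ (3 + B * 2))) (u -[1+ 2 + B * 2 ]))
    (cong₂ (λ x y → zsum B (λ k → u (+ 2 *ᶻ k)) +ᶻ x +ᶻ (zsum B (λ k → u (+ 2 *ᶻ k +ᶻ -1ℤ)) +ᶻ y +ᶻ u (+ (3 + B * 2))))
      (cong₂ (λ x y → u x +ᶻ u y) (above₀ B 2) (below₀ B 2))
      (cong₂ (λ x y → u x +ᶻ u y) (above B 2 1 -1ℤ refl) (below B 2 3 -1ℤ refl))))
  where
  rearrange : ∀ E O x a b c d → E +ᶻ (O +ᶻ x) +ᶻ (a +ᶻ b) +ᶻ (c +ᶻ d) ≡ E +ᶻ (a +ᶻ b) +ᶻ (O +ᶻ (x +ᶻ d) +ᶻ c)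
  rearrange = ℤ-solve

zsum-split₃ : ∀ B u → zsum (1 + B * 3) u ≡
  zsum B (λ k → u (+ 3 *ᶻ k)) +ᶻ (zsum B (λ k → u (+ 3 *ᶻ k +ᶻ 1ℤ)) +ᶻ zsum B (λ k → u (+ 3 *ᶻ k +ᶻ -1ℤ)))
zsum-split₃ zero    u = refl
zsum-split₃ (suc B) u = trans
  (cong (λ x → x +ᶻ (u (+ (2 + B * 3)) +ᶻ u -[1+ 1 + B * 3 ]) +ᶻ (u (+ (3 + B * 3)) +ᶻ u -[1+ 2 + B * 3 ])
    +ᶻ (u (+ (4 + B * 3)) +ᶻ u -[1+ 3 + B * 3 ])) (zsum-split₃ B u))
  (trans (rearrange (zsum B (λ k → u (+ 3 *ᶻ k))) (zsum B (λ k → u (+ 3 *ᶻ k +ᶻ 1ℤ))) (zsum B (λ k → u (+ 3 *ᶻ k +ᶻ -1ℤ)))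
           (u (+ (2 + B * 3))) (u -[1+ 1 + B * 3 ]) (u (+ (3 + B * 3))) (u -[1+ 2 + B * 3 ]) (u (+ (4 + B * 3))) (u -[1+ 3 + B * 3 ]))
    (cong₂ _+ᶻ_
      (cong₂ (λ x y → zsum B (λ k → u (+ 3 *ᶻ k)) +ᶻ (u x +ᶻ u y)) (above₀ B 3) (below₀ B 3))
      (cong₂ _+ᶻ_
        (cong₂ (λ x y → zsum B (λ k → u (+ 3 *ᶻ k +ᶻ 1ℤ)) +ᶻ (u x +ᶻ u y)) (above B 3 4 1ℤ refl) (below B 3 2 1ℤ refl))
        (cong₂ (λ x y → zsum B (λ k → u (+ 3 *ᶻ k +ᶻ -1ℤ)) +ᶻ (u x +ᶻ u y)) (above B 3 2 -1ℤ refl) (below B 3 4 -1ℤ refl)))))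
  where
  rearrange : ∀ P Q R a b c d e f → P +ᶻ (Q +ᶻ R) +ᶻ (a +ᶻ b) +ᶻ (c +ᶻ d) +ᶻ (e +ᶻ f) ≡
    (P +ᶻ (c +ᶻ d)) +ᶻ ((Q +ᶻ (e +ᶻ b)) +ᶻ (R +ᶻ (a +ᶻ f)))
  rearrange = ℤ-solve

zsum-split₄ : ∀ B u → zsum (2 + B * 4) u ≡
  zsum B (λ k → u (+ 4 *ᶻ k)) +ᶻ (zsum B (λ k → u (+ 4 *ᶻ k +ᶻ 1ℤ)) +ᶻ zsum B (λ k → u (+ 4 *ᶻ k +ᶻ -1ℤ))
    +ᶻ (zsum B (λ k → u (+ 4 *ᶻ k +ᶻ + 2)) +ᶻ u -[1+ 1 + B * 4 ]))
zsum-split₄ zero    u = rearrange (u 0ℤ) (u (+ 1)) (u -[1+ 0 ]) (u (+ 2)) (u -[1+ 1 ])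
  where
  rearrange : ∀ x a b c d → x +ᶻ (a +ᶻ b) +ᶻ (c +ᶻ d) ≡ x +ᶻ (a +ᶻ b +ᶻ (c +ᶻ d))
  rearrange = ℤ-solve
zsum-split₄ (suc B) u = trans
  (cong (λ x → x +ᶻ (u (+ (3 + B * 4)) +ᶻ u -[1+ 2 + B * 4 ]) +ᶻ (u (+ (4 + B * 4)) +ᶻ u -[1+ 3 + B * 4 ])
    +ᶻ (u (+ (5 + B * 4)) +ᶻ u -[1+ 4 + B * 4 ]) +ᶻ (u (+ (6 + B * 4)) +ᶻ u -[1+ 5 + B * 4 ])) (zsum-split₄ B u))
  (trans (rearrange (zsum B (λ k → u (+ 4 *ᶻ k))) (zsum B (λ k → u (+ 4 *ᶻ k +ᶻ 1ℤ)))
           (zsum B (λ k → u (+ 4 *ᶻ k +ᶻ -1ℤ))) (zsum B (λ k → u (+ 4 *ᶻ k +ᶻ + 2))) (u -[1+ 1 + B * 4 ])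
           (u (+ (3 + B * 4))) (u -[1+ 2 + B * 4 ]) (u (+ (4 + B * 4))) (u -[1+ 3 + B * 4 ])
           (u (+ (5 + B * 4))) (u -[1+ 4 + B * 4 ]) (u (+ (6 + B * 4))) (u -[1+ 5 + B * 4 ]))
    (cong₂ _+ᶻ_
      (cong₂ (λ x y → zsum B (λ k → u (+ 4 *ᶻ k)) +ᶻ (u x +ᶻ u y)) (above₀ B 4) (below₀ B 4))
      (cong₂ _+ᶻ_
        (cong₂ _+ᶻ_
          (cong₂ (λ x y → zsum B (λ k → u (+ 4 *ᶻ k +ᶻ 1ℤ)) +ᶻ (u x +ᶻ u y)) (above B 4 5 1ℤ refl) (below B 4 3 1ℤ refl))
          (cong₂ (λ x y → zsum B (λ k → u (+ 4 *ᶻ k +ᶻ -1ℤ)) +ᶻ (u x +ᶻ u y)) (above B 4 3 -1ℤ refl) (below B 4 5 -1ℤ refl)))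
        (cong (_+ᶻ u -[1+ 5 + B * 4 ])
          (cong₂ (λ x y → zsum B (λ k → u (+ 4 *ᶻ k +ᶻ + 2)) +ᶻ (u x +ᶻ u y)) (above B 4 6 (+ 2) refl) (below B 4 2 (+ 2) refl))))))
  where
  rearrange : ∀ P Q R S z a b c d e f g h →
    P +ᶻ (Q +ᶻ R +ᶻ (S +ᶻ z)) +ᶻ (a +ᶻ b) +ᶻ (c +ᶻ d) +ᶻ (e +ᶻ f) +ᶻ (g +ᶻ h) ≡
    (P +ᶻ (c +ᶻ d)) +ᶻ ((Q +ᶻ (e +ᶻ b)) +ᶻ (R +ᶻ (a +ᶻ f)) +ᶻ (S +ᶻ (g +ᶻ z) +ᶻ h))
  rearrange = ℤ-solve

zsum-shift-suc : ∀ B v → zsum B (λ k → v (k +ᶻ 1ℤ)) +ᶻ v (-ᶻ (+ B)) ≡ zsum B v +ᶻ v (+ suc B)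
zsum-shift-suc zero    v = ℤₚ.+-comm (v (+ 1)) (v 0ℤ)
zsum-shift-suc (suc B) v = begin
  zsum B v₁ +ᶻ (v (+ suc B +ᶻ 1ℤ) +ᶻ v (-[1+ B ] +ᶻ 1ℤ)) +ᶻ v -[1+ B ]
    ≡⟨ cong₂ (λ x y → zsum B v₁ +ᶻ (v x +ᶻ v y) +ᶻ v -[1+ B ]) (ℤₚ.+-comm (+ suc B) 1ℤ) (e (+ B)) ⟩
  zsum B v₁ +ᶻ (v (+ suc (suc B)) +ᶻ v (-ᶻ (+ B))) +ᶻ v -[1+ B ]
    ≡⟨ r₁ (zsum B v₁) (v (+ suc (suc B))) (v (-ᶻ (+ B))) (v -[1+ B ]) ⟩
  (zsum B v₁ +ᶻ v (-ᶻ (+ B))) +ᶻ v (+ suc (suc B)) +ᶻ v -[1+ B ]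
    ≡⟨ cong (λ x → x +ᶻ v (+ suc (suc B)) +ᶻ v -[1+ B ]) (zsum-shift-suc B v) ⟩
  (zsum B v +ᶻ v (+ suc B)) +ᶻ v (+ suc (suc B)) +ᶻ v -[1+ B ]
    ≡⟨ r₂ (zsum B v) (v (+ suc B)) (v (+ suc (suc B))) (v -[1+ B ]) ⟩
  zsum B v +ᶻ (v (+ suc B) +ᶻ v -[1+ B ]) +ᶻ v (+ suc (suc B)) ∎
  where
  open ≡-Reasoning
  v₁ : ℤ → ℤ
  v₁ k = v (k +ᶻ 1ℤ)
  e : ∀ b → -ᶻ (1ℤ +ᶻ b) +ᶻ 1ℤ ≡ -ᶻ b
  e = ℤ-solve
  r₁ : ∀ a b c d → a +ᶻ (b +ᶻ c) +ᶻ d ≡ (a +ᶻ c) +ᶻ b +ᶻ d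
  r₁ = ℤ-solve
  r₂ : ∀ a b c d → (a +ᶻ b) +ᶻ c +ᶻ d ≡ a +ᶻ (b +ᶻ d) +ᶻ c
  r₂ = ℤ-solve

-- Translation invariance: a shift by 1 only exchanges terms at the two ends of the window, where
-- the support condition makes them 0. Negative shifts reduce to positive ones by reflection.
zsum-shift : ∀ {S u} → SupportedIn S u → ∀ c {B B′} → S + ℤ.∣ c ∣ ≤ B → S ≤ B′ →
  zsum B (λ k → u (k +ᶻ c)) ≡ zsum B′ u
zsum-shift {S} {u} supp (+ m) = upward supp m
  where
  upward : ∀ {S u} → SupportedIn S u → ∀ m {B B′} → S + m ≤ B → S ≤ B′ →
    zsum B (λ k → u (k +ᶻ + m)) ≡ zsum B′ u
  upward {S} {u} supp zero {B} {B′} S≤B S≤B′ = trans (zsum-cong B (λ k → cong u (ℤₚ.+-identityʳ k)))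
    (zsum-window supp (subst (_≤ B) (ℕₚ.+-identityʳ S) S≤B) S≤B′)
  upward {S} {u} supp (suc m) {B} {B′} S≤B S≤B′ = begin
    zsum B (λ k → u (k +ᶻ + suc m))            ≡⟨ zsum-cong B (λ k → cong u (sym (ℤₚ.+-assoc k 1ℤ (+ m)))) ⟩
    zsum B (λ k → v (k +ᶻ 1ℤ))                 ≡⟨ ℤₚ.+-identityʳ _ ⟨
    zsum B (λ k → v (k +ᶻ 1ℤ)) +ᶻ 0ℤ
      ≡⟨ cong (zsum B (λ k → v (k +ᶻ 1ℤ)) +ᶻ_) (v-supp (-ᶻ (+ B)) (subst (S + m <_) (sym (ℤₚ.∣-i∣≡∣i∣ (+ B))) S+m<B)) ⟨
    zsum B (λ k → v (k +ᶻ 1ℤ)) +ᶻ v (-ᶻ (+ B)) ≡⟨ zsum-shift-suc B v ⟩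
    zsum B v +ᶻ v (+ suc B)                    ≡⟨ cong (zsum B v +ᶻ_) (v-supp (+ suc B) (ℕₚ.m≤n⇒m≤1+n S+m<B)) ⟩
    zsum B v +ᶻ 0ℤ                             ≡⟨ ℤₚ.+-identityʳ _ ⟩
    zsum B v                                   ≡⟨ upward supp m (ℕₚ.<⇒≤ S+m<B) S≤B′ ⟩
    zsum B′ u                                  ∎
    where
    open ≡-Reasoning
    v : ℤ → ℤ
    v k = u (k +ᶻ + m)
    S+m<B : S + m < B
    S+m<B = subst (_≤ B) (ℕₚ.+-suc S m) S≤B
    v-supp : SupportedIn (S + m) v
    v-supp k S+m<k = supp (k +ᶻ + m) (ℕₚ.+-cancelʳ-< m S ℤ.∣ k +ᶻ + m ∣ (ℕₚ.<-≤-trans S+m<k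
      (subst (λ z → ℤ.∣ z ∣ ≤ ℤ.∣ k +ᶻ + m ∣ + m) (e k (+ m)) (ℤₚ.∣i-j∣≤∣i∣+∣j∣ (k +ᶻ + m) (+ m)))))
      where
      e : ∀ k m → (k +ᶻ m) +ᶻ (-ᶻ m) ≡ k
      e = ℤ-solve
zsum-shift {S} {u} supp -[1+ m ] {B} {B′} S≤B S≤B′ = begin
  zsum B (λ k → u (k +ᶻ -[1+ m ]))             ≡⟨ zsum-reflect B (λ k → u (k +ᶻ -[1+ m ])) ⟩
  zsum B (λ k → u (-ᶻ k +ᶻ -[1+ m ]))          ≡⟨ zsum-cong B (λ k → cong u (e k (+ suc m))) ⟩
  zsum B (λ k → u (-ᶻ (k +ᶻ + suc m)))         ≡⟨ zsum-shift reflected (+ suc m) S≤B S≤B′ ⟩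
  zsum B′ (λ k → u (-ᶻ k))                     ≡⟨ zsum-reflect B′ u ⟨
  zsum B′ u                                    ∎
  where
  open ≡-Reasoning
  e : ∀ k m → -ᶻ k +ᶻ -ᶻ m ≡ -ᶻ (k +ᶻ m)
  e = ℤ-solve
  reflected : SupportedIn S (λ k → u (-ᶻ k))
  reflected k S<k = supp (-ᶻ k) (subst (S <_) (sym (ℤₚ.∣-i∣≡∣i∣ k)) S<k)

theta-reflect : ∀ w e → theta w e ≈ theta (λ k → w (-ᶻ k)) (λ k → e (-ᶻ k))
theta-reflect w e = pointwise λ n → zsum-reflect n (λ k → w k *ᶻ δ (e k) n)

theta-shift : ∀ d w {e} → Coercive e → mono d ∙ theta w e ≈ theta w (λ k → d + e k)
theta-shift d w {e} coercive = pointwise go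
  where
  go : ∀ n → (mono d ∙ theta w e) n ≡ theta w (λ k → d + e k) n
  go n with n ℕₚ.<? d
  ... | yes n<d = trans (mono-below d _ n n<d) (sym (zsum-0 n λ k → *ᶻ-δ-≢ (w k)
        (ℕₚ.>⇒≢ (ℕₚ.<-≤-trans n<d (ℕₚ.m≤m+n d (e k))))))
  ... | no n≮d with ℕₚ.m≤n⇒∃[o]m+o≡n (ℕₚ.≮⇒≥ n≮d)
  ... | m , refl = trans (mono-shift d (theta w e) m) (trans (theta-window w coercive (ℕₚ.m≤n+m m d))
        (zsum-cong (d + m) λ k → cong (w k *ᶻ_) (δ-⇔ (cong (λ z → d + z)) (ℕₚ.+-cancelˡ-≡ d (e k) m))))

theta-scale : ∀ c w e → const c ∙ theta w e ≈ theta (λ k → c *ᶻ w k) e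
theta-scale c w e = pointwise λ n → trans (at (const-∙ c (theta w e)) n) (sym
  (trans (zsum-cong n (λ k → ℤₚ.*-assoc c (w k) (δ (e k) n))) (zsum-*ˡ n c (λ k → w k *ᶻ δ (e k) n))))

theta-split₂ : ∀ w {e} → Coercive e → theta w e ≈
  theta (λ k → w (+ 2 *ᶻ k)) (λ k → e (+ 2 *ᶻ k)) ⊕
  theta (λ k → w (+ 2 *ᶻ k +ᶻ -1ℤ)) (λ k → e (+ 2 *ᶻ k +ᶻ -1ℤ))
theta-split₂ w {e} coercive = pointwise λ n → let u = λ (k : ℤ) → w k *ᶻ δ (e k) n in begin
  theta w e n
    ≡⟨ theta-window w coercive (ℕₚ.≤-trans (ℕₚ.m≤m*n n 2) (ℕₚ.n≤1+n (n * 2))) ⟩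
  zsum (1 + n * 2) u
    ≡⟨ zsum-split₂ n u ⟩
  zsum n (λ k → u (+ 2 *ᶻ k)) +ᶻ (zsum n (λ k → u (+ 2 *ᶻ k +ᶻ -1ℤ)) +ᶻ u (+ (1 + n * 2)))
    ≡⟨ cong (zsum n (λ k → u (+ 2 *ᶻ k)) +ᶻ_) (trans (cong (zsum n (λ k → u (+ 2 *ᶻ k +ᶻ -1ℤ)) +ᶻ_)
         (theta-supported w coercive n (+ (1 + n * 2)) (s≤s (ℕₚ.m≤m*n n 2)))) (ℤₚ.+-identityʳ _)) ⟩
  zsum n (λ k → u (+ 2 *ᶻ k)) +ᶻ zsum n (λ k → u (+ 2 *ᶻ k +ᶻ -1ℤ))
    ≡⟨ ⊕-at _ _ n ⟨
  (theta (λ k → w (+ 2 *ᶻ k)) (λ k → e (+ 2 *ᶻ k)) ⊕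
   theta (λ k → w (+ 2 *ᶻ k +ᶻ -1ℤ)) (λ k → e (+ 2 *ᶻ k +ᶻ -1ℤ))) n ∎
  where open ≡-Reasoning

theta-split₃ : ∀ w {e} → Coercive e → theta w e ≈
  theta (λ k → w (+ 3 *ᶻ k)) (λ k → e (+ 3 *ᶻ k)) ⊕
  (theta (λ k → w (+ 3 *ᶻ k +ᶻ 1ℤ)) (λ k → e (+ 3 *ᶻ k +ᶻ 1ℤ)) ⊕
   theta (λ k → w (+ 3 *ᶻ k +ᶻ -1ℤ)) (λ k → e (+ 3 *ᶻ k +ᶻ -1ℤ)))
theta-split₃ w {e} coercive = pointwise λ n → let u = λ (k : ℤ) → w k *ᶻ δ (e k) n in begin
  theta w e n
    ≡⟨ theta-window w coercive (ℕₚ.≤-trans (ℕₚ.m≤m*n n 3) (ℕₚ.n≤1+n (n * 3))) ⟩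
  zsum (1 + n * 3) u
    ≡⟨ zsum-split₃ n u ⟩
  zsum n (λ k → u (+ 3 *ᶻ k)) +ᶻ (zsum n (λ k → u (+ 3 *ᶻ k +ᶻ 1ℤ)) +ᶻ zsum n (λ k → u (+ 3 *ᶻ k +ᶻ -1ℤ)))
    ≡⟨ trans (⊕-at _ _ n) (cong (zsum n (λ k → u (+ 3 *ᶻ k)) +ᶻ_) (⊕-at _ _ n)) ⟨
  (theta (λ k → w (+ 3 *ᶻ k)) (λ k → e (+ 3 *ᶻ k)) ⊕
   (theta (λ k → w (+ 3 *ᶻ k +ᶻ 1ℤ)) (λ k → e (+ 3 *ᶻ k +ᶻ 1ℤ)) ⊕
    theta (λ k → w (+ 3 *ᶻ k +ᶻ -1ℤ)) (λ k → e (+ 3 *ᶻ k +ᶻ -1ℤ)))) n ∎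
  where open ≡-Reasoning

theta-split₄ : ∀ w {e} → Coercive e → theta w e ≈
  theta (λ k → w (+ 4 *ᶻ k)) (λ k → e (+ 4 *ᶻ k)) ⊕
  (theta (λ k → w (+ 4 *ᶻ k +ᶻ 1ℤ)) (λ k → e (+ 4 *ᶻ k +ᶻ 1ℤ)) ⊕
   theta (λ k → w (+ 4 *ᶻ k +ᶻ -1ℤ)) (λ k → e (+ 4 *ᶻ k +ᶻ -1ℤ)) ⊕
   theta (λ k → w (+ 4 *ᶻ k +ᶻ + 2)) (λ k → e (+ 4 *ᶻ k +ᶻ + 2)))
theta-split₄ w {e} coercive = pointwise λ n → let u = λ (k : ℤ) → w k *ᶻ δ (e k) n in begin
  theta w e n
    ≡⟨ theta-window w coercive (ℕₚ.≤-trans (ℕₚ.m≤m*n n 4) (ℕₚ.m≤n+m (n * 4) 2)) ⟩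
  zsum (2 + n * 4) u
    ≡⟨ zsum-split₄ n u ⟩
  zsum n (λ k → u (+ 4 *ᶻ k)) +ᶻ (zsum n (λ k → u (+ 4 *ᶻ k +ᶻ 1ℤ)) +ᶻ zsum n (λ k → u (+ 4 *ᶻ k +ᶻ -1ℤ))
    +ᶻ (zsum n (λ k → u (+ 4 *ᶻ k +ᶻ + 2)) +ᶻ u -[1+ 1 + n * 4 ]))
    ≡⟨ cong (λ x → zsum n (λ k → u (+ 4 *ᶻ k)) +ᶻ (zsum n (λ k → u (+ 4 *ᶻ k +ᶻ 1ℤ)) +ᶻ zsum n (λ k → u (+ 4 *ᶻ k +ᶻ -1ℤ)) +ᶻ x))
         (trans (cong (zsum n (λ k → u (+ 4 *ᶻ k +ᶻ + 2)) +ᶻ_)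
           (theta-supported w coercive n -[1+ 1 + n * 4 ] (s≤s (ℕₚ.≤-trans (ℕₚ.m≤m*n n 4) (ℕₚ.n≤1+n _))))) (ℤₚ.+-identityʳ _)) ⟩
  zsum n (λ k → u (+ 4 *ᶻ k)) +ᶻ (zsum n (λ k → u (+ 4 *ᶻ k +ᶻ 1ℤ)) +ᶻ zsum n (λ k → u (+ 4 *ᶻ k +ᶻ -1ℤ))
    +ᶻ zsum n (λ k → u (+ 4 *ᶻ k +ᶻ + 2)))
    ≡⟨ trans (⊕-at _ _ n) (cong (zsum n (λ k → u (+ 4 *ᶻ k)) +ᶻ_) (trans (⊕-at _ _ n)
         (cong (_+ᶻ zsum n (λ k → u (+ 4 *ᶻ k +ᶻ + 2))) (⊕-at _ _ n)))) ⟨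
  (theta (λ k → w (+ 4 *ᶻ k)) (λ k → e (+ 4 *ᶻ k)) ⊕
   (theta (λ k → w (+ 4 *ᶻ k +ᶻ 1ℤ)) (λ k → e (+ 4 *ᶻ k +ᶻ 1ℤ)) ⊕
    theta (λ k → w (+ 4 *ᶻ k +ᶻ -1ℤ)) (λ k → e (+ 4 *ᶻ k +ᶻ -1ℤ)) ⊕
    theta (λ k → w (+ 4 *ᶻ k +ᶻ + 2)) (λ k → e (+ 4 *ᶻ k +ᶻ + 2)))) n ∎
  where open ≡-Reasoning

tri-ℤ : ∀ m → + m *ᶻ + m ≡ + m +ᶻ + 2 *ᶻ + tri m
tri-ℤ m = trans (sym (ℤₚ.pos-* m m)) (trans (cong +_ (tri-square m)) (cong (+ m +ᶻ_) (ℤₚ.pos-* 2 (tri m))))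

triᶻ-ℤ : ∀ k → + 2 *ᶻ + triᶻ k ≡ k *ᶻ k +ᶻ k
triᶻ-ℤ (+ m)    = trans (e (+ m) (+ tri m)) (cong (_+ᶻ + m) (sym (tri-ℤ m)))
  where
  e : ∀ m t → + 2 *ᶻ (m +ᶻ t) ≡ (m +ᶻ + 2 *ᶻ t) +ᶻ m
  e = ℤ-solve
triᶻ-ℤ -[1+ m ] = trans (e₁ (+ suc m) (+ tri (suc m)))
  (trans (cong (_+ᶻ -[1+ m ]) (sym (tri-ℤ (suc m)))) (cong (_+ᶻ -[1+ m ]) (e₂ (+ suc m))))
  where
  e₁ : ∀ m t → + 2 *ᶻ t ≡ (m +ᶻ + 2 *ᶻ t) +ᶻ -ᶻ m
  e₁ = ℤ-solve
  e₂ : ∀ m → m *ᶻ m ≡ (-ᶻ m) *ᶻ (-ᶻ m)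
  e₂ = ℤ-solve

-- Doubling removes the halves of the triangular numbers; comparisons of exponents thus become
-- polynomial identities, which `ℕ-from-double` carries back.
rexp-ℤ : ∀ a b k → + 2 *ᶻ + rexp a b k ≡ (+ a +ᶻ + b) *ᶻ (k *ᶻ k) +ᶻ (+ b +ᶻ -ᶻ (+ a)) *ᶻ k
rexp-ℤ a b k = begin
  + 2 *ᶻ (+ (a * triᶻ (-ᶻ k)) +ᶻ + (b * triᶻ k))
    ≡⟨ cong₂ (λ x y → + 2 *ᶻ (x +ᶻ y)) (ℤₚ.pos-* a _) (ℤₚ.pos-* b _) ⟩
  + 2 *ᶻ (+ a *ᶻ + triᶻ (-ᶻ k) +ᶻ + b *ᶻ + triᶻ k)
    ≡⟨ e₁ (+ a) (+ b) (+ triᶻ (-ᶻ k)) (+ triᶻ k) ⟩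
  + a *ᶻ (+ 2 *ᶻ + triᶻ (-ᶻ k)) +ᶻ + b *ᶻ (+ 2 *ᶻ + triᶻ k)
    ≡⟨ cong₂ (λ x y → + a *ᶻ x +ᶻ + b *ᶻ y) (triᶻ-ℤ (-ᶻ k)) (triᶻ-ℤ k) ⟩
  + a *ᶻ ((-ᶻ k) *ᶻ (-ᶻ k) +ᶻ -ᶻ k) +ᶻ + b *ᶻ (k *ᶻ k +ᶻ k)
    ≡⟨ e₂ (+ a) (+ b) k ⟩
  (+ a +ᶻ + b) *ᶻ (k *ᶻ k) +ᶻ (+ b +ᶻ -ᶻ (+ a)) *ᶻ k ∎
  where
  open ≡-Reasoning
  e₁ : ∀ a b x y → + 2 *ᶻ (a *ᶻ x +ᶻ b *ᶻ y) ≡ a *ᶻ (+ 2 *ᶻ x) +ᶻ b *ᶻ (+ 2 *ᶻ y)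
  e₁ = ℤ-solve
  e₂ : ∀ a b k → a *ᶻ ((-ᶻ k) *ᶻ (-ᶻ k) +ᶻ -ᶻ k) +ᶻ b *ᶻ (k *ᶻ k +ᶻ k) ≡ (a +ᶻ b) *ᶻ (k *ᶻ k) +ᶻ (b +ᶻ -ᶻ a) *ᶻ k
  e₂ = ℤ-solve

ℕ-from-double : ∀ {m n x} → + 2 *ᶻ + m ≡ x → + 2 *ᶻ + n ≡ x → m ≡ n
ℕ-from-double {m} {n} p q = ℤₚ.+-injective (ℤₚ.*-cancelˡ-≡ (+ 2) (+ m) (+ n) (trans p (sym q)))

zpow-1 : ∀ n → zpow 1ℤ n ≡ 1ℤ
zpow-1 zero    = refl
zpow-1 (suc n) = trans (ℤₚ.*-identityˡ (zpow 1ℤ n)) (zpow-1 n)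

module _ (ε : ℤ) (εε : ε *ᶻ ε ≡ 1ℤ) where

  sign-double : ∀ k → zpow ε ℤ.∣ + 2 *ᶻ k ∣ ≡ 1ℤ
  sign-double k = trans (cong (zpow ε) (ℤₚ.abs-* (+ 2) k)) (trans
    (cong (λ m → zpow ε (ℤ.∣ k ∣ + m)) (ℕₚ.+-identityʳ ℤ.∣ k ∣))
    (trans (zpow-+ ε ℤ.∣ k ∣ ℤ.∣ k ∣) (zpow-square ε εε ℤ.∣ k ∣)))

  private
    involutive : ∀ x → ε *ᶻ (ε *ᶻ x) ≡ x
    involutive x = trans (sym (ℤₚ.*-assoc ε ε x)) (trans (cong (_*ᶻ x) εε) (ℤₚ.*-identityˡ x))

  sign-pred : ∀ k → zpow ε ℤ.∣ k +ᶻ -1ℤ ∣ ≡ ε *ᶻ zpow ε ℤ.∣ k ∣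
  sign-pred (+ zero)  = refl
  sign-pred (+ suc m) = sym (involutive (zpow ε m))
  sign-pred -[1+ m ]  = cong (λ n → zpow ε (suc (suc n))) (ℕₚ.+-identityʳ m)

  sign-suc : ∀ k → zpow ε ℤ.∣ k +ᶻ 1ℤ ∣ ≡ ε *ᶻ zpow ε ℤ.∣ k ∣
  sign-suc k = begin
    zpow ε ℤ.∣ k +ᶻ 1ℤ ∣                       ≡⟨ involutive _ ⟨
    ε *ᶻ (ε *ᶻ zpow ε ℤ.∣ k +ᶻ 1ℤ ∣)            ≡⟨ cong (ε *ᶻ_) (sign-pred (k +ᶻ 1ℤ)) ⟨
    ε *ᶻ zpow ε ℤ.∣ k +ᶻ 1ℤ +ᶻ -1ℤ ∣            ≡⟨ cong (λ z → ε *ᶻ zpow ε ℤ.∣ z ∣) (e k) ⟩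
    ε *ᶻ zpow ε ℤ.∣ k ∣                         ∎
    where
    open ≡-Reasoning
    e : ∀ k → k +ᶻ 1ℤ +ᶻ -1ℤ ≡ k
    e = ℤ-solve

  sign-triple : ∀ k → zpow ε ℤ.∣ + 3 *ᶻ k ∣ ≡ zpow ε ℤ.∣ k ∣
  sign-triple k = trans (cong (zpow ε) (ℤₚ.abs-* (+ 3) k)) (trans
    (cong (λ m → zpow ε (ℤ.∣ k ∣ + (ℤ.∣ k ∣ + m))) (ℕₚ.+-identityʳ ℤ.∣ k ∣))
    (trans (zpow-+ ε ℤ.∣ k ∣ (ℤ.∣ k ∣ + ℤ.∣ k ∣)) (trans (cong (zpow ε ℤ.∣ k ∣ *ᶻ_)
      (trans (zpow-+ ε ℤ.∣ k ∣ ℤ.∣ k ∣) (zpow-square ε εε ℤ.∣ k ∣))) (ℤₚ.*-identityʳ _))))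

theta-cong-reflect : ∀ (w w′ : ℤ → ℤ) (e e′ : ℤ → ℕ) →
  (∀ k → w k ≡ w′ (-ᶻ k)) → (∀ k → e k ≡ e′ (-ᶻ k)) → theta w e ≈ theta w′ e′
theta-cong-reflect w w′ e e′ p q = ≈-trans
  (theta-cong w (λ k → w′ (-ᶻ k)) e (λ k → e′ (-ᶻ k)) p q) (≈-sym (theta-reflect w′ e′))

sign-neg : ∀ ε k → zpow ε ℤ.∣ -ᶻ k ∣ ≡ zpow ε ℤ.∣ k ∣
sign-neg ε k = cong (zpow ε) (ℤₚ.∣-i∣≡∣i∣ k)

φ-exponent : ∀ k x → + 2 *ᶻ + rexp k k x ≡ + 2 *ᶻ (+ k *ᶻ (x *ᶻ x))
φ-exponent k x = trans (rexp-ℤ k k x) (e (+ k) x)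
  where
  e : ∀ k x → (k +ᶻ k) *ᶻ (x *ᶻ x) +ᶻ (k +ᶻ -ᶻ k) *ᶻ x ≡ + 2 *ᶻ (k *ᶻ (x *ᶻ x))
  e = ℤ-solve

ψ-exponent : ∀ k x → + 2 *ᶻ + rexp k (3 * k) x ≡ + 2 *ᶻ (+ k *ᶻ (+ 2 *ᶻ (x *ᶻ x) +ᶻ x))
ψ-exponent k x = trans (rexp-ℤ k (3 * k) x) (trans
  (cong (λ y → (+ k +ᶻ y) *ᶻ (x *ᶻ x) +ᶻ (y +ᶻ -ᶻ (+ k)) *ᶻ x) (ℤₚ.pos-* 3 k)) (e (+ k) x))
  where
  e : ∀ k x → (k +ᶻ + 3 *ᶻ k) *ᶻ (x *ᶻ x) +ᶻ (+ 3 *ᶻ k +ᶻ -ᶻ k) *ᶻ x ≡ + 2 *ᶻ (k *ᶻ (+ 2 *ᶻ (x *ᶻ x) +ᶻ x))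
  e = ℤ-solve

-- The indices 4j and 4j + 2 together give φ(q^(4k)). The classes 4j + 1 and 4j - 1 are exchanged by
-- negation and contribute equally, with (4j + 1)² = 1 + 8 (2j² + j).
φ-bisect : ∀ ε → ε *ᶻ ε ≡ 1ℤ → ∀ k .{{_ : NonZero k}} →
  rtheta ε k k ≈ φ⁺ (4 * k) ⊕ const (+ 2) ∙ (const ε ∙ (mono k ∙ ψ (8 * k)))
φ-bisect ε εε k@(suc _) = begin
  rtheta ε k k
    ≈⟨ theta-split₄ w (rexp-coercive k k) ⟩
  _ ⊕ (_ ⊕ _ ⊕ _)
    ≈⟨ ⊕-cong (theta-cong _ _ _ (λ j → rexp (4 * k) (4 * k) (+ 2 *ᶻ j)) w₀ e₀)
         (⊕-cong (⊕-cong (theta-cong _ _ _ eQ w₁ e₁) (theta-cong-reflect _ wQ _ eQ w₋₁ e₋₁))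
           (theta-cong-reflect _ (λ j → one-sign (+ 2 *ᶻ j +ᶻ -1ℤ)) _ (λ j → rexp (4 * k) (4 * k) (+ 2 *ᶻ j +ᶻ -1ℤ)) w₂ e₂)) ⟩
  P₀ ⊕ (Q ⊕ Q ⊕ P₁)
    ≈⟨ SR.solve 3 (λ p q r → p :+ (q :+ q :+ r) := (p :+ r) :+ con (+ 2) :* q) ≈-refl P₀ Q P₁ ⟩
  (P₀ ⊕ P₁) ⊕ const (+ 2) ∙ Q
    ≈⟨ ⊕-cong (theta-split₂ one-sign (rexp-coercive (4 * k) (4 * k)))
         (∙-congˡ (≈-trans (∙-congˡ (theta-shift k one-sign (rexp-coercive (8 * k) (3 * (8 * k)))))
           (theta-scale ε one-sign eQ))) ⟨
  φ⁺ (4 * k) ⊕ const (+ 2) ∙ (const ε ∙ (mono k ∙ ψ (8 * k))) ∎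
  where
  open ≈-Reasoning
  w one-sign wQ : ℤ → ℤ
  w x = zpow ε ℤ.∣ x ∣
  one-sign x = zpow 1ℤ ℤ.∣ x ∣
  wQ j = ε *ᶻ one-sign j
  eQ : ℤ → ℕ
  eQ j = k + rexp (8 * k) (3 * (8 * k)) j
  P₀ P₁ Q : Series
  P₀ = theta (λ j → one-sign (+ 2 *ᶻ j)) (λ j → rexp (4 * k) (4 * k) (+ 2 *ᶻ j))
  P₁ = theta (λ j → one-sign (+ 2 *ᶻ j +ᶻ -1ℤ)) (λ j → rexp (4 * k) (4 * k) (+ 2 *ᶻ j +ᶻ -1ℤ))
  Q = theta wQ eQ
  quad : ∀ j → + 4 *ᶻ j ≡ + 2 *ᶻ (+ 2 *ᶻ j)
  quad = ℤ-solve
  w4 : ∀ j → w (+ 4 *ᶻ j) ≡ 1ℤ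
  w4 j = trans (cong w (quad j)) (sign-double ε εε (+ 2 *ᶻ j))
  w₀ : ∀ j → w (+ 4 *ᶻ j) ≡ one-sign (+ 2 *ᶻ j)
  w₀ j = trans (w4 j) (sym (zpow-1 ℤ.∣ + 2 *ᶻ j ∣))
  w₁ : ∀ j → w (+ 4 *ᶻ j +ᶻ 1ℤ) ≡ wQ j
  w₁ j = trans (sign-suc ε εε (+ 4 *ᶻ j)) (cong (ε *ᶻ_) (trans (w4 j) (sym (zpow-1 ℤ.∣ j ∣))))
  w₋₁ : ∀ j → w (+ 4 *ᶻ j +ᶻ -1ℤ) ≡ wQ (-ᶻ j)
  w₋₁ j = trans (sign-pred ε εε (+ 4 *ᶻ j)) (cong (ε *ᶻ_) (trans (w4 j) (sym (zpow-1 ℤ.∣ -ᶻ j ∣))))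
  w₂ : ∀ j → w (+ 4 *ᶻ j +ᶻ + 2) ≡ one-sign (+ 2 *ᶻ (-ᶻ j) +ᶻ -1ℤ)
  w₂ j = trans (cong w (e j)) (trans (sign-double ε εε (+ 2 *ᶻ j +ᶻ 1ℤ)) (sym (zpow-1 ℤ.∣ + 2 *ᶻ (-ᶻ j) +ᶻ -1ℤ ∣)))
    where
    e : ∀ j → + 4 *ᶻ j +ᶻ + 2 ≡ + 2 *ᶻ (+ 2 *ᶻ j +ᶻ 1ℤ)
    e = ℤ-solve
  four : ∀ x y → + k *ᶻ (x *ᶻ x) ≡ + 4 *ᶻ + k *ᶻ (y *ᶻ y) → rexp k k x ≡ rexp (4 * k) (4 * k) y
  four x y eq = ℕ-from-double (φ-exponent k x) (trans (φ-exponent (4 * k) y)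
    (cong (+ 2 *ᶻ_) (trans (cong (_*ᶻ (y *ᶻ y)) (ℤₚ.pos-* 4 k)) (sym eq))))
  eight : ∀ x y → + k *ᶻ (x *ᶻ x) ≡ + k +ᶻ + 8 *ᶻ + k *ᶻ (+ 2 *ᶻ (y *ᶻ y) +ᶻ y) → rexp k k x ≡ eQ y
  eight x y eq = ℕ-from-double (φ-exponent k x) (trans (ℤₚ.*-distribˡ-+ (+ 2) (+ k) (+ rexp (8 * k) (3 * (8 * k)) y)) (trans
    (cong (+ 2 *ᶻ + k +ᶻ_) (trans (ψ-exponent (8 * k) y) (cong (λ z → + 2 *ᶻ (z *ᶻ (+ 2 *ᶻ (y *ᶻ y) +ᶻ y))) (ℤₚ.pos-* 8 k))))
    (trans (sym (ℤₚ.*-distribˡ-+ (+ 2) (+ k) (+ 8 *ᶻ + k *ᶻ (+ 2 *ᶻ (y *ᶻ y) +ᶻ y)))) (cong (+ 2 *ᶻ_) (sym eq)))))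
  e₀ : ∀ j → rexp k k (+ 4 *ᶻ j) ≡ rexp (4 * k) (4 * k) (+ 2 *ᶻ j)
  e₀ j = four (+ 4 *ᶻ j) (+ 2 *ᶻ j) (e (+ k) j)
    where
    e : ∀ k j → k *ᶻ ((+ 4 *ᶻ j) *ᶻ (+ 4 *ᶻ j)) ≡ + 4 *ᶻ k *ᶻ ((+ 2 *ᶻ j) *ᶻ (+ 2 *ᶻ j))
    e = ℤ-solve
  e₂ : ∀ j → rexp k k (+ 4 *ᶻ j +ᶻ + 2) ≡ rexp (4 * k) (4 * k) (+ 2 *ᶻ (-ᶻ j) +ᶻ -1ℤ)
  e₂ j = four (+ 4 *ᶻ j +ᶻ + 2) (+ 2 *ᶻ (-ᶻ j) +ᶻ -1ℤ) (e (+ k) j)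
    where
    e : ∀ k j → k *ᶻ ((+ 4 *ᶻ j +ᶻ + 2) *ᶻ (+ 4 *ᶻ j +ᶻ + 2)) ≡
      + 4 *ᶻ k *ᶻ ((+ 2 *ᶻ (-ᶻ j) +ᶻ -1ℤ) *ᶻ (+ 2 *ᶻ (-ᶻ j) +ᶻ -1ℤ))
    e = ℤ-solve
  e₁ : ∀ j → rexp k k (+ 4 *ᶻ j +ᶻ 1ℤ) ≡ eQ j
  e₁ j = eight (+ 4 *ᶻ j +ᶻ 1ℤ) j (e (+ k) j)
    where
    e : ∀ k j → k *ᶻ ((+ 4 *ᶻ j +ᶻ 1ℤ) *ᶻ (+ 4 *ᶻ j +ᶻ 1ℤ)) ≡ k +ᶻ + 8 *ᶻ k *ᶻ (+ 2 *ᶻ (j *ᶻ j) +ᶻ j)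
    e = ℤ-solve
  e₋₁ : ∀ j → rexp k k (+ 4 *ᶻ j +ᶻ -1ℤ) ≡ eQ (-ᶻ j)
  e₋₁ j = eight (+ 4 *ᶻ j +ᶻ -1ℤ) (-ᶻ j) (e (+ k) j)
    where
    e : ∀ k j → k *ᶻ ((+ 4 *ᶻ j +ᶻ -1ℤ) *ᶻ (+ 4 *ᶻ j +ᶻ -1ℤ)) ≡ k +ᶻ + 8 *ᶻ k *ᶻ (+ 2 *ᶻ ((-ᶻ j) *ᶻ (-ᶻ j)) +ᶻ -ᶻ j)
    e = ℤ-solve

rexp-shift : ∀ {a b a′ b′} d x y →
  (+ a +ᶻ + b) *ᶻ (x *ᶻ x) +ᶻ (+ b +ᶻ -ᶻ (+ a)) *ᶻ x ≡
  + 2 *ᶻ + d +ᶻ ((+ a′ +ᶻ + b′) *ᶻ (y *ᶻ y) +ᶻ (+ b′ +ᶻ -ᶻ (+ a′)) *ᶻ y) →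
  rexp a b x ≡ d + rexp a′ b′ y
rexp-shift {a} {b} {a′} {b′} d x y eq = ℕ-from-double (trans (rexp-ℤ a b x) eq)
  (trans (ℤₚ.*-distribˡ-+ (+ 2) (+ d) (+ rexp a′ b′ y)) (cong (+ 2 *ᶻ + d +ᶻ_) (rexp-ℤ a′ b′ y)))

-- The classes 3j + 1 and 3j - 1 are exchanged by negation, which explains the factor 2; here (3j +
-- 1)² = 1 + 9j² + 6j.
φ⁻-trisect : φ⁻ 1 ≈ φ⁻ 9 ⊕ const (-[1+ 1 ]) ∙ (mono 1 ∙ rtheta -1ℤ 3 15)
φ⁻-trisect = begin
  φ⁻ 1
    ≈⟨ theta-split₃ w (rexp-coercive 1 1) ⟩
  _ ⊕ (_ ⊕ _)
    ≈⟨ ⊕-cong (theta-cong _ w _ (rexp 9 9) (sign-triple -1ℤ refl) e₀)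
         (⊕-cong (theta-cong _ w₁ _ e′ (λ j → trans (sign-suc -1ℤ refl (+ 3 *ᶻ j)) (cong (-1ℤ *ᶻ_) (sign-triple -1ℤ refl j))) e₁)
                 (theta-cong-reflect _ w₁ _ e′ (λ j → trans (sign-pred -1ℤ refl (+ 3 *ᶻ j))
                   (cong (-1ℤ *ᶻ_) (trans (sign-triple -1ℤ refl j) (sym (sign-neg -1ℤ j))))) e₋₁)) ⟩
  φ⁻ 9 ⊕ (theta w₁ e′ ⊕ theta w₁ e′)
    ≈⟨ ⊕-congˡ (⊕-cong shape shape) ⟨
  φ⁻ 9 ⊕ (const -1ℤ ∙ (mono 1 ∙ B) ⊕ const -1ℤ ∙ (mono 1 ∙ B))
    ≈⟨ SR.solve 2 (λ p q → p :+ (con -1ℤ :* q :+ con -1ℤ :* q) := p :+ con (-[1+ 1 ]) :* q) ≈-refl (φ⁻ 9) (mono 1 ∙ B) ⟩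
  φ⁻ 9 ⊕ const (-[1+ 1 ]) ∙ (mono 1 ∙ B) ∎
  where
  open ≈-Reasoning
  B = rtheta -1ℤ 3 15
  w w₁ : ℤ → ℤ
  w j = zpow -1ℤ ℤ.∣ j ∣
  w₁ j = -1ℤ *ᶻ w j
  e′ : ℤ → ℕ
  e′ j = 1 + rexp 3 15 j
  shape : const -1ℤ ∙ (mono 1 ∙ B) ≈ theta w₁ e′
  shape = ≈-trans (∙-congˡ (theta-shift 1 w (rexp-coercive 3 15))) (theta-scale -1ℤ w e′)
  e₀ : ∀ j → rexp 1 1 (+ 3 *ᶻ j) ≡ rexp 9 9 j
  e₀ j = rexp-shift {1} {1} {9} {9} 0 (+ 3 *ᶻ j) j (e j)
    where
    e : ∀ j → + 2 *ᶻ ((+ 3 *ᶻ j) *ᶻ (+ 3 *ᶻ j)) +ᶻ 0ℤ *ᶻ (+ 3 *ᶻ j) ≡ 0ℤ +ᶻ (+ 18 *ᶻ (j *ᶻ j) +ᶻ 0ℤ *ᶻ j)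
    e = ℤ-solve
  e₁ : ∀ j → rexp 1 1 (+ 3 *ᶻ j +ᶻ 1ℤ) ≡ e′ j
  e₁ j = rexp-shift {1} {1} {3} {15} 1 (+ 3 *ᶻ j +ᶻ 1ℤ) j (e j)
    where
    e : ∀ j → + 2 *ᶻ ((+ 3 *ᶻ j +ᶻ 1ℤ) *ᶻ (+ 3 *ᶻ j +ᶻ 1ℤ)) +ᶻ 0ℤ *ᶻ (+ 3 *ᶻ j +ᶻ 1ℤ) ≡ + 2 +ᶻ (+ 18 *ᶻ (j *ᶻ j) +ᶻ + 12 *ᶻ j)
    e = ℤ-solve
  e₋₁ : ∀ j → rexp 1 1 (+ 3 *ᶻ j +ᶻ -1ℤ) ≡ e′ (-ᶻ j)
  e₋₁ j = rexp-shift {1} {1} {3} {15} 1 (+ 3 *ᶻ j +ᶻ -1ℤ) (-ᶻ j) (e j)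
    where
    e : ∀ j → + 2 *ᶻ ((+ 3 *ᶻ j +ᶻ -1ℤ) *ᶻ (+ 3 *ᶻ j +ᶻ -1ℤ)) +ᶻ 0ℤ *ᶻ (+ 3 *ᶻ j +ᶻ -1ℤ) ≡ + 2 +ᶻ (+ 18 *ᶻ ((-ᶻ j) *ᶻ (-ᶻ j)) +ᶻ + 12 *ᶻ (-ᶻ j))
    e = ℤ-solve

-- With exponents 2x² + x, the classes x = 3j and x = 3j + 1 yield the even and the odd terms of
-- f(q³, q⁶), and x = 3j - 1 yields q ψ(q⁹).
ψ-trisect : ψ 1 ≈ rtheta 1ℤ 3 6 ⊕ mono 1 ∙ ψ 9
ψ-trisect = begin
  ψ 1
    ≈⟨ theta-split₃ w (rexp-coercive 1 3) ⟩
  _ ⊕ (_ ⊕ _)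
    ≈⟨ ⊕-cong (theta-cong _ (λ j → w (+ 2 *ᶻ j)) _ (λ j → rexp 3 6 (+ 2 *ᶻ j)) (λ j → trivial (+ 3 *ᶻ j) (+ 2 *ᶻ j)) e₀)
         (⊕-cong (theta-cong-reflect _ (λ j → w (+ 2 *ᶻ j +ᶻ -1ℤ)) _ (λ j → rexp 3 6 (+ 2 *ᶻ j +ᶻ -1ℤ)) (λ j → trivial (+ 3 *ᶻ j +ᶻ 1ℤ) (+ 2 *ᶻ (-ᶻ j) +ᶻ -1ℤ)) e₁)
                 (theta-cong-reflect _ w _ (λ j → 1 + rexp 9 27 j) (λ j → trivial (+ 3 *ᶻ j +ᶻ -1ℤ) (-ᶻ j)) e₋₁)) ⟩
  P₀ ⊕ (P₁ ⊕ theta w (λ j → 1 + rexp 9 27 j))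
    ≈⟨ ⊕-assoc _ _ _ ⟨
  (P₀ ⊕ P₁) ⊕ theta w (λ j → 1 + rexp 9 27 j)
    ≈⟨ ⊕-cong (theta-split₂ w (rexp-coercive 3 6)) (theta-shift 1 w (rexp-coercive 9 27)) ⟨
  rtheta 1ℤ 3 6 ⊕ mono 1 ∙ ψ 9 ∎
  where
  open ≈-Reasoning
  w : ℤ → ℤ
  w j = zpow 1ℤ ℤ.∣ j ∣
  P₀ P₁ : Series
  P₀ = theta (λ j → w (+ 2 *ᶻ j)) (λ j → rexp 3 6 (+ 2 *ᶻ j))
  P₁ = theta (λ j → w (+ 2 *ᶻ j +ᶻ -1ℤ)) (λ j → rexp 3 6 (+ 2 *ᶻ j +ᶻ -1ℤ))
  trivial : ∀ x y → w x ≡ w y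
  trivial x y = trans (zpow-1 ℤ.∣ x ∣) (sym (zpow-1 ℤ.∣ y ∣))
  e₀ : ∀ j → rexp 1 3 (+ 3 *ᶻ j) ≡ rexp 3 6 (+ 2 *ᶻ j)
  e₀ j = rexp-shift {1} {3} {3} {6} 0 (+ 3 *ᶻ j) (+ 2 *ᶻ j) (e j)
    where
    e : ∀ j → + 4 *ᶻ ((+ 3 *ᶻ j) *ᶻ (+ 3 *ᶻ j)) +ᶻ + 2 *ᶻ (+ 3 *ᶻ j) ≡ 0ℤ +ᶻ (+ 9 *ᶻ ((+ 2 *ᶻ j) *ᶻ (+ 2 *ᶻ j)) +ᶻ + 3 *ᶻ (+ 2 *ᶻ j))
    e = ℤ-solve
  e₁ : ∀ j → rexp 1 3 (+ 3 *ᶻ j +ᶻ 1ℤ) ≡ rexp 3 6 (+ 2 *ᶻ (-ᶻ j) +ᶻ -1ℤ)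
  e₁ j = rexp-shift {1} {3} {3} {6} 0 (+ 3 *ᶻ j +ᶻ 1ℤ) (+ 2 *ᶻ (-ᶻ j) +ᶻ -1ℤ) (e j)
    where
    e : ∀ j → + 4 *ᶻ ((+ 3 *ᶻ j +ᶻ 1ℤ) *ᶻ (+ 3 *ᶻ j +ᶻ 1ℤ)) +ᶻ + 2 *ᶻ (+ 3 *ᶻ j +ᶻ 1ℤ) ≡
      0ℤ +ᶻ (+ 9 *ᶻ ((+ 2 *ᶻ (-ᶻ j) +ᶻ -1ℤ) *ᶻ (+ 2 *ᶻ (-ᶻ j) +ᶻ -1ℤ)) +ᶻ + 3 *ᶻ (+ 2 *ᶻ (-ᶻ j) +ᶻ -1ℤ))
    e = ℤ-solve
  e₋₁ : ∀ j → rexp 1 3 (+ 3 *ᶻ j +ᶻ -1ℤ) ≡ 1 + rexp 9 27 (-ᶻ j)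
  e₋₁ j = rexp-shift {1} {3} {9} {27} 1 (+ 3 *ᶻ j +ᶻ -1ℤ) (-ᶻ j) (e j)
    where
    e : ∀ j → + 4 *ᶻ ((+ 3 *ᶻ j +ᶻ -1ℤ) *ᶻ (+ 3 *ᶻ j +ᶻ -1ℤ)) +ᶻ + 2 *ᶻ (+ 3 *ᶻ j +ᶻ -1ℤ) ≡ + 2 +ᶻ (+ 36 *ᶻ ((-ᶻ j) *ᶻ (-ᶻ j)) +ᶻ + 18 *ᶻ (-ᶻ j))
    e = ℤ-solve

-- The quadratic form x² + 3y²

zsum-swap : ∀ B C (f : ℤ → ℤ → ℤ) → zsum B (λ x → zsum C (λ y → f x y)) ≡ zsum C (λ y → zsum B (λ x → f x y))
zsum-swap zero    C f = refl
zsum-swap (suc B) C f = begin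
  zsum B (λ x → zsum C (f x)) +ᶻ (zsum C (f (+ suc B)) +ᶻ zsum C (f -[1+ B ]))
    ≡⟨ cong₂ _+ᶻ_ (zsum-swap B C f) (sym (zsum-+ C (f (+ suc B)) (f -[1+ B ]))) ⟩
  zsum C (λ y → zsum B (λ x → f x y)) +ᶻ zsum C (λ y → f (+ suc B) y +ᶻ f -[1+ B ] y)
    ≡⟨ zsum-+ C (λ y → zsum B (λ x → f x y)) (λ y → f (+ suc B) y +ᶻ f -[1+ B ] y) ⟨
  zsum C (λ y → zsum (suc B) (λ x → f x y)) ∎
  where open ≡-Reasoning

theta-truncation : ∀ w {e} → Coercive e → ∀ {n B} → n ≤ B →
  theta w e ≈ zsumS B (λ x → const (w x) ∙ mono (e x)) upto n
theta-truncation w {e} coercive {n} {B} n≤B = agree λ m m≤n →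
  trans (theta-window w coercive (ℕₚ.≤-trans m≤n n≤B)) (zsum-cong B λ x →
    sym (trans (at (const-∙ (w x) (mono (e x))) m) (cong (w x *ᶻ_) (δ-comm m (e x)))))

theta-product : ∀ w w′ {e e′} → Coercive e → Coercive e′ → ∀ {n B C} → n ≤ B → n ≤ C →
  (theta w e ∙ theta w′ e′) n ≡ zsum B (λ x → zsum C (λ y → w x *ᶻ w′ y *ᶻ δ (e x + e′ y) n))
theta-product w w′ {e} {e′} coe coe′ {n} {B} {C} n≤B n≤C = begin
  (theta w e ∙ theta w′ e′) n
    ≡⟨ at≤ (∙-upto (theta-truncation w coe n≤B) (theta-truncation w′ coe′ n≤C)) n ℕₚ.≤-refl ⟩
  (zsumS B f ∙ zsumS C g) n
    ≡⟨ at (≈-trans (∙-comm (zsumS B f) (zsumS C g)) (∙-zsumS (zsumS C g) B f)) n ⟩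
  zsum B (λ x → (zsumS C g ∙ f x) n)
    ≡⟨ zsum-cong B (λ x → trans (at (≈-trans (∙-comm (zsumS C g) (f x)) (∙-zsumS (f x) C g)) n) (zsum-cong C (term x))) ⟩
  zsum B (λ x → zsum C (λ y → w x *ᶻ w′ y *ᶻ δ (e x + e′ y) n)) ∎
  where
  open ≡-Reasoning
  f g : ℤ → Series
  f x = const (w x) ∙ mono (e x)
  g y = const (w′ y) ∙ mono (e′ y)
  term : ∀ x y → (f x ∙ g y) n ≡ w x *ᶻ w′ y *ᶻ δ (e x + e′ y) n
  term x y = begin
    (f x ∙ g y) n
      ≡⟨ at (∙-interchange (const (w x)) (mono (e x)) (const (w′ y)) (mono (e′ y))) n ⟩
    ((const (w x) ∙ const (w′ y)) ∙ (mono (e x) ∙ mono (e′ y))) n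
      ≡⟨ at (∙-cong (const-* (w x) (w′ y)) (mono-+ (e x) (e′ y))) n ⟩
    (const (w x *ᶻ w′ y) ∙ mono (e x + e′ y)) n
      ≡⟨ at (const-∙ (w x *ᶻ w′ y) (mono (e x + e′ y))) n ⟩
    w x *ᶻ w′ y *ᶻ δ n (e x + e′ y)
      ≡⟨ cong (w x *ᶻ w′ y *ᶻ_) (δ-comm n (e x + e′ y)) ⟩
    w x *ᶻ w′ y *ᶻ δ (e x + e′ y) n ∎

theta-product-1 : ∀ a b c d .{{_ : NonZero a}} .{{_ : NonZero b}} .{{_ : NonZero c}} .{{_ : NonZero d}} →
  ∀ {n B C} → n ≤ B → n ≤ C →
  (rtheta 1ℤ a b ∙ rtheta 1ℤ c d) n ≡ zsum B (λ x → zsum C (λ y → δ (rexp a b x + rexp c d y) n))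
theta-product-1 a b c d {n} {B} {C} n≤B n≤C = trans
  (theta-product (λ x → zpow 1ℤ ℤ.∣ x ∣) (λ x → zpow 1ℤ ℤ.∣ x ∣) (rexp-coercive a b) (rexp-coercive c d) n≤B n≤C)
  (zsum-cong B λ x → zsum-cong C λ y → trans
    (cong (_*ᶻ δ (rexp a b x + rexp c d y) n) (cong₂ _*ᶻ_ (zpow-1 ℤ.∣ x ∣) (zpow-1 ℤ.∣ y ∣))) (ℤₚ.*-identityˡ _))

odd≢even : ∀ m z → + (m * 2 + 1) ≢ + 2 *ᶻ z
odd≢even m z eq = absurd ℤ.∣ z +ᶻ -ᶻ (+ m) ∣ (trans (sym (ℤₚ.abs-* (+ 2) (z +ᶻ -ᶻ (+ m)))) (cong ℤ.∣_∣ difference))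
  where
  absurd : ∀ a → 2 * a ≢ 1
  absurd zero    ()
  absurd (suc a) p with trans (sym (ℕₚ.+-suc a (a + 0))) (ℕₚ.suc-injective p)
  ... | ()
  difference : + 2 *ᶻ (z +ᶻ -ᶻ (+ m)) ≡ 1ℤ
  difference = trans (e₁ z (+ m)) (trans (cong (_+ᶻ -ᶻ (+ 2 *ᶻ + m))
    (trans (sym eq) (cong (_+ᶻ 1ℤ) (ℤₚ.pos-* m 2)))) (e₂ (+ m)))
    where
    e₁ : ∀ z m → + 2 *ᶻ (z +ᶻ -ᶻ m) ≡ + 2 *ᶻ z +ᶻ -ᶻ (+ 2 *ᶻ m)
    e₁ = ℤ-solve
    e₂ : ∀ m → m *ᶻ + 2 +ᶻ 1ℤ +ᶻ -ᶻ (+ 2 *ᶻ m) ≡ 1ℤ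
    e₂ = ℤ-solve

-- For odd n, the solutions of x² + 3y² = n with x - y ≡ 1 mod 4 correspond to
-- those of (4j+1)² + 3(4k+1)² = 4n through x - y = 4k + 1 and y = j - k
-- (a unit of ℤ[ω] acts); negation gives those with x - y ≡ 3 mod 4.
φφ₃-odd : extract 2 1 (φ⁺ 1 ∙ φ⁺ 3) ≈ const (+ 2) ∙ (ψ 1 ∙ ψ 3)
φφ₃-odd = pointwise coefficient
  where
  coefficient : ∀ m → (φ⁺ 1 ∙ φ⁺ 3) (m * 2 + 1) ≡ (const (+ 2) ∙ (ψ 1 ∙ ψ 3)) m
  coefficient m = begin
    (φ⁺ 1 ∙ φ⁺ 3) n
      ≡⟨ theta-product-1 1 1 3 3 {n} {n} {n} ℕₚ.≤-refl ℕₚ.≤-refl ⟩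
    zsum n (λ x → zsum n (λ y → f x y))
      ≡⟨ zsum-swap n n f ⟩
    zsum n (λ y → zsum n (λ x → f x y))
      -- Substitute x = b + y. The window for b exceeds the necessary 2n so as to have the shape
      -- that `zsum-split₄` splits.
      ≡⟨ zsum-cong≤ n (λ y y≤n → sym (zsum-shift (f-supp₁ y) y (window y y≤n) ℕₚ.≤-refl)) ⟩
    zsum n (λ y → zsum (2 + n * 4) (λ b → f (b +ᶻ y) y))
      ≡⟨ zsum-swap n (2 + n * 4) (λ y b → f (b +ᶻ y) y) ⟩
    zsum (2 + n * 4) g
      ≡⟨ zsum-split₄ n g ⟩
    zsum n (λ k → g (+ 4 *ᶻ k)) +ᶻ (zsum n (λ k → g (+ 4 *ᶻ k +ᶻ 1ℤ)) +ᶻ zsum n (λ k → g (+ 4 *ᶻ k +ᶻ -1ℤ))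
      +ᶻ (zsum n (λ k → g (+ 4 *ᶻ k +ᶻ + 2)) +ᶻ g -[1+ 1 + n * 4 ]))
      -- For even b the value (b + y)² + 3y² is even and misses the odd n; negating b and y
      -- exchanges the two odd classes.
      ≡⟨ cong₂ _+ᶻ_ (zsum-0 n (λ k → g-even (+ 4 *ᶻ k) (+ 2 *ᶻ k) (d₀ k)))
           (cong₂ _+ᶻ_ (cong (zsum n (λ k → g (+ 4 *ᶻ k +ᶻ 1ℤ)) +ᶻ_) reflected)
             (cong₂ _+ᶻ_ (zsum-0 n (λ k → g-even (+ 4 *ᶻ k +ᶻ + 2) (+ 2 *ᶻ k +ᶻ 1ℤ) (d₂ k)))
               (g-even -[1+ 1 + n * 4 ] (-ᶻ (1ℤ +ᶻ + n *ᶻ + 2)) (trans (cong (λ z → -ᶻ (+ 2 +ᶻ z)) (ℤₚ.pos-* n 4)) (d₃ (+ n)))))) ⟩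
    0ℤ +ᶻ (zsum n (λ k → g (+ 4 *ᶻ k +ᶻ 1ℤ)) +ᶻ zsum n (λ k → g (+ 4 *ᶻ k +ᶻ 1ℤ)) +ᶻ 0ℤ)
      ≡⟨ double (zsum n (λ k → g (+ 4 *ᶻ k +ᶻ 1ℤ))) ⟩
    + 2 *ᶻ zsum n (λ k → g (+ 4 *ᶻ k +ᶻ 1ℤ))
      ≡⟨ cong (+ 2 *ᶻ_) (zsum-cong≤ n g-one) ⟩
    + 2 *ᶻ zsum n (λ k → zsum (n + n) (λ j → h j k))
      ≡⟨ cong (+ 2 *ᶻ_) (zsum-swap (n + n) n h) ⟨
    + 2 *ᶻ zsum (n + n) (λ j → zsum n (λ k → h j k))
      ≡⟨ cong (+ 2 *ᶻ_) (theta-product-1 1 3 3 9 {m} {n + n} {n} (ℕₚ.≤-trans m≤n (ℕₚ.m≤m+n n n)) m≤n) ⟨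
    + 2 *ᶻ (ψ 1 ∙ ψ 3) m
      ≡⟨ at (const-∙ (+ 2) (ψ 1 ∙ ψ 3)) m ⟨
    (const (+ 2) ∙ (ψ 1 ∙ ψ 3)) m ∎
    where
    open ≡-Reasoning
    n = m * 2 + 1
    m≤n : m ≤ n
    m≤n = ℕₚ.≤-trans (ℕₚ.m≤m*n m 2) (ℕₚ.m≤m+n (m * 2) 1)
    N : ℤ → ℤ → ℕ
    N x y = rexp 1 1 x + rexp 3 3 y
    f h : ℤ → ℤ → ℤ
    f x y = δ (N x y) n
    h j k = δ (rexp 1 3 j + rexp 3 9 k) m
    g : ℤ → ℤ
    g b = zsum n (λ y → f (b +ᶻ y) y)
    N-ℤ : ∀ x y → + 2 *ᶻ + N x y ≡ + 2 *ᶻ (x *ᶻ x +ᶻ + 3 *ᶻ (y *ᶻ y))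
    N-ℤ x y = trans (ℤₚ.*-distribˡ-+ (+ 2) (+ rexp 1 1 x) (+ rexp 3 3 y))
      (trans (cong₂ _+ᶻ_ (φ-exponent 1 x) (φ-exponent 3 y)) (e x y))
      where
      e : ∀ x y → + 2 *ᶻ (1ℤ *ᶻ (x *ᶻ x)) +ᶻ + 2 *ᶻ (+ 3 *ᶻ (y *ᶻ y)) ≡ + 2 *ᶻ (x *ᶻ x +ᶻ + 3 *ᶻ (y *ᶻ y))
      e = ℤ-solve
    f-supp₁ : ∀ y → SupportedIn n (λ x → f x y)
    f-supp₁ y x n<x = δ-≢ (ℕₚ.>⇒≢ (ℕₚ.<-≤-trans n<x (ℕₚ.≤-trans (rexp-coercive 1 1 x) (ℕₚ.m≤m+n _ (rexp 3 3 y)))))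
    f-supp₂ : ∀ c → SupportedIn n (λ y → f (c +ᶻ y) y)
    f-supp₂ c y n<y = δ-≢ (ℕₚ.>⇒≢ (ℕₚ.<-≤-trans n<y (ℕₚ.≤-trans (rexp-coercive 3 3 y) (ℕₚ.m≤n+m _ (rexp 1 1 (c +ᶻ y))))))
    window : ∀ y → ℤ.∣ y ∣ ≤ n → n + ℤ.∣ y ∣ ≤ 2 + n * 4
    window y y≤n = ℕₚ.≤-trans (ℕₚ.+-monoʳ-≤ n y≤n) (ℕₚ.≤-trans
      (ℕₚ.+-monoʳ-≤ n (ℕₚ.m≤m+n n (n + (n + 2)))) (ℕₚ.≤-reflexive (e n)))
      where
      e : ∀ n → n + (n + (n + (n + 2))) ≡ 2 + n * 4
      e = ℕ-solve
    g-even : ∀ b c → b ≡ + 2 *ᶻ c → g b ≡ 0ℤ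
    g-even b c refl = zsum-0 n λ y → δ-≢ λ eq → odd≢even m (+ 2 *ᶻ (c *ᶻ c +ᶻ c *ᶻ y +ᶻ y *ᶻ y))
      (ℤₚ.*-cancelˡ-≡ (+ 2) (+ n) _ (trans (cong (λ z → + 2 *ᶻ + z) (sym eq)) (trans (N-ℤ (+ 2 *ᶻ c +ᶻ y) y) (cong (+ 2 *ᶻ_) (e c y)))))
      where
      e : ∀ c y → (+ 2 *ᶻ c +ᶻ y) *ᶻ (+ 2 *ᶻ c +ᶻ y) +ᶻ + 3 *ᶻ (y *ᶻ y) ≡ + 2 *ᶻ (+ 2 *ᶻ (c *ᶻ c +ᶻ c *ᶻ y +ᶻ y *ᶻ y))
      e = ℤ-solve
    d₀ : ∀ k → + 4 *ᶻ k ≡ + 2 *ᶻ (+ 2 *ᶻ k)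
    d₀ = ℤ-solve
    d₂ : ∀ k → + 4 *ᶻ k +ᶻ + 2 ≡ + 2 *ᶻ (+ 2 *ᶻ k +ᶻ 1ℤ)
    d₂ = ℤ-solve
    d₃ : ∀ n → -ᶻ (+ 2 +ᶻ n *ᶻ + 4) ≡ + 2 *ᶻ (-ᶻ (1ℤ +ᶻ n *ᶻ + 2))
    d₃ = ℤ-solve
    double : ∀ x → 0ℤ +ᶻ (x +ᶻ x +ᶻ 0ℤ) ≡ + 2 *ᶻ x
    double = ℤ-solve
    g-neg : ∀ b → g (-ᶻ b) ≡ g b
    g-neg b = trans (zsum-reflect n (λ y → f (-ᶻ b +ᶻ y) y)) (zsum-cong n λ y → cong (λ z → δ z n)
      (ℕ-from-double (trans (N-ℤ (-ᶻ b +ᶻ -ᶻ y) (-ᶻ y)) (e b y)) (N-ℤ (b +ᶻ y) y)))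
      where
      e : ∀ b y → + 2 *ᶻ ((-ᶻ b +ᶻ -ᶻ y) *ᶻ (-ᶻ b +ᶻ -ᶻ y) +ᶻ + 3 *ᶻ ((-ᶻ y) *ᶻ (-ᶻ y))) ≡
        + 2 *ᶻ ((b +ᶻ y) *ᶻ (b +ᶻ y) +ᶻ + 3 *ᶻ (y *ᶻ y))
      e = ℤ-solve
    reflected : zsum n (λ k → g (+ 4 *ᶻ k +ᶻ -1ℤ)) ≡ zsum n (λ k → g (+ 4 *ᶻ k +ᶻ 1ℤ))
    reflected = trans (zsum-reflect n (λ k → g (+ 4 *ᶻ k +ᶻ -1ℤ))) (zsum-cong n λ k →
      trans (cong g (e k)) (g-neg (+ 4 *ᶻ k +ᶻ 1ℤ)))
      where
      e : ∀ k → + 4 *ᶻ (-ᶻ k) +ᶻ -1ℤ ≡ -ᶻ (+ 4 *ᶻ k +ᶻ 1ℤ)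
      e = ℤ-solve
    g-one : ∀ k → ℤ.∣ k ∣ ≤ n → g (+ 4 *ᶻ k +ᶻ 1ℤ) ≡ zsum (n + n) (λ j → h j k)
    g-one k k≤n = trans (sym (zsum-shift (f-supp₂ (+ 4 *ᶻ k +ᶻ 1ℤ)) (-ᶻ k)
        (ℕₚ.+-monoʳ-≤ n (ℕₚ.≤-trans (ℕₚ.≤-reflexive (ℤₚ.∣-i∣≡∣i∣ k)) k≤n)) ℕₚ.≤-refl))
      (zsum-cong (n + n) λ j → trans (cong (λ z → δ z n) (relation j)) (δ-⇔
        (λ eq → ℕₚ.*-cancelʳ-≡ _ m 2 (ℕₚ.+-cancelʳ-≡ 1 _ (m * 2) eq)) (cong (λ z → z * 2 + 1))))
      where
      relation : ∀ j → N (+ 4 *ᶻ k +ᶻ 1ℤ +ᶻ (j +ᶻ -ᶻ k)) (j +ᶻ -ᶻ k) ≡ (rexp 1 3 j + rexp 3 9 k) * 2 + 1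
      relation j = ℕ-from-double (trans (N-ℤ (+ 4 *ᶻ k +ᶻ 1ℤ +ᶻ (j +ᶻ -ᶻ k)) (j +ᶻ -ᶻ k)) (e₁ j k))
        (trans (cong (λ z → + 2 *ᶻ (z +ᶻ 1ℤ)) (ℤₚ.pos-* (rexp 1 3 j + rexp 3 9 k) 2))
          (trans (e₂ (+ rexp 1 3 j) (+ rexp 3 9 k)) (cong₂ (λ x y → + 2 *ᶻ (x +ᶻ y) +ᶻ + 2) (ψ-exponent 1 j) (ψ-exponent 3 k))))
        where
        e₁ : ∀ j k → + 2 *ᶻ ((+ 4 *ᶻ k +ᶻ 1ℤ +ᶻ (j +ᶻ -ᶻ k)) *ᶻ (+ 4 *ᶻ k +ᶻ 1ℤ +ᶻ (j +ᶻ -ᶻ k)) +ᶻ + 3 *ᶻ ((j +ᶻ -ᶻ k) *ᶻ (j +ᶻ -ᶻ k))) ≡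
          + 2 *ᶻ (+ 2 *ᶻ (1ℤ *ᶻ (+ 2 *ᶻ (j *ᶻ j) +ᶻ j)) +ᶻ + 2 *ᶻ (+ 3 *ᶻ (+ 2 *ᶻ (k *ᶻ k) +ᶻ k))) +ᶻ + 2
        e₁ = ℤ-solve
        e₂ : ∀ x y → + 2 *ᶻ ((x +ᶻ y) *ᶻ + 2 +ᶻ 1ℤ) ≡ + 2 *ᶻ (+ 2 *ᶻ x +ᶻ + 2 *ᶻ y) +ᶻ + 2
        e₂ = ℤ-solve

-- The substitution s(-q).
twist : Series → Series
twist s n = zpow -1ℤ n *ᶻ s n

twist-∙ : ∀ s t → twist (s ∙ t) ≈ twist s ∙ twist t
twist-∙ s t = pointwise λ n → let open ≡-Reasoning in begin
  zpow -1ℤ n *ᶻ (s ∙ t) n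
    ≡⟨ cong (zpow -1ℤ n *ᶻ_) (∙-at s t n) ⟩
  zpow -1ℤ n *ᶻ sumTo n (λ k → s k *ᶻ t (n ∸ k))
    ≡⟨ sumTo-*ˡ n (zpow -1ℤ n) _ ⟨
  sumTo n (λ k → zpow -1ℤ n *ᶻ (s k *ᶻ t (n ∸ k)))
    ≡⟨ sumTo-cong≤ n (λ k k≤n → trans (cong (_*ᶻ (s k *ᶻ t (n ∸ k)))
         (trans (cong (zpow -1ℤ) (sym (ℕₚ.m+[n∸m]≡n k≤n))) (zpow-+ -1ℤ k (n ∸ k))))
         (interchange (zpow -1ℤ k) (zpow -1ℤ (n ∸ k)) (s k) (t (n ∸ k)))) ⟩
  sumTo n (λ k → twist s k *ᶻ twist t (n ∸ k))
    ≡⟨ ∙-at (twist s) (twist t) n ⟨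
  (twist s ∙ twist t) n ∎
  where
  interchange : ∀ a b c d → (a *ᶻ b) *ᶻ (c *ᶻ d) ≡ (a *ᶻ c) *ᶻ (b *ᶻ d)
  interchange = ℤ-solve

zpow-parity : ∀ m r → zpow -1ℤ (m * 2 + r) ≡ zpow -1ℤ r
zpow-parity zero    r = refl
zpow-parity (suc m) r = trans (e (zpow -1ℤ (m * 2 + r))) (zpow-parity m r)
  where
  e : ∀ x → -1ℤ *ᶻ (-1ℤ *ᶻ x) ≡ x
  e = ℤ-solve

-- For odd k the exponent k x² has the parity of |x|, so substituting -q for q produces exactly the
-- signs of φ(-q^k).
twist-φ⁺ : ∀ l → twist (φ⁺ (l * 2 + 1)) ≈ φ⁻ (l * 2 + 1)
twist-φ⁺ l = pointwise λ n → trans (sym (zsum-*ˡ n (zpow -1ℤ n) _)) (zsum-cong n (term n))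
  where
  half : ℤ → ℕ
  half x = l * ℤ.∣ x ∣ + (l * 2 + 1) * tri ℤ.∣ x ∣
  exponent-parity : ∀ x → rexp (l * 2 + 1) (l * 2 + 1) x ≡ half x * 2 + ℤ.∣ x ∣
  exponent-parity (+ m) = trans (cong (λ z → (l * 2 + 1) * z + (l * 2 + 1) * (m + tri m)) (triᶻ-neg m)) (e l m (tri m))
    where
    e : ∀ l m t → (l * 2 + 1) * t + (l * 2 + 1) * (m + t) ≡ (l * m + (l * 2 + 1) * t) * 2 + m
    e = ℕ-solve
  exponent-parity -[1+ m ] = e l (suc m) (tri (suc m))
    where
    e : ∀ l m t → (l * 2 + 1) * (m + t) + (l * 2 + 1) * t ≡ (l * m + (l * 2 + 1) * t) * 2 + m
    e = ℕ-solve
  term : ∀ n x → zpow -1ℤ n *ᶻ (zpow 1ℤ ℤ.∣ x ∣ *ᶻ δ (rexp (l * 2 + 1) (l * 2 + 1) x) n) ≡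
    zpow -1ℤ ℤ.∣ x ∣ *ᶻ δ (rexp (l * 2 + 1) (l * 2 + 1) x) n
  term n x with rexp (l * 2 + 1) (l * 2 + 1) x ℕₚ.≟ n
  ... | yes refl = trans (cong (λ y → zpow -1ℤ (rexp (l * 2 + 1) (l * 2 + 1) x) *ᶻ (y *ᶻ 1ℤ)) (zpow-1 ℤ.∣ x ∣))
    (cong (_*ᶻ 1ℤ) (trans (cong (zpow -1ℤ) (exponent-parity x)) (zpow-parity (half x) ℤ.∣ x ∣)))
  ... | no _ = trans (cong (zpow -1ℤ n *ᶻ_) (ℤₚ.*-zeroʳ (zpow 1ℤ ℤ.∣ x ∣)))
    (trans (ℤₚ.*-zeroʳ (zpow -1ℤ n)) (sym (ℤₚ.*-zeroʳ (zpow -1ℤ ℤ.∣ x ∣))))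

extract-twist : ∀ r s → extract 2 r (twist s) ≈ const (zpow -1ℤ r) ∙ extract 2 r s
extract-twist r s = pointwise λ n → trans (cong (_*ᶻ s (n * 2 + r)) (zpow-parity n r))
  (sym (at (const-∙ (zpow -1ℤ r) (extract 2 r s)) n))

residue-unique : ∀ d .{{_ : NonZero d}} {r s} n → r < d → s < d → n * d + r ≡ s → r ≡ s
residue-unique d {r} {s} n r<d s<d eq = begin
  r                ≡⟨ m<n⇒m%n≡m r<d ⟨
  r % d            ≡⟨ [m+kn]%n≡m%n r n d ⟨
  (r + n * d) % d  ≡⟨ cong (_% d) (trans (ℕₚ.+-comm r (n * d)) eq) ⟩
  s % d            ≡⟨ m<n⇒m%n≡m s<d ⟩
  s                ∎
  where open ≡-Reasoning

extract-mono-∙ : ∀ d .{{_ : NonZero d}} r → r < d → ∀ t → extract d r (mono r ∙ dilate d t) ≈ t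
extract-mono-∙ d r r<d t = ≈-trans (extract-cong d r (∙-comm _ _)) (≈-trans (extract-dilate d r<d t (mono r))
  (≈-trans (∙-congˡ (pointwise λ n → δ-⇔
    (λ eq → ℕₚ.m*n≡0⇒m≡0 n d (ℕₚ.+-cancelʳ-≡ r (n * d) 0 eq)) (λ { refl → refl }))) (∙-identityʳ t)))

extract-mono-∙-0 : ∀ d .{{_ : NonZero d}} {r s} → r < d → s < d → r ≢ s → ∀ t → extract d r (mono s ∙ dilate d t) ≈ zeroS
extract-mono-∙-0 d {r} {s} r<d s<d r≢s t = ≈-trans (extract-cong d r (∙-comm _ _)) (≈-trans (extract-dilate d r<d t (mono s))
  (≈-trans (∙-congˡ (pointwise λ n → δ-≢ (λ eq → r≢s (residue-unique d n r<d s<d eq)))) (∙-zeroʳ t)))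

dilate-⊕ : ∀ d s t → dilate d (s ⊕ t) ≈ dilate d s ⊕ dilate d t
dilate-⊕ d s t = pointwise λ n → trans (trans (sumTo-cong n (λ j →
    trans (cong (_*ᶻ δ (j * d) n) (⊕-at s t j)) (ℤₚ.*-distribʳ-+ (δ (j * d) n) (s j) (t j)))) (sumTo-+ n _ _))
  (sym (⊕-at (dilate d s) (dilate d t) n))

dilate-const-∙ : ∀ d c s → dilate d (const c ∙ s) ≈ const c ∙ dilate d s
dilate-const-∙ d c s = pointwise λ n → trans (trans (sumTo-cong n (λ j →
    trans (cong (_*ᶻ δ (j * d) n) (at (const-∙ c s) j)) (ℤₚ.*-assoc c (s j) (δ (j * d) n)))) (sumTo-*ˡ n c _))
  (sym (at (const-∙ c (dilate d s)) n))

dilate-mono : ∀ d .{{_ : NonZero d}} m → dilate d (mono m) ≈ mono (m * d)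
dilate-mono d m = extract-ext d λ
  { zero    r<d → ≈-trans (extract-dilated d (mono m)) (pointwise λ n → δ-⇔
      (λ eq → trans (ℕₚ.+-identityʳ (n * d)) (cong (_* d) eq))
      (λ eq → ℕₚ.*-cancelʳ-≡ n m d (trans (sym (ℕₚ.+-identityʳ (n * d))) eq)))
  ; (suc r) r<d → ≈-trans (extract-dilated-0 d (suc r) r<d (mono m)) (pointwise λ n → sym (δ-≢ λ eq →
      ℕₚ.1+n≢0 (trans (sym (m<n⇒m%n≡m r<d)) (trans (sym ([m+kn]%n≡m%n (suc r) n d))
        (trans (cong (_% d) (trans (ℕₚ.+-comm (suc r) (n * d)) eq)) (m*n%n≡0 m d)))))) }

-- Being a series in q^d. The closure lemmas assemble the witness, so it need not be written out for
-- the long expressions whose extraction vanishes.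
Dilated : ℕ → Series → Set
Dilated d s = Σ Series λ t → s ≈ dilate d t

Dilated-∙ : ∀ d .{{_ : NonZero d}} {s t} → Dilated d s → Dilated d t → Dilated d (s ∙ t)
Dilated-∙ d (s′ , p) (t′ , q) = s′ ∙ t′ , ≈-trans (∙-cong p q) (≈-sym (dilate-∙ d s′ t′))

Dilated-⊕ : ∀ d {s t} → Dilated d s → Dilated d t → Dilated d (s ⊕ t)
Dilated-⊕ d (s′ , p) (t′ , q) = s′ ⊕ t′ , ≈-trans (⊕-cong p q) (≈-sym (dilate-⊕ d s′ t′))

Dilated-const-∙ : ∀ d c {s} → Dilated d s → Dilated d (const c ∙ s)
Dilated-const-∙ d c (s′ , p) = const c ∙ s′ , ≈-trans (∙-congˡ p) (≈-sym (dilate-const-∙ d c s′))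

Dilated-mono : ∀ d .{{_ : NonZero d}} m → Dilated d (mono (m * d))
Dilated-mono d m = mono m , ≈-sym (dilate-mono d m)

Dilated-rtheta : ∀ d .{{_ : NonZero d}} ε a b .{{_ : NonZero a}} .{{_ : NonZero b}} → Dilated d (rtheta ε (d * a) (d * b))
Dilated-rtheta d ε a b = rtheta ε a b , rtheta-dilate d ε a b

-- Replacing q by -q keeps the even part of φ(q) φ(q³) and negates the odd part, which is 2q ψ(q²)
-- ψ(q⁶) by `φφ₃-odd`; the difference is twice the odd part.
φ⁻φ⁻₃ : φ⁻ 1 ∙ φ⁻ 3 ⊕ const (+ 4) ∙ (mono 1 ∙ (ψ 2 ∙ ψ 6)) ≈ φ⁺ 1 ∙ φ⁺ 3
φ⁻φ⁻₃ = extract-ext 2 λ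
  { 0 r<2 → begin
      extract 2 0 (φ⁻ 1 ∙ φ⁻ 3 ⊕ const (+ 4) ∙ (mono 1 ∙ (ψ 2 ∙ ψ 6)))
        ≈⟨ parts 0 ⟩
      const (zpow -1ℤ 0) ∙ P 0 ⊕ const (+ 4) ∙ extract 2 0 (mono 1 ∙ dilate 2 (ψ 1 ∙ ψ 3))
        ≈⟨ ⊕-congˡ (∙-congˡ (extract-mono-∙-0 2 (s≤s z≤n) (s≤s (s≤s z≤n)) (λ ()) (ψ 1 ∙ ψ 3))) ⟩
      const 1ℤ ∙ P 0 ⊕ const (+ 4) ∙ zeroS
        ≈⟨ ⊕-congˡ (∙-zeroʳ _) ⟩
      const 1ℤ ∙ P 0 ⊕ zeroS
        ≈⟨ ≈-trans (⊕-identityʳ _) (≈-trans (∙-congʳ (≈-sym oneS≈const1)) (∙-identityˡ (P 0))) ⟩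
      P 0 ∎
  ; 1 r<2 → begin
      extract 2 1 (φ⁻ 1 ∙ φ⁻ 3 ⊕ const (+ 4) ∙ (mono 1 ∙ (ψ 2 ∙ ψ 6)))
        ≈⟨ parts 1 ⟩
      const -1ℤ ∙ P 1 ⊕ const (+ 4) ∙ extract 2 1 (mono 1 ∙ dilate 2 (ψ 1 ∙ ψ 3))
        ≈⟨ ⊕-cong (∙-congˡ φφ₃-odd) (∙-congˡ (extract-mono-∙ 2 1 (s≤s (s≤s z≤n)) (ψ 1 ∙ ψ 3))) ⟩
      const -1ℤ ∙ (const (+ 2) ∙ (ψ 1 ∙ ψ 3)) ⊕ const (+ 4) ∙ (ψ 1 ∙ ψ 3)
        ≈⟨ SR.solve 1 (λ x → con -1ℤ :* (con (+ 2) :* x) :+ con (+ 4) :* x := con (+ 2) :* x) ≈-refl (ψ 1 ∙ ψ 3) ⟩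
      const (+ 2) ∙ (ψ 1 ∙ ψ 3)
        ≈⟨ φφ₃-odd ⟨
      P 1 ∎
  ; (suc (suc r)) (s≤s (s≤s ())) }
  where
  open ≈-Reasoning
  P : ℕ → Series
  P r = extract 2 r (φ⁺ 1 ∙ φ⁺ 3)
  parts : ∀ r → extract 2 r (φ⁻ 1 ∙ φ⁻ 3 ⊕ const (+ 4) ∙ (mono 1 ∙ (ψ 2 ∙ ψ 6))) ≈
    const (zpow -1ℤ r) ∙ P r ⊕ const (+ 4) ∙ extract 2 r (mono 1 ∙ dilate 2 (ψ 1 ∙ ψ 3))
  parts r = begin
    extract 2 r (φ⁻ 1 ∙ φ⁻ 3 ⊕ const (+ 4) ∙ (mono 1 ∙ (ψ 2 ∙ ψ 6)))
      ≈⟨ extract-cong 2 r (⊕-cong (≈-trans (∙-cong (≈-sym (twist-φ⁺ 0)) (≈-sym (twist-φ⁺ 1))) (≈-sym (twist-∙ (φ⁺ 1) (φ⁺ 3))))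
           (∙-congˡ (∙-congˡ (≈-trans (∙-cong (rtheta-dilate 2 1ℤ 1 3) (rtheta-dilate 2 1ℤ 3 9)) (≈-sym (dilate-∙ 2 (ψ 1) (ψ 3))))))) ⟩
    extract 2 r (twist (φ⁺ 1 ∙ φ⁺ 3) ⊕ const (+ 4) ∙ (mono 1 ∙ dilate 2 (ψ 1 ∙ ψ 3)))
      ≈⟨ extract-⊕ 2 r _ _ ⟩
    extract 2 r (twist (φ⁺ 1 ∙ φ⁺ 3)) ⊕ extract 2 r (const (+ 4) ∙ (mono 1 ∙ dilate 2 (ψ 1 ∙ ψ 3)))
      ≈⟨ ⊕-cong (extract-twist r (φ⁺ 1 ∙ φ⁺ 3)) (extract-const 2 r (+ 4) _) ⟩
    const (zpow -1ℤ r) ∙ P r ⊕ const (+ 4) ∙ extract 2 r (mono 1 ∙ dilate 2 (ψ 1 ∙ ψ 3)) ∎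

φ⁻₂φ⁻₆ : φ⁻ 2 ∙ φ⁻ 6 ⊕ const (+ 4) ∙ (mono 2 ∙ (ψ 4 ∙ ψ 12)) ≈ φ⁺ 2 ∙ φ⁺ 6
φ⁻₂φ⁻₆ = begin
  φ⁻ 2 ∙ φ⁻ 6 ⊕ const (+ 4) ∙ (mono 2 ∙ (ψ 4 ∙ ψ 12))
    ≈⟨ ⊕-cong (pair (rtheta-dilate 2 -1ℤ 1 1) (rtheta-dilate 2 -1ℤ 3 3)) (∙-congˡ
         (≈-trans (∙-cong (≈-sym (dilate-mono 2 1)) (pair (rtheta-dilate 2 1ℤ 2 6) (rtheta-dilate 2 1ℤ 6 18))) (≈-sym (dilate-∙ 2 (mono 1) (ψ 2 ∙ ψ 6))))) ⟩
  dilate 2 (φ⁻ 1 ∙ φ⁻ 3) ⊕ const (+ 4) ∙ dilate 2 (mono 1 ∙ (ψ 2 ∙ ψ 6))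
    ≈⟨ ≈-trans (dilate-⊕ 2 _ _) (⊕-congˡ (dilate-const-∙ 2 (+ 4) _)) ⟨
  dilate 2 (φ⁻ 1 ∙ φ⁻ 3 ⊕ const (+ 4) ∙ (mono 1 ∙ (ψ 2 ∙ ψ 6)))
    ≈⟨ dilate-cong 2 φ⁻φ⁻₃ ⟩
  dilate 2 (φ⁺ 1 ∙ φ⁺ 3)
    ≈⟨ pair (rtheta-dilate 2 1ℤ 1 1) (rtheta-dilate 2 1ℤ 3 3) ⟨
  φ⁺ 2 ∙ φ⁺ 6 ∎
  where
  open ≈-Reasoning
  pair : ∀ {s t s′ t′} → s ≈ dilate 2 s′ → t ≈ dilate 2 t′ → s ∙ t ≈ dilate 2 (s′ ∙ t′)
  pair {s′ = s′} {t′} p q = ≈-trans (∙-cong p q) (≈-sym (dilate-∙ 2 s′ t′))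

-- Multiplying out (φ(q⁴) + 2q ψ(q⁸)) (φ(q¹²) - 2q³ ψ(q²⁴)), the even part is φ(q⁴) φ(q¹²) - 4q⁴
-- ψ(q⁸) ψ(q²⁴). After q² is replaced by q, `φ⁻₂φ⁻₆` evaluates it.
φ⁺φ⁻₃-even : extract 2 0 (φ⁺ 1 ∙ φ⁻ 3) ≈ φ⁻ 2 ∙ φ⁻ 6
φ⁺φ⁻₃-even = begin
  extract 2 0 (φ⁺ 1 ∙ φ⁻ 3)
    ≈⟨ extract-cong 2 0 expansion ⟩
  extract 2 0 (φ⁺ 4 ∙ φ⁺ 12 ⊕ const (-[1+ 3 ]) ∙ (mono 4 ∙ (ψ 8 ∙ ψ 24)) ⊕ mono 1 ∙ O)
    ≈⟨ extract-cong 2 0 (⊕-cong even (∙-congˡ (proj₂ O-dilated))) ⟩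
  extract 2 0 (dilate 2 (φ⁺ 2 ∙ φ⁺ 6 ⊕ const (-[1+ 3 ]) ∙ (mono 2 ∙ (ψ 4 ∙ ψ 12))) ⊕ mono 1 ∙ dilate 2 (proj₁ O-dilated))
    ≈⟨ extract-⊕ 2 0 _ _ ⟩
  extract 2 0 (dilate 2 (φ⁺ 2 ∙ φ⁺ 6 ⊕ const (-[1+ 3 ]) ∙ (mono 2 ∙ (ψ 4 ∙ ψ 12)))) ⊕ extract 2 0 (mono 1 ∙ dilate 2 (proj₁ O-dilated))
    ≈⟨ ⊕-cong (extract-dilated 2 _) (extract-mono-∙-0 2 (s≤s z≤n) (s≤s (s≤s z≤n)) (λ ()) (proj₁ O-dilated)) ⟩
  φ⁺ 2 ∙ φ⁺ 6 ⊕ const (-[1+ 3 ]) ∙ (mono 2 ∙ (ψ 4 ∙ ψ 12)) ⊕ zeroS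
    ≈⟨ ≈-trans (⊕-identityʳ _) (⊕-congʳ (≈-sym φ⁻₂φ⁻₆)) ⟩
  φ⁻ 2 ∙ φ⁻ 6 ⊕ const (+ 4) ∙ (mono 2 ∙ (ψ 4 ∙ ψ 12)) ⊕ const (-[1+ 3 ]) ∙ (mono 2 ∙ (ψ 4 ∙ ψ 12))
    ≈⟨ SR.solve 2 (λ x y → x :+ con (+ 4) :* y :+ con (-[1+ 3 ]) :* y := x) ≈-refl (φ⁻ 2 ∙ φ⁻ 6) (mono 2 ∙ (ψ 4 ∙ ψ 12)) ⟩
  φ⁻ 2 ∙ φ⁻ 6 ∎
  where
  open ≈-Reasoning
  O : Series
  O = const (+ 2) ∙ (ψ 8 ∙ φ⁺ 12) ⊕ const (-[1+ 1 ]) ∙ (mono 2 ∙ (φ⁺ 4 ∙ ψ 24))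
  O-dilated : Dilated 2 O
  O-dilated = Dilated-⊕ 2
    (Dilated-const-∙ 2 (+ 2) (Dilated-∙ 2 (Dilated-rtheta 2 1ℤ 4 12) (Dilated-rtheta 2 1ℤ 6 6)))
    (Dilated-const-∙ 2 (-[1+ 1 ]) (Dilated-∙ 2 (Dilated-mono 2 1) (Dilated-∙ 2 (Dilated-rtheta 2 1ℤ 2 2) (Dilated-rtheta 2 1ℤ 12 36))))
  even : φ⁺ 4 ∙ φ⁺ 12 ⊕ const (-[1+ 3 ]) ∙ (mono 4 ∙ (ψ 8 ∙ ψ 24)) ≈
    dilate 2 (φ⁺ 2 ∙ φ⁺ 6 ⊕ const (-[1+ 3 ]) ∙ (mono 2 ∙ (ψ 4 ∙ ψ 12)))
  even = proj₂ (Dilated-⊕ 2 (Dilated-∙ 2 (Dilated-rtheta 2 1ℤ 2 2) (Dilated-rtheta 2 1ℤ 6 6))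
    (Dilated-const-∙ 2 (-[1+ 3 ]) (Dilated-∙ 2 (Dilated-mono 2 2) (Dilated-∙ 2 (Dilated-rtheta 2 1ℤ 4 12) (Dilated-rtheta 2 1ℤ 12 36)))))
  expansion : φ⁺ 1 ∙ φ⁻ 3 ≈ φ⁺ 4 ∙ φ⁺ 12 ⊕ const (-[1+ 3 ]) ∙ (mono 4 ∙ (ψ 8 ∙ ψ 24)) ⊕ mono 1 ∙ O
  expansion = begin
    φ⁺ 1 ∙ φ⁻ 3
      -- Writing q³ as q · q² lets the solver take a single q out of the odd part, leaving the
      -- series `O` in q².
      ≈⟨ ∙-cong (φ-bisect 1ℤ refl 1) (≈-trans (φ-bisect -1ℤ refl 3)
           (⊕-congˡ (∙-congˡ (∙-congˡ (∙-congʳ (≈-sym (mono-+ 1 2))))))) ⟩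
    (φ⁺ 4 ⊕ const (+ 2) ∙ (const 1ℤ ∙ (mono 1 ∙ ψ 8))) ∙ (φ⁺ 12 ⊕ const (+ 2) ∙ (const -1ℤ ∙ (mono 1 ∙ mono 2 ∙ ψ 24)))
      ≈⟨ SR.solve 6 (λ a c q r u v → 
           (a :+ con (+ 2) :* (con 1ℤ :* (q :* u))) :* (c :+ con (+ 2) :* (con -1ℤ :* (q :* r :* v))) :=
           a :* c :+ con (-[1+ 3 ]) :* (q :* (q :* r) :* (u :* v)) :+ q :* (con (+ 2) :* (u :* c) :+ con (-[1+ 1 ]) :* (r :* (a :* v))))
           ≈-refl (φ⁺ 4) (φ⁺ 12) (mono 1) (mono 2) (ψ 8) (ψ 24) ⟩
    φ⁺ 4 ∙ φ⁺ 12 ⊕ const (-[1+ 3 ]) ∙ (mono 1 ∙ (mono 1 ∙ mono 2) ∙ (ψ 8 ∙ ψ 24)) ⊕ mono 1 ∙ O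
      ≈⟨ ⊕-congʳ (⊕-congˡ (∙-congˡ (∙-congʳ (≈-trans (∙-congˡ (mono-+ 1 2)) (mono-+ 1 3))))) ⟩
    φ⁺ 4 ∙ φ⁺ 12 ⊕ const (-[1+ 3 ]) ∙ (mono 4 ∙ (ψ 8 ∙ ψ 24)) ⊕ mono 1 ∙ O ∎

θ₃₆θ₃₁₅ : rtheta 1ℤ 3 6 ∙ rtheta -1ℤ 3 15 ≈ φ⁻ 9 ∙ ψ 9
θ₃₆θ₃₁₅ = begin
  rtheta 1ℤ 3 6 ∙ rtheta -1ℤ 3 15   ≈⟨ ∙-cong (rtheta-dilate 3 1ℤ 1 2) (rtheta-dilate 3 -1ℤ 1 5) ⟩
  dilate 3 θ₁₂ ∙ dilate 3 θ₁₅           ≈⟨ dilate-∙ 3 θ₁₂ θ₁₅ ⟨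
  dilate 3 (θ₁₂ ∙ θ₁₅)                  ≈⟨ dilate-cong 3 θ₁₂θ₁₅ ⟩
  dilate 3 (φ⁻ 3 ∙ ψ 3)             ≈⟨ dilate-∙ 3 (φ⁻ 3) (ψ 3) ⟩
  dilate 3 (φ⁻ 3) ∙ dilate 3 (ψ 3)  ≈⟨ ∙-cong (rtheta-dilate 3 -1ℤ 3 3) (rtheta-dilate 3 1ℤ 3 9) ⟨
  φ⁻ 9 ∙ ψ 9                        ∎
  where open ≈-Reasoning

-- With φ(-q) = a - 2qd and ψ(q) = u + qp, the relevant part of ψ(q) φ(-q)³ is
-- q²(12ad²u - 6a²dp), and ud = ap.
ψφ⁻³-trisect : extract 3 2 (ψ 1 ∙ (φ⁻ 1 ∙ φ⁻ 1 ∙ φ⁻ 1)) ≈ const (+ 6) ∙ (φ⁻ 3 ∙ φ⁻ 3 ∙ (θ₁₅ ∙ ψ 3))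
ψφ⁻³-trisect = begin
  extract 3 2 (ψ 1 ∙ (φ⁻ 1 ∙ φ⁻ 1 ∙ φ⁻ 1))
    ≈⟨ extract-cong 3 2 expansion ⟩
  extract 3 2 (B₀ ⊕ mono 1 ∙ B₁ ⊕ mono 2 ∙ B₂)
    ≈⟨ extract-cong 3 2 (⊕-cong (⊕-cong (proj₂ D₀) (∙-congˡ (proj₂ D₁))) (∙-congˡ B₂-dilated)) ⟩
  extract 3 2 (dilate 3 (proj₁ D₀) ⊕ mono 1 ∙ dilate 3 (proj₁ D₁) ⊕ mono 2 ∙ dilate 3 R)
    ≈⟨ ≈-trans (extract-⊕ 3 2 _ _) (⊕-congʳ (extract-⊕ 3 2 _ _)) ⟩
  extract 3 2 (dilate 3 (proj₁ D₀)) ⊕ extract 3 2 (mono 1 ∙ dilate 3 (proj₁ D₁)) ⊕ extract 3 2 (mono 2 ∙ dilate 3 R)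
    ≈⟨ ⊕-cong (⊕-cong (extract-dilated-0 3 2 2<3 (proj₁ D₀)) (extract-mono-∙-0 3 2<3 (s≤s (s≤s z≤n)) (λ ()) (proj₁ D₁)))
         (extract-mono-∙ 3 2 2<3 R) ⟩
  zeroS ⊕ zeroS ⊕ R
    ≈⟨ ≈-trans (⊕-congʳ (⊕-identityˡ zeroS)) (⊕-identityˡ R) ⟩
  R ∎
  where
  open ≈-Reasoning
  2<3 : 2 < 3
  2<3 = s≤s (s≤s (s≤s z≤n))
  a d u p R B₀ B₁ B₂ : Series
  a = φ⁻ 9
  d = rtheta -1ℤ 3 15
  u = rtheta 1ℤ 3 6
  p = ψ 9
  R = const (+ 6) ∙ (φ⁻ 3 ∙ φ⁻ 3 ∙ (θ₁₅ ∙ ψ 3))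
  B₀ = u ∙ (a ∙ (a ∙ a)) ⊕ mono 3 ∙ (const (-[1+ 7 ]) ∙ (u ∙ (d ∙ (d ∙ d))) ⊕ const (+ 12) ∙ (p ∙ (a ∙ (d ∙ d))))
  B₁ = p ∙ (a ∙ (a ∙ a)) ⊕ const (-[1+ 5 ]) ∙ (u ∙ (a ∙ (a ∙ d))) ⊕ mono 3 ∙ (const (-[1+ 7 ]) ∙ (p ∙ (d ∙ (d ∙ d))))
  B₂ = const (+ 12) ∙ (a ∙ d ∙ (u ∙ d)) ⊕ const (-[1+ 5 ]) ∙ (a ∙ a ∙ (d ∙ p))
  expansion : ψ 1 ∙ (φ⁻ 1 ∙ φ⁻ 1 ∙ φ⁻ 1) ≈ B₀ ⊕ mono 1 ∙ B₁ ⊕ mono 2 ∙ B₂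
  expansion = begin
    ψ 1 ∙ (φ⁻ 1 ∙ φ⁻ 1 ∙ φ⁻ 1)
      ≈⟨ ∙-cong ψ-trisect (∙-cong (∙-cong φ⁻-trisect φ⁻-trisect) φ⁻-trisect) ⟩
    (u ⊕ x ∙ p) ∙ ((a ⊕ const (-[1+ 1 ]) ∙ (x ∙ d)) ∙ (a ⊕ const (-[1+ 1 ]) ∙ (x ∙ d)) ∙ (a ⊕ const (-[1+ 1 ]) ∙ (x ∙ d)))
      ≈⟨ SR.solve 5 (λ u p a d x → 
           (u :+ x :* p) :* ((a :+ con (-[1+ 1 ]) :* (x :* d)) :* (a :+ con (-[1+ 1 ]) :* (x :* d)) :* (a :+ con (-[1+ 1 ]) :* (x :* d))) :=
           u :* (a :* (a :* a)) :+ x :* (x :* x) :* (con (-[1+ 7 ]) :* (u :* (d :* (d :* d))) :+ con (+ 12) :* (p :* (a :* (d :* d))))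
           :+ x :* (p :* (a :* (a :* a)) :+ con (-[1+ 5 ]) :* (u :* (a :* (a :* d))) :+ x :* (x :* x) :* (con (-[1+ 7 ]) :* (p :* (d :* (d :* d)))))
           :+ x :* x :* (con (+ 12) :* (a :* d :* (u :* d)) :+ con (-[1+ 5 ]) :* (a :* a :* (d :* p)))) ≈-refl u p a d x ⟩
    u ∙ (a ∙ (a ∙ a)) ⊕ x ∙ (x ∙ x) ∙ (const (-[1+ 7 ]) ∙ (u ∙ (d ∙ (d ∙ d))) ⊕ const (+ 12) ∙ (p ∙ (a ∙ (d ∙ d))))
      ⊕ x ∙ (p ∙ (a ∙ (a ∙ a)) ⊕ const (-[1+ 5 ]) ∙ (u ∙ (a ∙ (a ∙ d))) ⊕ x ∙ (x ∙ x) ∙ (const (-[1+ 7 ]) ∙ (p ∙ (d ∙ (d ∙ d)))))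
      ⊕ x ∙ x ∙ B₂
      ≈⟨ ⊕-cong (⊕-cong (⊕-congˡ (∙-congʳ x³)) (∙-congˡ (⊕-congˡ (∙-congʳ x³)))) (∙-congʳ (mono-+ 1 1)) ⟩
    B₀ ⊕ mono 1 ∙ B₁ ⊕ mono 2 ∙ B₂ ∎
    where
    x = mono 1
    x³ : x ∙ (x ∙ x) ≈ mono 3
    x³ = ≈-trans (∙-congˡ (mono-+ 1 1)) (mono-+ 1 2)
  Da : Dilated 3 a
  Da = Dilated-rtheta 3 -1ℤ 3 3
  Dd : Dilated 3 d
  Dd = Dilated-rtheta 3 -1ℤ 1 5
  Du : Dilated 3 u
  Du = Dilated-rtheta 3 1ℤ 1 2
  Dp : Dilated 3 p
  Dp = Dilated-rtheta 3 1ℤ 3 9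
  infixr 7 _⊗_
  _⊗_ : ∀ {s t} → Dilated 3 s → Dilated 3 t → Dilated 3 (s ∙ t)
  _⊗_ = Dilated-∙ 3
  D₀ : Dilated 3 B₀
  D₀ = Dilated-⊕ 3 (Du ⊗ Da ⊗ Da ⊗ Da) (Dilated-mono 3 1 ⊗ Dilated-⊕ 3
    (Dilated-const-∙ 3 (-[1+ 7 ]) (Du ⊗ Dd ⊗ Dd ⊗ Dd)) (Dilated-const-∙ 3 (+ 12) (Dp ⊗ Da ⊗ Dd ⊗ Dd)))
  D₁ : Dilated 3 B₁
  D₁ = Dilated-⊕ 3 (Dilated-⊕ 3 (Dp ⊗ Da ⊗ Da ⊗ Da) (Dilated-const-∙ 3 (-[1+ 5 ]) (Du ⊗ Da ⊗ Da ⊗ Dd)))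
    (Dilated-mono 3 1 ⊗ Dilated-const-∙ 3 (-[1+ 7 ]) (Dp ⊗ Dd ⊗ Dd ⊗ Dd))
  B₂-dilated : B₂ ≈ dilate 3 R
  B₂-dilated = begin
    const (+ 12) ∙ (a ∙ d ∙ (u ∙ d)) ⊕ const (-[1+ 5 ]) ∙ (a ∙ a ∙ (d ∙ p))
      ≈⟨ ⊕-congʳ (∙-congˡ (∙-congˡ θ₃₆θ₃₁₅)) ⟩
    const (+ 12) ∙ (a ∙ d ∙ (a ∙ p)) ⊕ const (-[1+ 5 ]) ∙ (a ∙ a ∙ (d ∙ p))
      ≈⟨ SR.solve 3 (λ a d p → con (+ 12) :* (a :* d :* (a :* p)) :+ con (-[1+ 5 ]) :* (a :* a :* (d :* p))
           := con (+ 6) :* (a :* a :* (d :* p))) ≈-refl a d p ⟩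
    const (+ 6) ∙ (a ∙ a ∙ (d ∙ p))
      ≈⟨ proj₂ (Dilated-const-∙ 3 (+ 6) ((Da ⊗ Da) ⊗ (Dd ⊗ Dp))) ⟩
    dilate 3 R ∎

-- Congruences between power series

infix 4 _≡_[mod_]
record _≡_[mod_] (f g : Series) (k : ℤ) : Set where
  constructor congruent
  field
    quotient : Series
    relation : f ≈ g ⊕ const k ∙ quotient
open _≡_[mod_]

≈⇒mod : ∀ {k f g} → f ≈ g → f ≡ g [mod k ]
≈⇒mod {k} {f} {g} p = congruent zeroS (≈-trans p (≈-sym (≈-trans (⊕-congˡ (∙-zeroʳ (const k))) (⊕-identityʳ g))))

mod-refl : ∀ {k f} → f ≡ f [mod k ]
mod-refl = ≈⇒mod ≈-refl

mod-sym : ∀ {k f g} → f ≡ g [mod k ] → g ≡ f [mod k ]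
mod-sym {k} {f} {g} (congruent q p) = congruent (const -1ℤ ∙ q) (≈-trans
  (SR.solve 3 (λ g k q → g := g :+ k :* q :+ k :* (con -1ℤ :* q)) ≈-refl g (const k) q)
  (⊕-congʳ (≈-sym p)))

mod-trans : ∀ {k f g h} → f ≡ g [mod k ] → g ≡ h [mod k ] → f ≡ h [mod k ]
mod-trans {k} {f} {g} {h} (congruent q p) (congruent q′ p′) = congruent (q′ ⊕ q) (≈-trans p (≈-trans (⊕-congʳ p′)
  (SR.solve 4 (λ h k q q′ → h :+ k :* q′ :+ k :* q := h :+ k :* (q′ :+ q)) ≈-refl h (const k) q q′)))

∙-mod : ∀ {k f f′ g g′} → f ≡ f′ [mod k ] → g ≡ g′ [mod k ] → f ∙ g ≡ f′ ∙ g′ [mod k ]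
∙-mod {k} {f} {f′} {g} {g′} (congruent q p) (congruent r s) = congruent (f′ ∙ r ⊕ g′ ∙ q ⊕ const k ∙ (q ∙ r))
  (≈-trans (∙-cong p s) (SR.solve 5 (λ f g k q r → 
    (f :+ k :* q) :* (g :+ k :* r) := f :* g :+ k :* (f :* r :+ g :* q :+ k :* (q :* r))) ≈-refl f′ g′ (const k) q r))

extract-mod : ∀ d r {k f g} → f ≡ g [mod k ] → extract d r f ≡ extract d r g [mod k ]
extract-mod d r {k} {f} {g} (congruent q p) = congruent (extract d r q) (≈-trans (extract-cong d r p)
  (≈-trans (extract-⊕ d r g (const k ∙ q)) (⊕-congˡ (extract-const d r k q))))

-- A constant factor raises the modulus; this is what permits weaker congruences for the cofactor
-- once a constant has been split off.
scale-mod : ∀ c {k f g} → f ≡ g [mod k ] → const c ∙ f ≡ const c ∙ g [mod c *ᶻ k ]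
scale-mod c {k} {f} {g} (congruent q p) = congruent q (≈-trans (∙-congˡ p) (≈-trans
  (SR.solve 4 (λ c g k q → c :* (g :+ k :* q) := c :* g :+ c :* k :* q) ≈-refl (const c) g (const k) q)
  (⊕-congˡ (∙-congʳ (const-* c k)))))

weaken-mod : ∀ {k} l {f g} → f ≡ g [mod k *ᶻ l ] → f ≡ g [mod k ]
weaken-mod {k} l {f} {g} (congruent q p) = congruent (const l ∙ q) (≈-trans p (⊕-congˡ
  (≈-trans (∙-congʳ (≈-sym (const-* k l))) (∙-assoc _ _ _))))

mod-setoid : ℤ → Setoid 0ℓ 0ℓ
mod-setoid k = record { Carrier = Series ; _≈_ = λ f g → f ≡ g [mod k ]
  ; isEquivalence = record { refl = mod-refl ; sym = mod-sym ; trans = mod-trans } }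

UnitMod : ℤ → Series → Set
UnitMod k f = f ≡ oneS [mod k ]

unit-∙ : ∀ {k f g} → UnitMod k f → UnitMod k g → UnitMod k (f ∙ g)
unit-∙ p q = mod-trans (∙-mod p q) (≈⇒mod (∙-identityˡ oneS))

absorb : ∀ {k f} → UnitMod k f → ∀ g → g ∙ f ≡ g [mod k ]
absorb p g = mod-trans (∙-mod (mod-refl {f = g}) p) (≈⇒mod (∙-identityʳ g))

-- (1 + 2 l q)² = 1 + 4 l (q + l q²), with q the quotient series: each squaring doubles the modulus,
-- so three squarings lead from 2 to 16.
unit-square : ∀ {l f} → UnitMod (+ 2 *ᶻ l) f → UnitMod (+ 2 *ᶻ (+ 2 *ᶻ l)) (f ∙ f)
unit-square {l} {f} (congruent q p) = congruent (q ⊕ const l ∙ (q ∙ q)) (begin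
  f ∙ f
    ≈⟨ ∙-cong p p ⟩
  (oneS ⊕ const (+ 2 *ᶻ l) ∙ q) ∙ (oneS ⊕ const (+ 2 *ᶻ l) ∙ q)
    ≈⟨ ∙-cong e e ⟩
  (const 1ℤ ⊕ const (+ 2) ∙ const l ∙ q) ∙ (const 1ℤ ⊕ const (+ 2) ∙ const l ∙ q)
    ≈⟨ SR.solve 2 (λ l q → (con 1ℤ :+ con (+ 2) :* l :* q) :* (con 1ℤ :+ con (+ 2) :* l :* q)
         := con 1ℤ :+ con (+ 2) :* (con (+ 2) :* l) :* (q :+ l :* (q :* q))) ≈-refl (const l) q ⟩
  const 1ℤ ⊕ const (+ 2) ∙ (const (+ 2) ∙ const l) ∙ (q ⊕ const l ∙ (q ∙ q))
    ≈⟨ ⊕-cong (≈-sym oneS≈const1) (∙-congʳ (≈-trans (∙-congˡ (const-* (+ 2) l)) (const-* (+ 2) (+ 2 *ᶻ l)))) ⟩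
  oneS ⊕ const (+ 2 *ᶻ (+ 2 *ᶻ l)) ∙ (q ⊕ const l ∙ (q ∙ q)) ∎)
  where
  open ≈-Reasoning
  e : oneS ⊕ const (+ 2 *ᶻ l) ∙ q ≈ const 1ℤ ⊕ const (+ 2) ∙ const l ∙ q
  e = ⊕-cong oneS≈const1 (∙-congʳ (≈-sym (const-* (+ 2) l)))

^ˢ-+ : ∀ s m n → s ^ˢ (m + n) ≈ s ^ˢ m ∙ s ^ˢ n
^ˢ-+ s zero    n = ≈-sym (∙-identityˡ _)
^ˢ-+ s (suc m) n = ≈-trans (∙-congˡ (^ˢ-+ s m n)) (≈-sym (∙-assoc _ _ _))

^ˢ-∙ : ∀ s t n → (s ∙ t) ^ˢ n ≈ s ^ˢ n ∙ t ^ˢ n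
^ˢ-∙ s t zero    = ≈-sym (∙-identityˡ oneS)
^ˢ-∙ s t (suc n) = ≈-trans (∙-congˡ (^ˢ-∙ s t n))
  (∙-interchange s t (s ^ˢ n) (t ^ˢ n))

^ˢ-cong : ∀ {s t} → s ≈ t → ∀ n → s ^ˢ n ≈ t ^ˢ n
^ˢ-cong p zero    = ≈-refl
^ˢ-cong p (suc n) = ∙-cong p (^ˢ-cong p n)

unit-double : ∀ {l f} → ∀ n → UnitMod (+ 2 *ᶻ l) (f ^ˢ n) → UnitMod (+ 2 *ᶻ (+ 2 *ᶻ l)) (f ^ˢ (n + n))
unit-double n p = mod-trans (≈⇒mod (^ˢ-+ _ n n)) (unit-square p)

module _ {f : Series} (p : UnitMod (+ 2) f) where

  unit-^2 : UnitMod (+ 4) (f ^ˢ 2)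
  unit-^2 = unit-double {+ 1} 1 (mod-trans (≈⇒mod (∙-identityʳ f)) p)

  unit-^4 : UnitMod (+ 8) (f ^ˢ 4)
  unit-^4 = unit-double {+ 2} 2 unit-^2

  unit-^8 : UnitMod (+ 16) (f ^ˢ 8)
  unit-^8 = unit-double {+ 4} 4 unit-^4

  unit-^8m : ∀ m → UnitMod (+ 16) (f ^ˢ (8 * m))
  unit-^8m m = mod-trans (≈⇒mod (≡⇒≈ (cong (f ^ˢ_) (ℕₚ.*-comm 8 m)))) (go m)
    where
    go : ∀ m → UnitMod (+ 16) (f ^ˢ (m * 8))
    go zero    = mod-refl
    go (suc m) = mod-trans (≈⇒mod (^ˢ-+ f 8 (m * 8))) (unit-∙ unit-^8 (go m))

  unit-double-factor : UnitMod (+ 4) (f ∙ f)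
  unit-double-factor = mod-trans (≈⇒mod (∙-congˡ (≈-sym (∙-identityʳ f)))) unit-^2

-- The terms at x and -x are equal, so modulo 2 only the term at x = 0 survives.
φ-unit : ∀ ε k .{{_ : NonZero k}} → UnitMod (+ 2) (rtheta ε k k)
φ-unit ε k@(suc _) = congruent (λ n → half n (u n)) (pointwise λ n → begin
  zsum n (u n)                                   ≡⟨ paired n (u n) (even n) ⟩
  u n 0ℤ +ᶻ + 2 *ᶻ half n (u n)                  ≡⟨ cong (_+ᶻ + 2 *ᶻ half n (u n)) (centre n) ⟩
  δ n 0 +ᶻ + 2 *ᶻ half n (u n)                   ≡⟨ cong (δ n 0 +ᶻ_) (at (const-∙ (+ 2) (λ n → half n (u n))) n) ⟨
  oneS n +ᶻ (const (+ 2) ∙ (λ n → half n (u n))) n ≡⟨ ⊕-at _ _ n ⟨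
  (oneS ⊕ const (+ 2) ∙ (λ n → half n (u n))) n  ∎)
  where
  open ≡-Reasoning
  u : ℕ → ℤ → ℤ
  u n x = zpow ε ℤ.∣ x ∣ *ᶻ δ (rexp k k x) n
  half : ℕ → (ℤ → ℤ) → ℤ
  half zero    v = 0ℤ
  half (suc B) v = half B v +ᶻ v (+ suc B)
  paired : ∀ B v → (∀ m → v -[1+ m ] ≡ v (+ suc m)) → zsum B v ≡ v 0ℤ +ᶻ + 2 *ᶻ half B v
  paired zero    v h = sym (ℤₚ.+-identityʳ (v 0ℤ))
  paired (suc B) v h = trans (cong₂ (λ x y → x +ᶻ (v (+ suc B) +ᶻ y)) (paired B v h) (h B)) (e (v 0ℤ) (half B v) (v (+ suc B)))
    where
    e : ∀ x y z → x +ᶻ + 2 *ᶻ y +ᶻ (z +ᶻ z) ≡ x +ᶻ + 2 *ᶻ (y +ᶻ z)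
    e = ℤ-solve
  even : ∀ n m → u n -[1+ m ] ≡ u n (+ suc m)
  even n m = cong (λ y → zpow ε (suc m) *ᶻ δ y n) (ℕₚ.+-comm (k * triᶻ (+ suc m)) (k * triᶻ -[1+ m ]))
  centre : ∀ n → u n 0ℤ ≡ δ n 0
  centre n = trans (ℤₚ.*-identityˡ _) (trans (cong (λ y → δ y n) (cong₂ _+_ (ℕₚ.*-zeroʳ k) (ℕₚ.*-zeroʳ k))) (δ-comm 0 n))

φ⁺-unit : ∀ k .{{_ : NonZero k}} → UnitMod (+ 2) (φ⁺ k)
φ⁺-unit = φ-unit 1ℤ

φ⁻-unit : ∀ k .{{_ : NonZero k}} → UnitMod (+ 2) (φ⁻ k)
φ⁻-unit = φ-unit -1ℤ

-- The generating function modulo 16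

module Mod16 = SetoidReasoning (mod-setoid (+ 16))
module Mod8 = SetoidReasoning (mod-setoid (+ 8))
module Mod4 = SetoidReasoning (mod-setoid (+ 4))

private
  -- `V` is `U` in q², and `Ū` is `U` at -q. `W` is the series treated by `ψφ⁻³-trisect`.
  U V Ū W : Series
  U = φ⁻ 1 ∙ φ⁻ 3
  V = φ⁻ 2 ∙ φ⁻ 6
  Ū = φ⁺ 1 ∙ φ⁺ 3
  W = ψ 1 ∙ (φ⁻ 1 ∙ φ⁻ 1 ∙ φ⁻ 1)

  U-unit : UnitMod (+ 2) U
  U-unit = unit-∙ (φ⁻-unit 1) (φ⁻-unit 3)

  V-unit : UnitMod (+ 2) V
  V-unit = unit-∙ (φ⁻-unit 2) (φ⁻-unit 6)

  V-dilated : V ≈ dilate 2 U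
  V-dilated = ≈-trans (∙-cong (rtheta-dilate 2 -1ℤ 1 1) (rtheta-dilate 2 -1ℤ 3 3)) (≈-sym (dilate-∙ 2 (φ⁻ 1) (φ⁻ 3)))

  UŪ : U ∙ Ū ≈ V ∙ V
  UŪ = begin
    (φ⁻ 1 ∙ φ⁻ 3) ∙ (φ⁺ 1 ∙ φ⁺ 3)
      ≈⟨ Mon.solve 4 (λ a b c d → (a ⊙ b) ⊙ (c ⊙ d) ⊜ (c ⊙ a) ⊙ (d ⊙ b)) ≈-refl (φ⁻ 1) (φ⁻ 3) (φ⁺ 1) (φ⁺ 3) ⟩
    (φ⁺ 1 ∙ φ⁻ 1) ∙ (φ⁺ 3 ∙ φ⁻ 3)
      ≈⟨ ∙-cong (φ⁺φ⁻ 1) (φ⁺φ⁻ 3) ⟩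
    (φ⁻ 2 ∙ φ⁻ 2) ∙ (φ⁻ 6 ∙ φ⁻ 6)
      ≈⟨ Mon.solve 2 (λ a b → (a ⊙ a) ⊙ (b ⊙ b) ⊜ (a ⊙ b) ⊙ (a ⊙ b)) ≈-refl (φ⁻ 2) (φ⁻ 6) ⟩
    V ∙ V ∎
    where open ≈-Reasoning

-- As V is 1 modulo 2, `schur` is congruent to `schur ∙ V`, a product of two φ's.
schur-unit : UnitMod (+ 2) schur
schur-unit = mod-trans (mod-sym (absorb V-unit schur))
  (mod-trans (≈⇒mod schur-theta) (unit-∙ (φ⁺-unit 1) (φ⁻-unit 3)))

-- V⁸ ≡ 1 replaces division by V with V⁷, which passes the extraction as U⁷ and leaves U⁷ V.
-- Multiplying by Ū⁸ ≡ 1 and using U Ū = V² turns this into V⁷ Ū: now V⁷ is again a series in q²,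
-- and the next bisection concerns Ū alone.
schur-even : extract 2 0 schur ≡ V ^ˢ 7 ∙ Ū [mod + 16 ]
schur-even = begin
  extract 2 0 schur
    ≈⟨ extract-mod 2 0 (absorb (unit-^8 V-unit) schur) ⟨
  extract 2 0 (schur ∙ V ^ˢ 8)
    ≈⟨ ≈⇒mod (extract-cong 2 0 (≈-trans (≈-sym (∙-assoc schur V (V ^ˢ 7)))
         (≈-trans (∙-cong schur-theta (^ˢ-cong V-dilated 7)) (∙-comm _ _)))) ⟩
  extract 2 0 (dilate 2 U ^ˢ 7 ∙ (φ⁺ 1 ∙ φ⁻ 3))
    ≈⟨ ≈⇒mod (extract-dilate-^ˢ 2 (s≤s z≤n) U (φ⁺ 1 ∙ φ⁻ 3) 7) ⟩
  U ^ˢ 7 ∙ extract 2 0 (φ⁺ 1 ∙ φ⁻ 3)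
    ≈⟨ ≈⇒mod (∙-congˡ φ⁺φ⁻₃-even) ⟩
  U ^ˢ 7 ∙ V
    ≈⟨ absorb (unit-^8 (unit-∙ (φ⁺-unit 1) (φ⁺-unit 3))) (U ^ˢ 7 ∙ V) ⟨
  U ^ˢ 7 ∙ V ∙ Ū ^ˢ 8
    ≈⟨ ≈⇒mod (Mon.solve 4 (λ u v w x → (u ⊙ v) ⊙ (w ⊙ x) ⊜ (u ⊙ x) ⊙ (v ⊙ w)) ≈-refl (U ^ˢ 7) V Ū (Ū ^ˢ 7)) ⟩
  (U ^ˢ 7 ∙ Ū ^ˢ 7) ∙ (V ∙ Ū)
    ≈⟨ ≈⇒mod (∙-congʳ (≈-trans (≈-sym (^ˢ-∙ U Ū 7)) (≈-trans (^ˢ-cong UŪ 7) (^ˢ-∙ V V 7)))) ⟩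
  (V ^ˢ 7 ∙ V ^ˢ 7) ∙ (V ∙ Ū)
    ≈⟨ ≈⇒mod (Mon.solve 3 (λ v w x → (w ⊙ w) ⊙ (v ⊙ x) ⊜ (w ⊙ x) ⊙ (v ⊙ w)) ≈-refl V (V ^ˢ 7) Ū) ⟩
  V ^ˢ 7 ∙ Ū ∙ V ^ˢ 8
    ≈⟨ absorb (unit-^8 V-unit) (V ^ˢ 7 ∙ Ū) ⟩
  V ^ˢ 7 ∙ Ū ∎
  where open Mod16

-- With the factor 2 outside, U⁴ ≡ 1 (mod 8) reduces U⁷ to U³. The rest, U³ ψ(q) ψ(q³), regroups as
-- W(q³) W(q), so the coming trisection concerns W alone.
schur-2mod4 : extract 2 1 (extract 2 0 schur) ≡ const (+ 2) ∙ (dilate 3 W ∙ W) [mod + 16 ]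
schur-2mod4 = begin
  extract 2 1 (extract 2 0 schur)
    ≈⟨ extract-mod 2 1 schur-even ⟩
  extract 2 1 (V ^ˢ 7 ∙ Ū)
    ≈⟨ ≈⇒mod (≈-trans (extract-cong 2 1 (∙-congʳ (^ˢ-cong V-dilated 7)))
         (extract-dilate-^ˢ 2 (s≤s (s≤s z≤n)) U Ū 7)) ⟩
  U ^ˢ 7 ∙ extract 2 1 Ū
    ≈⟨ ≈⇒mod (∙-congˡ φφ₃-odd) ⟩
  U ^ˢ 7 ∙ (const (+ 2) ∙ (ψ 1 ∙ ψ 3))
    ≈⟨ ≈⇒mod (Mon.solve 4 (λ u v c x → (u ⊙ v) ⊙ (c ⊙ x) ⊜ c ⊙ (u ⊙ x ⊙ v)) ≈-refl (U ^ˢ 3) (U ^ˢ 4) (const (+ 2)) (ψ 1 ∙ ψ 3) ⟨≈⟩ ^ˢ-+ U 3 4) ⟩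
  const (+ 2) ∙ (U ^ˢ 3 ∙ (ψ 1 ∙ ψ 3) ∙ U ^ˢ 4)
    ≈⟨ scale-mod (+ 2) (absorb (unit-^4 U-unit) (U ^ˢ 3 ∙ (ψ 1 ∙ ψ 3))) ⟩
  const (+ 2) ∙ (U ^ˢ 3 ∙ (ψ 1 ∙ ψ 3))
    ≈⟨ ≈⇒mod (∙-congˡ cube) ⟩
  const (+ 2) ∙ (dilate 3 W ∙ W) ∎
  where
  open Mod16
  _⟨≈⟩_ : ∀ {s t u v} → s ∙ t ≈ u → v ≈ s → v ∙ t ≈ u
  p ⟨≈⟩ q = ≈-trans (∙-congʳ q) p
  W₃ : dilate 3 W ≈ ψ 3 ∙ (φ⁻ 3 ∙ φ⁻ 3 ∙ φ⁻ 3)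
  W₃ = ≈-trans (dilate-∙ 3 (ψ 1) _) (∙-cong (≈-sym (rtheta-dilate 3 1ℤ 1 3))
    (≈-trans (dilate-∙ 3 _ (φ⁻ 1)) (∙-cong (≈-trans (dilate-∙ 3 (φ⁻ 1) (φ⁻ 1)) (∙-cong e e)) e)))
    where
    e : dilate 3 (φ⁻ 1) ≈ φ⁻ 3
    e = ≈-sym (rtheta-dilate 3 -1ℤ 1 1)
  cube : U ^ˢ 3 ∙ (ψ 1 ∙ ψ 3) ≈ dilate 3 W ∙ W
  cube = ≈-trans (∙-congʳ (∙-congˡ (∙-congˡ (∙-identityʳ U)))) (≈-trans
    (Mon.solve 4 (λ a b p q → ((a ⊙ b) ⊙ ((a ⊙ b) ⊙ (a ⊙ b))) ⊙ (p ⊙ q)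
      ⊜ (q ⊙ (b ⊙ b ⊙ b)) ⊙ (p ⊙ (a ⊙ a ⊙ a))) ≈-refl (φ⁻ 1) (φ⁻ 3) (ψ 1) (ψ 3))
    (∙-congʳ (≈-sym W₃)))

-- Squares of φ's are 1 modulo 4, so φ(-q) ≡ φ(-q) φ(q)² = φ(q) φ(-q²)² ≡ φ(q).
φ⁻≡φ⁺ : φ⁻ 1 ≡ φ⁺ 1 [mod + 4 ]
φ⁻≡φ⁺ = begin
  φ⁻ 1                      ≈⟨ absorb (unit-double-factor (φ⁺-unit 1)) (φ⁻ 1) ⟨
  φ⁻ 1 ∙ (φ⁺ 1 ∙ φ⁺ 1)
    ≈⟨ ≈⇒mod (≈-trans (Mon.solve 2 (λ m p → m ⊙ (p ⊙ p) ⊜ p ⊙ (p ⊙ m)) ≈-refl (φ⁻ 1) (φ⁺ 1))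
         (∙-congˡ (φ⁺φ⁻ 1))) ⟩
  φ⁺ 1 ∙ (φ⁻ 2 ∙ φ⁻ 2)      ≈⟨ absorb (unit-double-factor (φ⁻-unit 2)) (φ⁺ 1) ⟩
  φ⁺ 1                      ∎
  where open Mod4

-- Dropping squares of φ's leaves `θ₁₅` ψ(q) ψ(q³) φ(-q). Then `θ₁₅ψ1` supplies a second ψ(q³), and
-- ψ(q³)² = ψ(q⁶) φ(q³) separates the series f_2 ψ(q⁶) in q² from Ū.
Z-mod4 : W ∙ (φ⁻ 3 ∙ φ⁻ 3 ∙ (θ₁₅ ∙ ψ 3)) ≡ η 2 ∙ (ψ 6 ∙ Ū) [mod + 4 ]
Z-mod4 = begin
  W ∙ (φ⁻ 3 ∙ φ⁻ 3 ∙ (θ₁₅ ∙ ψ 3))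
    ≈⟨ ≈⇒mod (Mon.solve 5 (λ p m n b q → (p ⊙ (m ⊙ m ⊙ m)) ⊙ (n ⊙ n ⊙ (b ⊙ q))
         ⊜ b ⊙ p ⊙ q ⊙ m ⊙ (m ⊙ m) ⊙ (n ⊙ n)) ≈-refl (ψ 1) (φ⁻ 1) (φ⁻ 3) θ₁₅ (ψ 3)) ⟩
  θ₁₅ ∙ ψ 1 ∙ ψ 3 ∙ φ⁻ 1 ∙ (φ⁻ 1 ∙ φ⁻ 1) ∙ (φ⁻ 3 ∙ φ⁻ 3)
    ≈⟨ mod-trans (absorb (unit-double-factor (φ⁻-unit 3)) _) (absorb (unit-double-factor (φ⁻-unit 1)) _) ⟩
  θ₁₅ ∙ ψ 1 ∙ ψ 3 ∙ φ⁻ 1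
    ≈⟨ ∙-mod (≈⇒mod (≈-trans (∙-congʳ θ₁₅ψ1) (≈-trans (∙-assoc _ _ _) (∙-congˡ (ψ-squared 3))))) φ⁻≡φ⁺ ⟩
  η 2 ∙ (ψ 6 ∙ φ⁺ 3) ∙ φ⁺ 1
    ≈⟨ ≈⇒mod (Mon.solve 4 (λ e p a c → e ⊙ (p ⊙ a) ⊙ c ⊜ e ⊙ (p ⊙ (c ⊙ a))) ≈-refl (η 2) (ψ 6) (φ⁺ 3) (φ⁺ 1)) ⟩
  η 2 ∙ (ψ 6 ∙ Ū) ∎
  where open Mod4

η2-dilated : η 2 ≈ dilate 2 (η 1)
η2-dilated = ≈-trans η2-theta (≈-trans (rtheta-dilate 2 -1ℤ 1 2) (dilate-cong 2 (≈-sym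
  (≈-trans (qprod-trisect -1ℤ 1 1) (≈-sym (jacobi-triple-product -1ℤ refl 1 2))))))

-- Only Ū is dissected, with odd part 2 ψ(q) ψ(q³). The perfect square arises because f_1 ψ(q) =
-- f_2² and the second ψ(q³) comes from ψ(q⁶).
Y-odd : extract 2 1 (η 2 ∙ (ψ 6 ∙ Ū)) ≈ const (+ 2) ∙ ((η 2 ∙ ψ 3) ∙ (η 2 ∙ ψ 3))
Y-odd = begin
  extract 2 1 (η 2 ∙ (ψ 6 ∙ Ū))
    ≈⟨ extract-cong 2 1 (∙-cong η2-dilated (∙-congʳ (rtheta-dilate 2 1ℤ 3 9))) ⟩
  extract 2 1 (dilate 2 (η 1) ∙ (dilate 2 (ψ 3) ∙ Ū))
    ≈⟨ ≈-trans (extract-dilate 2 (s≤s (s≤s z≤n)) (η 1) _) (∙-congˡ (extract-dilate 2 (s≤s (s≤s z≤n)) (ψ 3) Ū)) ⟩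
  η 1 ∙ (ψ 3 ∙ extract 2 1 Ū)
    ≈⟨ ∙-congˡ (∙-congˡ φφ₃-odd) ⟩
  η 1 ∙ (ψ 3 ∙ (const (+ 2) ∙ (ψ 1 ∙ ψ 3)))
    ≈⟨ Mon.solve 4 (λ e p c q → e ⊙ (p ⊙ (c ⊙ (q ⊙ p))) ⊜ c ⊙ ((e ⊙ q) ⊙ (p ⊙ p))) ≈-refl (η 1) (ψ 3) (const (+ 2)) (ψ 1) ⟩
  const (+ 2) ∙ ((η 1 ∙ ψ 1) ∙ (ψ 3 ∙ ψ 3))
    ≈⟨ ∙-congˡ (≈-trans (∙-congʳ η1ψ1)
         (Mon.solve 2 (λ e p → (e ⊙ e) ⊙ (p ⊙ p) ⊜ (e ⊙ p) ⊙ (e ⊙ p)) ≈-refl (η 2) (ψ 3))) ⟩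
  const (+ 2) ∙ ((η 2 ∙ ψ 3) ∙ (η 2 ∙ ψ 3)) ∎
  where open ≈-Reasoning

schur-extraction : extract 2 1 (extract 3 2 (extract 2 1 (extract 2 0 schur))) ≡
  const (+ 24) ∙ ((η 2 ∙ ψ 3) ∙ (η 2 ∙ ψ 3)) [mod + 16 ]
schur-extraction = begin
  extract 2 1 (extract 3 2 (extract 2 1 (extract 2 0 schur)))
    ≈⟨ extract-mod 2 1 (extract-mod 3 2 schur-2mod4) ⟩
  extract 2 1 (extract 3 2 (const (+ 2) ∙ (dilate 3 W ∙ W)))
    ≈⟨ ≈⇒mod (extract-cong 2 1 (≈-trans (extract-const 3 2 (+ 2) _) (∙-congˡ
         (≈-trans (extract-dilate 3 (s≤s (s≤s (s≤s z≤n))) W W) (∙-congˡ ψφ⁻³-trisect))))) ⟩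
  extract 2 1 (const (+ 2) ∙ (W ∙ (const (+ 6) ∙ Z)))
    ≈⟨ ≈⇒mod (extract-cong 2 1 (SR.solve 2 (λ w z → con (+ 2) :* (w :* (con (+ 6) :* z)) := con (+ 12) :* (w :* z)) ≈-refl W Z)) ⟩
  extract 2 1 (const (+ 12) ∙ (W ∙ Z))
    -- 12 · 4 = 16 · 3, so behind the factor 12 a congruence modulo 4 is enough.
    ≈⟨ extract-mod 2 1 (weaken-mod (+ 3) (scale-mod (+ 12) Z-mod4)) ⟩
  extract 2 1 (const (+ 12) ∙ (η 2 ∙ (ψ 6 ∙ Ū)))
    ≈⟨ ≈⇒mod (≈-trans (extract-const 2 1 (+ 12) _) (∙-congˡ Y-odd)) ⟩
  const (+ 12) ∙ (const (+ 2) ∙ ((η 2 ∙ ψ 3) ∙ (η 2 ∙ ψ 3)))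
    ≈⟨ ≈⇒mod (≈-trans (≈-sym (∙-assoc _ _ _)) (∙-congʳ (const-* (+ 12) (+ 2)))) ⟩
  const (+ 24) ∙ ((η 2 ∙ ψ 3) ∙ (η 2 ∙ ψ 3)) ∎
  where
  open Mod16
  Z = φ⁻ 3 ∙ φ⁻ 3 ∙ (θ₁₅ ∙ ψ 3)

-- In coefficient 2n of s² the products s_i s_(2n-i) with i ≠ n occur in equal pairs, and s_n² is 0.
-- The induction removes the outermost pair by passing to `tail s`.
square-even : ∀ n s → s n ≡ 0ℤ → ∃[ x ] (s ∙ s) (n * 2) ≡ + 2 *ᶻ x
square-even zero    s p = 0ℤ , trans (∙-at s s 0) (cong₂ _*ᶻ_ p p)
square-even (suc n) s p with square-even n (tail s) p
... | x , q = s 0 *ᶻ s (2 + n * 2) +ᶻ x , (begin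
  (s ∙ s) (2 + n * 2)
    ≡⟨ ∙-suc s s (1 + n * 2) ⟩
  s 0 *ᶻ s (2 + n * 2) +ᶻ (tail s ∙ s) (1 + n * 2)
    ≡⟨ cong (s 0 *ᶻ s (2 + n * 2) +ᶻ_) (trans (at (∙-comm (tail s) s) (1 + n * 2)) (∙-suc s (tail s) (n * 2))) ⟩
  s 0 *ᶻ s (2 + n * 2) +ᶻ (s 0 *ᶻ s (2 + n * 2) +ᶻ (tail s ∙ tail s) (n * 2))
    ≡⟨ cong (λ y → s 0 *ᶻ s (2 + n * 2) +ᶻ (s 0 *ᶻ s (2 + n * 2) +ᶻ y)) q ⟩
  s 0 *ᶻ s (2 + n * 2) +ᶻ (s 0 *ᶻ s (2 + n * 2) +ᶻ + 2 *ᶻ x)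
    ≡⟨ e (s 0 *ᶻ s (2 + n * 2)) x ⟩
  + 2 *ᶻ (s 0 *ᶻ s (2 + n * 2) +ᶻ x) ∎)
  where
  open ≡-Reasoning
  e : ∀ y x → y +ᶻ (y +ᶻ + 2 *ᶻ x) ≡ + 2 *ᶻ (y +ᶻ x)
  e = ℤ-solve

η2ψ3-vanishes : ∀ K → (∀ x y → rexp 2 4 x + rexp 3 9 y ≢ K) → (η 2 ∙ ψ 3) K ≡ 0ℤ
η2ψ3-vanishes K norep = trans (at (∙-congʳ η2-theta) K)
  (trans (theta-product (λ x → zpow -1ℤ ℤ.∣ x ∣) (λ x → zpow 1ℤ ℤ.∣ x ∣) (rexp-coercive 2 4) (rexp-coercive 3 9) ℕₚ.≤-refl ℕₚ.≤-refl)
    (zsum-0 K λ x → zsum-0 K λ y → *ᶻ-δ-≢ (zpow -1ℤ ℤ.∣ x ∣ *ᶻ zpow 1ℤ ℤ.∣ y ∣) (norep x y)))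

mod-at : ∀ {k f g} → f ≡ g [mod k ] → ∀ n → ∃[ q ] f n ≡ g n +ᶻ k *ᶻ q
mod-at {k} {f} {g} (congruent q p) n = q n , trans (at p n)
  (trans (⊕-at g (const k ∙ q) n) (cong (g n +ᶻ_) (at (const-∙ k q) n)))

schur-coefficient : ∀ K → (η 2 ∙ ψ 3) K ≡ 0ℤ →
  ∃[ q ] extract 2 1 (extract 3 2 (extract 2 1 (extract 2 0 schur))) (K * 2) ≡ + 16 *ᶻ q
schur-coefficient K vanishes = + 3 *ᶻ proj₁ even +ᶻ proj₁ remainder ,
  trans (proj₂ remainder) (trans (cong (_+ᶻ + 16 *ᶻ proj₁ remainder) (trans
    (at (const-∙ (+ 24) (s ∙ s)) (K * 2)) (cong (+ 24 *ᶻ_) (proj₂ even)))) (e (proj₁ even) (proj₁ remainder)))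
  where
  s : Series
  s = η 2 ∙ ψ 3
  even : ∃[ x ] (s ∙ s) (K * 2) ≡ + 2 *ᶻ x
  even = square-even K s vanishes
  remainder : ∃[ q ] extract 2 1 (extract 3 2 (extract 2 1 (extract 2 0 schur))) (K * 2) ≡
    (const (+ 24) ∙ (s ∙ s)) (K * 2) +ᶻ + 16 *ᶻ q
  remainder = mod-at schur-extraction (K * 2)
  e : ∀ x q → + 24 *ᶻ (+ 2 *ᶻ x) +ᶻ + 16 *ᶻ q ≡ + 16 *ᶻ (+ 3 *ᶻ x +ᶻ q)
  e = ℤ-solve

schur-power : ∀ m → schur ^ˢ (8 * m + 1) ≡ schur [mod + 16 ]
schur-power m = mod-trans
  (≈⇒mod (≈-trans (^ˢ-+ schur (8 * m) 1) (≈-trans (∙-congˡ (∙-identityʳ schur)) (∙-comm (schur ^ˢ (8 * m)) schur))))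
  (absorb (unit-^8m schur-unit m) schur)

-- The residues 0 mod 2, 1 mod 2, 2 mod 3 and 1 mod 2 read from the inside out, applied to the even
-- index 2K that `square-even` requires.
extract-index : ∀ K → 48 * K + 22 ≡ (((K * 2 * 2 + 1) * 3 + 2) * 2 + 1) * 2 + 0
extract-index = ℕ-solve

S3bar-divisible : ∀ m K → (∀ x y → rexp 2 4 x + rexp 3 9 y ≢ K) → + 16 ∣ S3bar (8 * m + 1) (48 * K + 22)
S3bar-divisible m K norep = Signed.∣⇒∣ᵤ (Signed.divides (proj₁ x +ᶻ proj₁ q) (begin
  S3bar (8 * m + 1) (48 * K + 22)            ≡⟨ S3bar-schur (8 * m + 1) (48 * K + 22) ⟩
  (schur ^ˢ (8 * m + 1)) (48 * K + 22)       ≡⟨ proj₂ q ⟩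
  schur (48 * K + 22) +ᶻ + 16 *ᶻ proj₁ q
    ≡⟨ cong (_+ᶻ + 16 *ᶻ proj₁ q) (trans (cong schur (extract-index K)) (proj₂ x)) ⟩
  + 16 *ᶻ proj₁ x +ᶻ + 16 *ᶻ proj₁ q         ≡⟨ e (proj₁ x) (proj₁ q) ⟩
  (proj₁ x +ᶻ proj₁ q) *ᶻ + 16               ∎))
  where
  open ≡-Reasoning
  q : ∃[ q ] (schur ^ˢ (8 * m + 1)) (48 * K + 22) ≡ schur (48 * K + 22) +ᶻ + 16 *ᶻ q
  q = mod-at (schur-power m) (48 * K + 22)
  x : ∃[ x ] extract 2 1 (extract 3 2 (extract 2 1 (extract 2 0 schur))) (K * 2) ≡ + 16 *ᶻ x
  x = schur-coefficient K (η2ψ3-vanishes K norep)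
  e : ∀ x q → + 16 *ᶻ x +ᶻ + 16 *ᶻ q ≡ (x +ᶻ q) *ᶻ + 16
  e = ℤ-solve

-- The quadratic form 2X² + 9Y²

-- p^(2α+1), arranged so that one descent step removes one layer p².
odd-power : ℕ → ℕ → ℕ
odd-power p zero    = p
odd-power p (suc α) = p * (p * odd-power p α)

odd-power-^ : ∀ p α → p ^ (2 * α + 1) ≡ odd-power p α
odd-power-^ p zero    = ℕₚ.*-identityʳ p
odd-power-^ p (suc α) = trans (cong (p ^_) (e α)) (cong (λ z → p * (p * z)) (odd-power-^ p α))
  where
  e : ∀ α → 2 * suc α + 1 ≡ suc (suc (2 * α + 1))
  e = ℕ-solve

even-power-^ : ∀ p α → p ^ (2 * α + 2) ≡ p * odd-power p α
even-power-^ p α = trans (cong (p ^_) (ℕₚ.+-suc (2 * α) 1)) (cong (p *_) (odd-power-^ p α))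

square-mod-24 : ∀ r → r < 24 → (r * r) % 24 ≡ 1 ⊎ (2 ℕᵈ.∣ r) ⊎ (3 ℕᵈ.∣ r)
square-mod-24 r = from-yes (ℕₚ.allUpTo? (λ r → ((r * r) % 24 ℕₚ.≟ 1) ⊎-dec ((2 ℕᵈ.∣? r) ⊎-dec (3 ℕᵈ.∣? r))) 24)

module _ {p : ℕ} (pp : Prime p) (5≤p : 5 ≤ p) where

  private instance
    p≢0 : NonZero p
    p≢0 = prime⇒nonZero pp

  small-∤ : ∀ d → 2 ≤ d → d < 5 → ¬ (d ℕᵈ.∣ p)
  small-∤ d 2≤d d<5 d∣p with prime⇒irreducible pp d∣p
  ... | inj₁ refl = ℕₚ.1+n≰n 2≤d
  ... | inj₂ refl = ℕₚ.<⇒≱ d<5 5≤p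

  ∤-small : ∀ d .{{_ : NonZero d}} → d < 5 → ¬ (p ℕᵈ.∣ d)
  ∤-small d d<5 p∣d = ℕₚ.<⇒≱ d<5 (ℕₚ.≤-trans 5≤p (ℕᵈ.∣⇒≤ p∣d))

  prime-square : ∃[ s ] p * p ≡ 1 + 24 * s
  prime-square with square-mod-24 (p % 24) (m%n<n p 24)
  ... | inj₁ eq = (p * p) / 24 , (begin
    p * p                                    ≡⟨ m≡m%n+[m/n]*n (p * p) 24 ⟩
    (p * p) % 24 + (p * p) / 24 * 24         ≡⟨ cong₂ _+_ (trans (%-distribˡ-* p p 24) eq) (ℕₚ.*-comm ((p * p) / 24) 24) ⟩
    1 + 24 * ((p * p) / 24)                  ∎)
    where open ≡-Reasoning
  ... | inj₂ small = ⊥-elim (excluded small)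
    where
    lift : ∀ d → d ℕᵈ.∣ 24 → d ℕᵈ.∣ p % 24 → d ℕᵈ.∣ p
    lift d d∣24 d∣r = subst (d ℕᵈ.∣_) (sym (m≡m%n+[m/n]*n p 24)) (ℕᵈ.∣m∣n⇒∣m+n d∣r (ℕᵈ.∣n⇒∣m*n (p / 24) d∣24))
    excluded : (2 ℕᵈ.∣ p % 24) ⊎ (3 ℕᵈ.∣ p % 24) → ⊥
    excluded (inj₁ 2∣r) = small-∤ 2 (s≤s (s≤s z≤n)) (s≤s (s≤s (s≤s z≤n))) (lift 2 (ℕᵈ.divides 12 refl) 2∣r)
    excluded (inj₂ 3∣r) = small-∤ 3 (s≤s (s≤s z≤n)) (s≤s (s≤s (s≤s (s≤s z≤n)))) (lift 3 (ℕᵈ.divides 8 refl) 3∣r)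

  -- Brings the argument into the form 48K + 22: from p^(2α+2) = 1 + 24 s follows 22 p^(2α+2) = 22 +
  -- 48 · 11 s.
  even-power-mod-24 : ∀ α → ∃[ s ] p * odd-power p α ≡ 1 + 24 * s
  even-power-mod-24 zero    = prime-square
  even-power-mod-24 (suc α) with prime-square | even-power-mod-24 α
  ... | s , eq | t , eq′ = s + t + 24 * (s * t) , (begin
    p * (p * (p * odd-power p α))            ≡⟨ ℕₚ.*-assoc p p _ ⟨
    p * p * (p * odd-power p α)              ≡⟨ cong₂ _*_ eq eq′ ⟩
    (1 + 24 * s) * (1 + 24 * t)              ≡⟨ e s t ⟩
    1 + 24 * (s + t + 24 * (s * t))          ∎)
    where
    open ≡-Reasoning
    e : ∀ s t → (1 + 24 * s) * (1 + 24 * t) ≡ 1 + 24 * (s + t + 24 * (s * t))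
    e = ℕ-solve

  euclid-ℤ : ∀ x y → + p Signed.∣ x *ᶻ y → + p Signed.∣ x ⊎ + p Signed.∣ y
  euclid-ℤ x y p∣xy with euclidsLemma ℤ.∣ x ∣ ℤ.∣ y ∣ pp (subst (p ℕᵈ.∣_) (ℤₚ.abs-* x y) (Signed.∣⇒∣ᵤ p∣xy))
  ... | inj₁ p∣x = inj₁ (Signed.∣ᵤ⇒∣ p∣x)
  ... | inj₂ p∣y = inj₂ (Signed.∣ᵤ⇒∣ p∣y)

  euclid-square : ∀ x → + p Signed.∣ x *ᶻ x → + p Signed.∣ x
  euclid-square x p∣xx with euclid-ℤ x x p∣xx
  ... | inj₁ p∣x = p∣x
  ... | inj₂ p∣x = p∣x

  inverse-mod : ∀ y → ¬ (p ℕᵈ.∣ y) → ∃[ t ] ∃[ c ] t *ᶻ + y ≡ 1ℤ +ᶻ + p *ᶻ c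
  inverse-mod y p∤y with coprime-Bézout {y} {p} coprime
    where
    coprime : Coprime y p
    coprime (d∣y , d∣p) with prime⇒irreducible pp d∣p
    ... | inj₁ d≡1  = d≡1
    ... | inj₂ refl = ⊥-elim (p∤y d∣y)
  ... | Bézout.+- t c eq = + t , + c , trans (sym (ℤₚ.pos-* t y))
    (trans (cong +_ (sym eq)) (cong (1ℤ +ᶻ_) (trans (ℤₚ.pos-* c p) (ℤₚ.*-comm (+ c) (+ p)))))
  ... | Bézout.-+ t c eq = -ᶻ (+ t) , -ᶻ (+ c) , (begin
    (-ᶻ (+ t)) *ᶻ + y                          ≡⟨ e₁ (+ t) (+ y) ⟩
    1ℤ +ᶻ -ᶻ (1ℤ +ᶻ + t *ᶻ + y)                ≡⟨ cong (λ z → 1ℤ +ᶻ -ᶻ (1ℤ +ᶻ z)) (ℤₚ.pos-* t y) ⟨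
    1ℤ +ᶻ -ᶻ (+ (1 + t * y))                   ≡⟨ cong (λ z → 1ℤ +ᶻ -ᶻ z) (trans (cong +_ eq) (ℤₚ.pos-* c p)) ⟩
    1ℤ +ᶻ -ᶻ (+ c *ᶻ + p)                      ≡⟨ e₂ (+ c) (+ p) ⟩
    1ℤ +ᶻ + p *ᶻ (-ᶻ (+ c))                    ∎)
    where
    open ≡-Reasoning
    e₁ : ∀ t y → (-ᶻ t) *ᶻ y ≡ 1ℤ +ᶻ -ᶻ (1ℤ +ᶻ t *ᶻ y)
    e₁ = ℤ-solve
    e₂ : ∀ c p → 1ℤ +ᶻ -ᶻ (c *ᶻ p) ≡ 1ℤ +ᶻ p *ᶻ (-ᶻ c)
    e₂ = ℤ-solve

  module _ (nonresidue : LegendreIsMinusOne -[1+ 17 ] p) where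

    form : ℤ → ℤ → ℤ
    form X Y = + 2 *ᶻ (X *ᶻ X) +ᶻ + 9 *ᶻ (Y *ᶻ Y)

    abs-square : ∀ Y → + ℤ.∣ Y ∣ *ᶻ + ℤ.∣ Y ∣ ≡ Y *ᶻ Y
    abs-square (+ n)    = refl
    abs-square -[1+ n ] = refl

    -- If p ∤ Y, then 2X/Y is a square root of -18 modulo p.
    form-∣ʳ : ∀ X Y → + p Signed.∣ form X Y → + p Signed.∣ Y
    form-∣ʳ X Y (Signed.divides q eq) with p ℕᵈ.∣? ℤ.∣ Y ∣
    ... | yes p∣Y = Signed.∣ᵤ⇒∣ p∣Y
    ... | no p∤Y with inverse-mod ℤ.∣ Y ∣ p∤Y
    -- t inverts y = |Y| modulo p, with t y = 1 + p c. The quotient comes from (2 X t)² + 18 = 2 t²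
    -- (2 X² + 9 y²) + 18 (1 - (t y)²), where p divides both summands.
    ... | t , c , inverse = ⊥-elim (proj₂ nonresidue (+ 2 *ᶻ X *ᶻ t , Signed.∣⇒∣ᵤ {+ p} {(+ 2 *ᶻ X *ᶻ t) *ᶻ (+ 2 *ᶻ X *ᶻ t) +ᶻ + 18} (Signed.divides
        (+ 2 *ᶻ (t *ᶻ t) *ᶻ q +ᶻ -ᶻ (+ 18 *ᶻ (+ 2 *ᶻ c +ᶻ + p *ᶻ (c *ᶻ c)))) (begin
      (+ 2 *ᶻ X *ᶻ t) *ᶻ (+ 2 *ᶻ X *ᶻ t) +ᶻ + 18
        ≡⟨ e₁ X t y ⟩
      + 2 *ᶻ (t *ᶻ t) *ᶻ (+ 2 *ᶻ (X *ᶻ X) +ᶻ + 9 *ᶻ (y *ᶻ y)) +ᶻ + 18 +ᶻ -ᶻ (+ 18 *ᶻ ((t *ᶻ y) *ᶻ (t *ᶻ y)))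
        ≡⟨ cong₂ (λ u v → + 2 *ᶻ (t *ᶻ t) *ᶻ u +ᶻ + 18 +ᶻ -ᶻ (+ 18 *ᶻ (v *ᶻ v)))
             (trans (cong (λ z → + 2 *ᶻ (X *ᶻ X) +ᶻ + 9 *ᶻ z) (abs-square Y)) eq) inverse ⟩
      + 2 *ᶻ (t *ᶻ t) *ᶻ (q *ᶻ + p) +ᶻ + 18 +ᶻ -ᶻ (+ 18 *ᶻ ((1ℤ +ᶻ + p *ᶻ c) *ᶻ (1ℤ +ᶻ + p *ᶻ c)))
        ≡⟨ e₂ (t *ᶻ t) q (+ p) c ⟩
      (+ 2 *ᶻ (t *ᶻ t) *ᶻ q +ᶻ -ᶻ (+ 18 *ᶻ (+ 2 *ᶻ c +ᶻ + p *ᶻ (c *ᶻ c)))) *ᶻ + p ∎))))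
      where
      open ≡-Reasoning
      y = + ℤ.∣ Y ∣
      e₁ : ∀ X t y → (+ 2 *ᶻ X *ᶻ t) *ᶻ (+ 2 *ᶻ X *ᶻ t) +ᶻ + 18 ≡
        + 2 *ᶻ (t *ᶻ t) *ᶻ (+ 2 *ᶻ (X *ᶻ X) +ᶻ + 9 *ᶻ (y *ᶻ y)) +ᶻ + 18 +ᶻ -ᶻ (+ 18 *ᶻ ((t *ᶻ y) *ᶻ (t *ᶻ y)))
      e₁ = ℤ-solve
      e₂ : ∀ s q p c → + 2 *ᶻ s *ᶻ (q *ᶻ p) +ᶻ + 18 +ᶻ -ᶻ (+ 18 *ᶻ ((1ℤ +ᶻ p *ᶻ c) *ᶻ (1ℤ +ᶻ p *ᶻ c))) ≡
        (+ 2 *ᶻ s *ᶻ q +ᶻ -ᶻ (+ 18 *ᶻ (+ 2 *ᶻ c +ᶻ p *ᶻ (c *ᶻ c)))) *ᶻ p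
      e₂ = ℤ-solve

    form-∣ˡ : ∀ X Y → + p Signed.∣ form X Y → + p Signed.∣ X
    form-∣ˡ X Y p∣f with euclid-ℤ (+ 2) (X *ᶻ X) (Signed.∣m+n∣n⇒∣m p∣f
      (Signed.∣n⇒∣m*n (+ 9) (Signed.∣n⇒∣m*n Y (form-∣ʳ X Y p∣f))))
    ... | inj₁ p∣2  = ⊥-elim (∤-small 2 (s≤s (s≤s (s≤s z≤n))) (Signed.∣⇒∣ᵤ p∣2))
    ... | inj₂ p∣XX = euclid-square X p∣XX

    -- If p divides a value of the form, it divides both X and Y, so p² divides the value; one p
    -- cancels and z retains the other.
    form-descent : ∀ X Y z → + (p * z) ≡ form X Y →
      ∃[ X′ ] ∃[ Y′ ] + z ≡ + p *ᶻ form X′ Y′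
    form-descent X Y z eq = X′ , Y′ , ℤₚ.*-cancelˡ-≡ (+ p) (+ z) (+ p *ᶻ form X′ Y′) (begin
      + p *ᶻ + z                        ≡⟨ ℤₚ.pos-* p z ⟨
      + (p * z)                         ≡⟨ eq ⟩
      form X Y                          ≡⟨ cong₂ form (Signed._∣_.equality p∣X) (Signed._∣_.equality p∣Y) ⟩
      form (X′ *ᶻ + p) (Y′ *ᶻ + p)      ≡⟨ e X′ Y′ (+ p) ⟩
      + p *ᶻ (+ p *ᶻ form X′ Y′)        ∎)
      where
      open ≡-Reasoning
      p∣f : + p Signed.∣ form X Y
      p∣f = Signed.divides (+ z) (trans (sym eq) (trans (ℤₚ.pos-* p z) (ℤₚ.*-comm (+ p) (+ z))))
      p∣X : + p Signed.∣ X
      p∣X = form-∣ˡ X Y p∣f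
      p∣Y : + p Signed.∣ Y
      p∣Y = form-∣ʳ X Y p∣f
      X′ Y′ : ℤ
      X′ = Signed.quotient p∣X
      Y′ = Signed.quotient p∣Y
      e : ∀ X Y p → + 2 *ᶻ ((X *ᶻ p) *ᶻ (X *ᶻ p)) +ᶻ + 9 *ᶻ ((Y *ᶻ p) *ᶻ (Y *ᶻ p)) ≡
        p *ᶻ (p *ᶻ (+ 2 *ᶻ (X *ᶻ X) +ᶻ + 9 *ᶻ (Y *ᶻ Y)))
      e = ℤ-solve

    -- Descent on α: each step removes p² from the value and divides X and Y by p. At the last,
    -- single factor p it would force p to divide w.
    form-odd-power : ∀ w → ¬ (p ℕᵈ.∣ w) → ∀ α X Y → + (odd-power p α * w) ≢ form X Y
    form-odd-power w p∤w zero X Y eq = contradict (form-descent X Y w eq)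
      where
      contradict : ¬ (∃[ X′ ] ∃[ Y′ ] + w ≡ + p *ᶻ form X′ Y′)
      contradict (X′ , Y′ , eq′) = p∤w (Signed.∣⇒∣ᵤ {+ p} {+ w}
        (Signed.divides (form X′ Y′) (trans eq′ (ℤₚ.*-comm (+ p) (form X′ Y′)))))
    form-odd-power w p∤w (suc α) X Y eq = contradict (form-descent X Y (p * r * w)
        (trans (cong (λ z → + z) (sym (ℕₚ.*-assoc p (p * r) w))) eq))
      where
      r : ℕ
      r = odd-power p α
      contradict : ¬ (∃[ X′ ] ∃[ Y′ ] + (p * r * w) ≡ + p *ᶻ form X′ Y′)
      contradict (X′ , Y′ , eq′) = form-odd-power w p∤w α X′ Y′ (ℤₚ.*-cancelˡ-≡ (+ p) (+ (r * w)) (form X′ Y′)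
        (trans (sym (ℤₚ.pos-* p (r * w))) (trans (cong (λ z → + z) (sym (ℕₚ.*-assoc p r w))) eq′)))

    -- Modulo p the number is 24 i; a prime p ≥ 5 does not divide 24 = 3 · 2 · 4, and 1 ≤ i ≤ p - 1
    -- excludes p dividing i.
    cofactor-∤ : ∀ n i → 1 ≤ i → i ≤ p ∸ 1 → ¬ (p ℕᵈ.∣ 24 * (p * n + i) + 11 * p)
    cofactor-∤ n i@(suc _) 1≤i i<p p∣w = excluded (euclidsLemma 24 i pp
        (ℕᵈ.∣m+n∣m⇒∣n {p} {p * (24 * n + 11)} {24 * i} (subst (p ℕᵈ.∣_) (e n i p) p∣w) (ℕᵈ.m∣m*n (24 * n + 11))))
      where
      e : ∀ n i p → 24 * (p * n + i) + 11 * p ≡ p * (24 * n + 11) + 24 * i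
      e = ℕ-solve
      excluded₈ : p ℕᵈ.∣ 2 ⊎ p ℕᵈ.∣ 4 → ⊥
      excluded₈ (inj₁ p∣2) = ∤-small 2 (s≤s (s≤s (s≤s z≤n))) p∣2
      excluded₈ (inj₂ p∣4) = ∤-small 4 (s≤s (s≤s (s≤s (s≤s (s≤s z≤n))))) p∣4
      excluded₂₄ : p ℕᵈ.∣ 3 ⊎ p ℕᵈ.∣ 8 → ⊥
      excluded₂₄ (inj₁ p∣3) = ∤-small 3 (s≤s (s≤s (s≤s (s≤s z≤n)))) p∣3
      excluded₂₄ (inj₂ p∣8) = excluded₈ (euclidsLemma 2 4 pp p∣8)
      excluded : p ℕᵈ.∣ 24 ⊎ p ℕᵈ.∣ i → ⊥
      excluded (inj₁ p∣24) = excluded₂₄ (euclidsLemma 3 8 pp p∣24)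
      excluded (inj₂ p∣i)  = ℕₚ.1+n≰n (subst (_≤ p ∸ 1) (sym (ℕₚ.suc-pred p)) (ℕₚ.≤-trans (ℕᵈ.∣⇒≤ p∣i) i<p))

    -- Completing squares: the exponents are 3x² + x and 6y² + 3y, and 24 times their sum plus 11 is
    -- 2 (6x + 1)² + 9 (4y + 1)². For the given K, 24K + 11 is p^(2α+1) times a number prime to p.
    no-representation : ∀ α n i s → 1 ≤ i → i ≤ p ∸ 1 → p * odd-power p α ≡ 1 + 24 * s →
      ∀ x y → rexp 2 4 x + rexp 3 9 y ≢ p * odd-power p α * n + i * odd-power p α + 11 * s
    no-representation α n i s 1≤i i≤ eq x y rep = form-odd-power (24 * (p * n + i) + 11 * p) (cofactor-∤ n i 1≤i i≤)
      α (+ 6 *ᶻ x +ᶻ 1ℤ) (+ 4 *ᶻ y +ᶻ 1ℤ) (begin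
      + (r * (24 * (p * n + i) + 11 * p))
        ≡⟨ cong (λ z → + z) (trans (e₁ r p n i) (trans (cong (λ z → 24 * (p * r * n + i * r) + 11 * z) eq) (e₂ (p * r * n + i * r) s))) ⟩
      + (24 * (p * r * n + i * r + 11 * s) + 11)
        ≡⟨ cong (λ z → + (24 * z + 11)) rep ⟨
      + (24 * (rexp 2 4 x + rexp 3 9 y) + 11)
        ≡⟨ cong (_+ᶻ + 11) (ℤₚ.pos-* 24 (rexp 2 4 x + rexp 3 9 y)) ⟩
      + 24 *ᶻ (+ rexp 2 4 x +ᶻ + rexp 3 9 y) +ᶻ + 11
        ≡⟨ e₃ (+ rexp 2 4 x) (+ rexp 3 9 y) ⟩
      + 12 *ᶻ (+ 2 *ᶻ + rexp 2 4 x +ᶻ + 2 *ᶻ + rexp 3 9 y) +ᶻ + 11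
        ≡⟨ cong₂ (λ u v → + 12 *ᶻ (u +ᶻ v) +ᶻ + 11) (rexp-ℤ 2 4 x) (rexp-ℤ 3 9 y) ⟩
      + 12 *ᶻ (+ 6 *ᶻ (x *ᶻ x) +ᶻ + 2 *ᶻ x +ᶻ (+ 12 *ᶻ (y *ᶻ y) +ᶻ + 6 *ᶻ y)) +ᶻ + 11
        ≡⟨ e₄ x y ⟩
      form (+ 6 *ᶻ x +ᶻ 1ℤ) (+ 4 *ᶻ y +ᶻ 1ℤ) ∎)
      where
      open ≡-Reasoning
      r = odd-power p α
      e₁ : ∀ r p n i → r * (24 * (p * n + i) + 11 * p) ≡ 24 * (p * r * n + i * r) + 11 * (p * r)
      e₁ = ℕ-solve
      e₂ : ∀ u s → 24 * u + 11 * (1 + 24 * s) ≡ 24 * (u + 11 * s) + 11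
      e₂ = ℕ-solve
      e₃ : ∀ u v → + 24 *ᶻ (u +ᶻ v) +ᶻ + 11 ≡ + 12 *ᶻ (+ 2 *ᶻ u +ᶻ + 2 *ᶻ v) +ᶻ + 11
      e₃ = ℤ-solve
      e₄ : ∀ x y → + 12 *ᶻ (+ 6 *ᶻ (x *ᶻ x) +ᶻ + 2 *ᶻ x +ᶻ (+ 12 *ᶻ (y *ᶻ y) +ᶻ + 6 *ᶻ y)) +ᶻ + 11 ≡
        + 2 *ᶻ ((+ 6 *ᶻ x +ᶻ 1ℤ) *ᶻ (+ 6 *ᶻ x +ᶻ 1ℤ)) +ᶻ + 9 *ᶻ ((+ 4 *ᶻ y +ᶻ 1ℤ) *ᶻ (+ 4 *ᶻ y +ᶻ 1ℤ))
      e₄ = ℤ-solve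

theorem4p7 : (p m α n i : ℕ) → Prime p → 5 ≤ p → LegendreIsMinusOne -[1+ 17 ] p →
    1 ≤ i → i ≤ p ∸ 1 →
    (+ 16) ∣ S3bar (8 * m + 1) (48 * p ^ (2 * α + 2) * n + 2 * (24 * i + 11 * p) * p ^ (2 * α + 1))
theorem4p7 p m α n i pp 5≤p nonresidue 1≤i i≤p-1 = subst (λ N → + 16 ∣ S3bar (8 * m + 1) N) (sym argument)
  (S3bar-divisible m (p * r * n + i * r + 11 * s) (no-representation pp 5≤p nonresidue α n i s 1≤i i≤p-1 eq))
  where
  open ≡-Reasoning
  r s : ℕ
  r = odd-power p α
  s = proj₁ (even-power-mod-24 pp 5≤p α)
  eq : p * r ≡ 1 + 24 * s
  eq = proj₂ (even-power-mod-24 pp 5≤p α)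
  argument : 48 * p ^ (2 * α + 2) * n + 2 * (24 * i + 11 * p) * p ^ (2 * α + 1) ≡ 48 * (p * r * n + i * r + 11 * s) + 22
  argument = begin
    48 * p ^ (2 * α + 2) * n + 2 * (24 * i + 11 * p) * p ^ (2 * α + 1)
      ≡⟨ cong₂ (λ u v → 48 * u * n + 2 * (24 * i + 11 * p) * v) (even-power-^ p α) (odd-power-^ p α) ⟩
    48 * (p * r) * n + 2 * (24 * i + 11 * p) * r
      ≡⟨ e₁ p r n i ⟩
    48 * (p * r * n + i * r) + 22 * (p * r)
      ≡⟨ cong (λ z → 48 * (p * r * n + i * r) + 22 * z) eq ⟩
    48 * (p * r * n + i * r) + 22 * (1 + 24 * s)
      ≡⟨ e₂ (p * r * n + i * r) s ⟩
    48 * (p * r * n + i * r + 11 * s) + 22 ∎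
    where
    e₁ : ∀ p r n i → 48 * (p * r) * n + 2 * (24 * i + 11 * p) * r ≡ 48 * (p * r * n + i * r) + 22 * (p * r)
    e₁ = ℕ-solve
    e₂ : ∀ u s → 48 * u + 22 * (1 + 24 * s) ≡ 48 * (u + 11 * s) + 22
    e₂ = ℕ-solve
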